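{- Let $(G,\mathcal{B},\mathcal{L},\mathcal{F})$ be a quasi-biased graph such that $M=M(G,\mathcal{B},\mathcal{L},\mathcal{F})$ is $3$-connected and unbreakable, $G$ is $3$-connected, and $|V(G)|\ge 7$. Then $\mathrm{si}(G)$ can be obtained from a complete graph by deleting the edges of a path of length at most two.
   Context: Graphs are finite with loops and parallel edges allowed; cycles include loops and 2-cycles. A quasi-biased graph $(G,\mathcal{B},\mathcal{L},\mathcal{F})$ is a graph with a partition $(\mathcal{B},\mathcal{L},\mathcal{F})$ of its cycles such that no theta subgraph contains exactly two cycles of $\mathcal{B}$ and every cycle in $\mathcal{L}$ shares a vertex with every cycle in $\mathcal{F}$. $M(G,\mathcal{B},\mathcal{L},\mathcal{F})$ is the matroid on $E(G)$ with circuits: cycles in $\mathcal{B}$; theta subgraphs with no cycle in $\mathcal{B}$; tight handcuffs (two edge-disjoint cycles sharing exactly one vertex) with neither cycle in $\mathcal{B}$; unions of two vertex-disjoint cycles of $\mathcal{L}$; loose handcuffs (two vertex-disjoint cycles plus a minimal path joining them) with both cycles in $\mathcal{F}$. A matroid is unbreakable if it is connected and $M/F$ is connected for every flat $F$. $\mathrm{si}(G)$ is the simplification. -}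

module Defs where

open import Data.Nat using (ℕ; zero; suc; _+_; _≤_; _<_)
open import Data.Bool using (Bool; true; false; if_then_else_)
open import Data.Fin using (Fin; _≟_)
open import Data.Fin.Subset using (Subset; _∈_; _∉_; _⊆_; _∪_; _∩_; ∁; ⊥; ⊤; ⁅_⁆; ∣_∣; Nonempty)
open import Data.Product using (Σ; ∃; _×_; _,_; proj₁; proj₂)
open import Data.Sum using (_⊎_)
open import Data.List using (List; []; _∷_; length)
open import Data.List.Relation.Unary.Unique.Propositional using (Unique)
open import Relation.Nullary using (¬_; does)
open import Relation.Binary.PropositionalEquality using (_≡_; _≢_)
open import Function.Bundles using (_⇔_)

record Graph : Set where
  field
    n    : ℕ
    m    : ℕ
    ends : Fin m → Fin n × Fin n

module _ (G : Graph) where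
  open Graph G

  src tgt : Fin m → Fin n
  src e = proj₁ (ends e)
  tgt e = proj₂ (ends e)

  EdgeSet : Set
  EdgeSet = Subset m

  ∑ : ∀ {k} → (Fin k → ℕ) → ℕ
  ∑ {zero}  f = 0
  ∑ {suc k} f = f Fin.zero + ∑ (λ i → f (Fin.suc i))

  ind : Bool → ℕ
  ind true  = 1
  ind false = 0

  deg : EdgeSet → Fin n → ℕ
  deg S v = ∑ (λ e → if Data.Vec.lookup S e
                        then ind (does (src e ≟ v)) + ind (does (tgt e ≟ v))
                        else 0)
    where import Data.Vec

  InV : EdgeSet → Fin n → Set
  InV S v = ∃ λ e → e ∈ S × (src e ≡ v ⊎ tgt e ≡ v)

  data Reach (ok : Fin m → Set) : Fin n → Fin n → Set where
    here : ∀ {u} → Reach ok u u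
    fwd  : ∀ {u} e → ok e → Reach ok (tgt e) u → Reach ok (src e) u
    bwd  : ∀ {u} e → ok e → Reach ok (src e) u → Reach ok (tgt e) u

  ConnectedES : EdgeSet → Set
  ConnectedES S = ∀ u v → InV S u → InV S v → Reach (λ e → e ∈ S) u v

  -- cycle: nonempty connected 2-regular subgraph (includes loops, 2-cycles)
  IsCycle : EdgeSet → Set
  IsCycle C = Nonempty C × ConnectedES C × (∀ w → deg C w ≡ 0 ⊎ deg C w ≡ 2)

  IsPath : Fin n → Fin n → EdgeSet → Set
  IsPath u v P = u ≢ v × ConnectedES P × deg P u ≡ 1 × deg P v ≡ 1
               × (∀ w → w ≢ u → w ≢ v → deg P w ≡ 0 ⊎ deg P w ≡ 2)

  EdgeDisjoint : EdgeSet → EdgeSet → Set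
  EdgeDisjoint S T = ∀ e → e ∈ S → e ∉ T

  VertexDisjoint : EdgeSet → EdgeSet → Set
  VertexDisjoint S T = ∀ w → InV S w → ¬ InV T w

  IsTheta : EdgeSet → Set
  IsTheta T = ∃ λ u → ∃ λ v → ∃ λ P₁ → ∃ λ P₂ → ∃ λ P₃ →
      IsPath u v P₁ × IsPath u v P₂ × IsPath u v P₃
    × EdgeDisjoint P₁ P₂ × EdgeDisjoint P₁ P₃ × EdgeDisjoint P₂ P₃
    × IntDisj u v P₁ P₂ × IntDisj u v P₁ P₃ × IntDisj u v P₂ P₃
    × T ≡ (P₁ ∪ P₂) ∪ P₃
    where
      IntDisj : Fin n → Fin n → EdgeSet → EdgeSet → Set
      IntDisj u v P Q = ∀ w → InV P w → InV Q w → w ≡ u ⊎ w ≡ v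

  -- Quasi-biased graphs. A partition (𝓑,𝓛,𝓕) of the cycles is given by a
  -- labelling function; only its values on cycles are relevant.

  data Cls : Set where
    𝓑 𝓛 𝓕 : Cls

  -- no theta contains exactly two cycles of 𝓑 (a theta contains exactly
  -- three cycles): if two distinct cycles of a theta are in 𝓑, so are all.
  IsQuasiBiased : (EdgeSet → Cls) → Set
  IsQuasiBiased cls =
      (∀ T → IsTheta T → ∀ C₁ C₂ → IsCycle C₁ → IsCycle C₂ → C₁ ⊆ T → C₂ ⊆ T
         → C₁ ≢ C₂ → cls C₁ ≡ 𝓑 → cls C₂ ≡ 𝓑
         → ∀ C → IsCycle C → C ⊆ T → cls C ≡ 𝓑)
    × (∀ C D → IsCycle C → IsCycle D → cls C ≡ 𝓛 → cls D ≡ 𝓕 →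
         ∃ λ w → InV C w × InV D w)

  module _ (cls : EdgeSet → Cls) where

    IsCircuit : EdgeSet → Set
    IsCircuit X =
        (IsCycle X × cls X ≡ 𝓑)
      ⊎ (IsTheta X × (∀ C → IsCycle C → C ⊆ X → cls C ≢ 𝓑))
      ⊎ (∃ λ C₁ → ∃ λ C₂ → IsCycle C₁ × IsCycle C₂ × EdgeDisjoint C₁ C₂
           × (∃ λ w → InV C₁ w × InV C₂ w × (∀ x → InV C₁ x → InV C₂ x → x ≡ w))
           × cls C₁ ≢ 𝓑 × cls C₂ ≢ 𝓑 × X ≡ C₁ ∪ C₂)
      ⊎ (∃ λ C₁ → ∃ λ C₂ → IsCycle C₁ × IsCycle C₂ × VertexDisjoint C₁ C₂
           × cls C₁ ≡ 𝓛 × cls C₂ ≡ 𝓛 × X ≡ C₁ ∪ C₂)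
      ⊎ (∃ λ C₁ → ∃ λ C₂ → ∃ λ P → ∃ λ u → ∃ λ v →
           IsCycle C₁ × IsCycle C₂ × VertexDisjoint C₁ C₂ × IsPath u v P
           × InV C₁ u × InV C₂ v
           × (∀ x → InV P x → InV C₁ x → x ≡ u)
           × (∀ x → InV P x → InV C₂ x → x ≡ v)
           × cls C₁ ≡ 𝓕 × cls C₂ ≡ 𝓕 × X ≡ (C₁ ∪ C₂) ∪ P)

    Indep : EdgeSet → Set
    Indep I = ∀ C → IsCircuit C → ¬ (C ⊆ I)

    IsRank : EdgeSet → ℕ → Set
    IsRank X r = (∃ λ I → I ⊆ X × Indep I × ∣ I ∣ ≡ r)
               × (∀ I → I ⊆ X → Indep I → ∣ I ∣ ≤ r)

    IsFlat : EdgeSet → Set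
    IsFlat F = ∀ e → e ∉ F → ∀ a b → IsRank F a → IsRank (F ∪ ⁅ e ⁆) b → a < b

    -- M / F is connected: no 1-separation (X, Y) of E - F, where
    -- r_{M/F}(Z) = r(Z ∪ F) - r(F).  Condition r'(X)+r'(Y) > r'(E - F).
    ContractionConnected : EdgeSet → Set
    ContractionConnected F = ∀ X → EdgeDisjoint X F → Nonempty X
      → Nonempty (∁ (X ∪ F)) → ∀ a b c d
      → IsRank (X ∪ F) a → IsRank (∁ X) b → IsRank F c → IsRank ⊤ d
      → c + d < a + b

    MConnected : Set
    MConnected = ContractionConnected ⊥

    -- Tutte: 3-connected = no k-separation for k < 3
    M3Connected : Set
    M3Connected = ∀ k → 1 ≤ k → k ≤ 2 → ∀ X → k ≤ ∣ X ∣ → k ≤ ∣ ∁ X ∣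
      → ∀ a b d → IsRank X a → IsRank (∁ X) b → IsRank ⊤ d → d + k ≤ a + b

    Unbreakable : Set
    Unbreakable = MConnected × (∀ F → IsFlat F → ContractionConnected F)

  Graph3Connected : Set
  Graph3Connected = 4 ≤ n × (∀ (X : Subset n) → ∣ X ∣ ≤ 2 → ∀ u v → u ∉ X → v ∉ X
      → Reach (λ e → src e ∉ X × tgt e ∉ X) u v)

  SiAdj : Fin n → Fin n → Set
  SiAdj u v = u ≢ v × ∃ λ e → (src e ≡ u × tgt e ≡ v) ⊎ (src e ≡ v × tgt e ≡ u)

OnPath : ∀ {n} → List (Fin n) → Fin n → Fin n → Set
OnPath []             u v = Data.Empty.⊥ where import Data.Empty
OnPath (a ∷ [])       u v = Data.Empty.⊥ where import Data.Empty
OnPath (a ∷ b ∷ ps)   u v = ((a ≡ u × b ≡ v) ⊎ (a ≡ v × b ≡ u)) ⊎ OnPath (b ∷ ps) u v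

-- si(G) is K_n minus the edges of a path of length ≤ 2 (a path with
-- 1 to 3 distinct vertices ps).
SiIsKnMinusShortPath : Graph → Set
SiIsKnMinusShortPath G = ∃ λ (ps : List (Fin n)) → 1 ≤ length ps × length ps ≤ 3
    × Unique ps × (∀ u v → u ≢ v → (SiAdj G u v ⇔ (¬ OnPath ps u v)))
  where open Graph G

{-# OPTIONS --safe #-}
-- Call a set of edges balanced if all its cycles are in 𝓑, and let u, v be non-adjacent. Three contractions of
-- rank two that fall apart into two points control the graph. Contracting the closure of E(G − {u, v}) shows
-- that G − {u, v} is balanced and that G is not. If moreover G − {u, v, z} is connected, a balanced connected
-- subgraph of G − z which stays balanced after adding all edges at z is contracted; since by the theta property
-- balance may be tested along a single path, this shows that for t = u or t = v the vertices t, z are adjacent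
-- and every cycle through the edge tz that avoids the other one of u, v meets every pair of non-adjacent vertices.
--
-- The rest only uses this covering property of the simple graph. Choose z such that G − {u, v, z} is connected
-- and take an induced cycle C through tz avoiding the other vertex; V − C is a clique. If |C| ≥ 5 or |C| = 4, the
-- property applied to suitable vertices of C and of V − C fails, because short cycles through V − C miss a
-- non-adjacent pair of C. So C is a triangle, and for |V| ≥ 7 the property excludes two disjoint non-adjacent
-- pairs as well as three non-adjacent pairs with a common vertex.
--
-- Ranks are bounded from below by growing trees from a vertex or from an unbalanced cycle, and from above by
-- assigning to an independent set one root for every component that is a tree.
module Submission where

open import Defs
open import Data.Bool using (true; false; if_then_else_)
open import Data.Empty using (⊥-elim) renaming (⊥ to Absurd)
open import Data.Fin using (Fin; zero; suc; _≟_)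
open import Data.Fin.Properties using (any?)
open import Data.Fin.Subset using (Subset; inside; outside; _∈_; _∉_; _⊆_; _∪_; _∩_; ∁; ⊥; ⊤; ⁅_⁆; ∣_∣; Nonempty)
open import Data.Fin.Subset.Properties
open import Data.List using (List; []; _∷_; _++_; length; [_])
open import Data.List.Membership.Propositional using () renaming (_∈_ to _∈ˡ_; _∉_ to _∉ˡ_)
open import Data.List.Membership.Propositional.Properties using (∈-++⁺ˡ; ∈-++⁺ʳ; ∈-++⁻)
import Data.List.Membership.DecPropositional as DecMembership
open import Data.List.Properties using (length-++; ++-assoc)
open import Data.List.Relation.Unary.All using (All)
import Data.List.Relation.Unary.All as All
open import Data.List.Relation.Unary.AllPairs using ([]; _∷_)
open import Data.List.Relation.Unary.Any using (Any; here; there)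
import Data.List.Relation.Unary.Any as Any
open import Data.List.Relation.Unary.Unique.Propositional using (Unique)
open import Data.Nat using (ℕ; zero; suc; _+_; _∸_; _≤_; _<_; z≤n; s≤s)
import Data.Nat.Properties as ℕₚ
open import Data.Nat.Tactic.RingSolver using (solve-∀)
open import Data.Product using (Σ; ∃; _×_; _,_; proj₁; proj₂)
open import Data.Sum using (_⊎_; inj₁; inj₂; swap; [_,_]′)
open import Data.Unit using (tt) renaming (⊤ to Unit)
open import Data.Vec using ([]; _∷_; lookup; tabulate)
open import Data.Vec.Properties using (lookup∘tabulate; lookup-replicate; []=⇒lookup; lookup⇒[]=)
open import Function using (case_of_)
open import Function.Bundles using (mk⇔)
open import Relation.Binary.PropositionalEquality using (_≡_; _≢_; refl; sym; trans; cong; cong₂; subst; module ≡-Reasoning)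
open import Relation.Nullary using (¬_; Dec; yes; no; does; ¬?)
open import Relation.Nullary.Decidable using (_×-dec_; _⊎-dec_; dec-true; dec-false; decidable-stable)

-- Contracting a flat leaves no loops of the matroid, so a contraction of rank two is disconnected
-- exactly when it has two parallel classes. Each use of unbreakability thereby becomes one count: a
-- base set of rank `k`, a matroid of rank at least `k + 2`, and two parts which together with the
-- flat have rank at most `k + 1` each. Only such bounds are proved; exact ranks appear under a
-- double negation, which suffices because every count ends in a contradiction and adjacency is
-- decidable. The obstacle is the graph loops at `u`, `v` or `z`. The flat is known only as a
-- maximal set of bounded rank and may contain some of them, so it cannot be described by its
-- vertices alone. Hence edges that are no loops are excluded by a pendant-edge argument, and loops
-- are treated by their labels. Seven vertices leave at least four vertices in the clique beside a
-- triangle and three beside a square: enough for one more clique vertex that closes a short cycle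
-- avoiding all the vertices already named.

private variable
  N : ℕ

-- Finite sets given by lists and by decidable predicates

_∈ˡ?_ : (x : Fin N) (xs : List (Fin N)) → Dec (x ∈ˡ xs)
_∈ˡ?_ = DecMembership._∈?_ _≟_

∣⁅x⁆∪p∣ : {x : Fin N} {p : Subset N} → x ∉ p → ∣ ⁅ x ⁆ ∪ p ∣ ≡ suc ∣ p ∣
∣⁅x⁆∪p∣ {x = zero}  {inside ∷ p}  x∉ = ⊥-elim (x∉ Data.Vec.here)
∣⁅x⁆∪p∣ {x = zero}  {outside ∷ p} x∉ = cong (λ q → suc ∣ q ∣) (∪-identityˡ p)
∣⁅x⁆∪p∣ {x = suc x} {inside ∷ p}  x∉ = cong suc (∣⁅x⁆∪p∣ (λ x∈ → x∉ (Data.Vec.there x∈)))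
∣⁅x⁆∪p∣ {x = suc x} {outside ∷ p} x∉ = ∣⁅x⁆∪p∣ (λ x∈ → x∉ (Data.Vec.there x∈))

infixl 6 _∖_
opaque
  _∖_ : Subset N → Fin N → Subset N
  p ∖ x = p ∩ ∁ ⁅ x ⁆

  ∈∖⁺ : {p : Subset N} {x y : Fin N} → y ∈ p → y ≢ x → y ∈ p ∖ x
  ∈∖⁺ y∈ y≢ = x∈p∩q⁺ (y∈ , x∉p⇒x∈∁p (λ y∈x → y≢ (x∈⁅y⁆⇒x≡y _ y∈x)))

  ∈∖⁻ : {p : Subset N} {x y : Fin N} → y ∈ p ∖ x → y ∈ p × y ≢ x
  ∈∖⁻ {p = p} {x} y∈ with x∈p∩q⁻ p (∁ ⁅ x ⁆) y∈
  ... | y∈p , y∈∁ = y∈p , λ { refl → x∈∁p⇒x∉p y∈∁ (x∈⁅x⁆ _) }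

  insert-∖ : {p : Subset N} {x : Fin N} → x ∈ p → p ≡ ⁅ x ⁆ ∪ (p ∖ x)
  insert-∖ {p = p} {x} x∈ = ⊆-antisym to from
    where
    to : p ⊆ ⁅ x ⁆ ∪ (p ∖ x)
    to {y} y∈ with y ≟ x
    ... | yes refl = x∈p∪q⁺ (inj₁ (x∈⁅x⁆ x))
    ... | no y≢ = x∈p∪q⁺ (inj₂ (∈∖⁺ y∈ y≢))
    from : ⁅ x ⁆ ∪ (p ∖ x) ⊆ p
    from y∈ with x∈p∪q⁻ ⁅ x ⁆ (p ∖ x) y∈
    ... | inj₁ y∈x rewrite x∈⁅y⁆⇒x≡y x y∈x = x∈
    ... | inj₂ y∈p = proj₁ (∈∖⁻ y∈p)

  ∣p∖x∣ : {p : Subset N} {x : Fin N} → x ∈ p → ∣ p ∣ ≡ suc ∣ p ∖ x ∣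
  ∣p∖x∣ {p = p} {x} x∈ = trans (cong ∣_∣ (insert-∖ x∈)) (∣⁅x⁆∪p∣ (λ x∈' → proj₂ (∈∖⁻ {p = p} x∈') refl))

  filterSet : {P : Fin N → Set} → (∀ x → Dec (P x)) → Subset N
  filterSet P? = tabulate (λ x → does (P? x))

  ∈filter⁺ : {P : Fin N → Set} (P? : ∀ x → Dec (P x)) {x : Fin N} → P x → x ∈ filterSet P?
  ∈filter⁺ P? {x} px = lookup⇒[]= x _ (trans (lookup∘tabulate _ x) (dec-true (P? x) px))

  ∈filter⁻ : {P : Fin N → Set} (P? : ∀ x → Dec (P x)) {x : Fin N} → x ∈ filterSet P? → P x
  ∈filter⁻ P? {x} x∈ with P? x | trans (sym (lookup∘tabulate (λ y → does (P? y)) x)) ([]=⇒lookup x∈)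
  ... | yes px | _ = px
  ... | no  _  | ()

  ⟦_⟧ : List (Fin N) → Subset N
  ⟦ [] ⟧     = ⊥
  ⟦ x ∷ xs ⟧ = ⁅ x ⁆ ∪ ⟦ xs ⟧

  ∈⟦⟧⁺ : {xs : List (Fin N)} {x : Fin N} → x ∈ˡ xs → x ∈ ⟦ xs ⟧
  ∈⟦⟧⁺ (here refl) = x∈p∪q⁺ (inj₁ (x∈⁅x⁆ _))
  ∈⟦⟧⁺ (there x∈)  = x∈p∪q⁺ (inj₂ (∈⟦⟧⁺ x∈))

  ∈⟦⟧⁻ : {xs : List (Fin N)} {x : Fin N} → x ∈ ⟦ xs ⟧ → x ∈ˡ xs
  ∈⟦⟧⁻ {xs = []} x∈ = ⊥-elim (∉⊥ x∈)
  ∈⟦⟧⁻ {xs = y ∷ xs} x∈ with x∈p∪q⁻ ⁅ y ⁆ ⟦ xs ⟧ x∈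
  ... | inj₁ x∈y  = here (x∈⁅y⁆⇒x≡y y x∈y)
  ... | inj₂ x∈xs = there (∈⟦⟧⁻ x∈xs)

  ⟦[]⟧ : ⟦ [] ⟧ ≡ ⊥ {n = N}
  ⟦[]⟧ = refl

  ⟦∷⟧ : (x : Fin N) (xs : List (Fin N)) → ⟦ x ∷ xs ⟧ ≡ ⁅ x ⁆ ∪ ⟦ xs ⟧
  ⟦∷⟧ x xs = refl

⟦⟧-cong : {xs ys : List (Fin N)} → (∀ {x} → x ∈ˡ xs → x ∈ˡ ys) → (∀ {x} → x ∈ˡ ys → x ∈ˡ xs) → ⟦ xs ⟧ ≡ ⟦ ys ⟧
⟦⟧-cong f g = ⊆-antisym (λ x∈ → ∈⟦⟧⁺ (f (∈⟦⟧⁻ x∈))) (λ x∈ → ∈⟦⟧⁺ (g (∈⟦⟧⁻ x∈)))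

All≢⇒∉ : {x : Fin N} {xs : List (Fin N)} → All (x ≢_) xs → x ∉ˡ xs
All≢⇒∉ al x∈ = All.lookup al x∈ refl

∉⇒All≢ : {x : Fin N} {xs : List (Fin N)} → x ∉ˡ xs → All (x ≢_) xs
∉⇒All≢ x∉ = All.tabulate (λ y∈ x≡y → x∉ (subst (_∈ˡ _) (sym x≡y) y∈))

∣⟦⟧∣ : {xs : List (Fin N)} → Unique xs → ∣ ⟦ xs ⟧ ∣ ≡ length xs
∣⟦⟧∣ {N} [] = trans (cong ∣_∣ ⟦[]⟧) (∣⊥∣≡0 N)
∣⟦⟧∣ {xs = x ∷ xs} (x∉ ∷ u) = trans (cong ∣_∣ (⟦∷⟧ x xs)) (trans (∣⁅x⁆∪p∣ (λ x∈ → All≢⇒∉ x∉ (∈⟦⟧⁻ x∈))) (cong suc (∣⟦⟧∣ u)))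

∣⟦⟧∣≤ : (xs : List (Fin N)) → ∣ ⟦ xs ⟧ ∣ ≤ length xs
∣⟦⟧∣≤ {N} [] = ℕₚ.≤-reflexive (trans (cong ∣_∣ ⟦[]⟧) (∣⊥∣≡0 N))
∣⟦⟧∣≤ (x ∷ xs) with x ∈ˡ? xs
... | yes x∈ = ℕₚ.≤-trans (p⊆q⇒∣p∣≤∣q∣ (λ i → ∈⟦⟧⁺ (drop (∈⟦⟧⁻ i)))) (ℕₚ.m≤n⇒m≤1+n (∣⟦⟧∣≤ xs))
  where
  drop : ∀ {y} → y ∈ˡ x ∷ xs → y ∈ˡ xs
  drop (here refl) = x∈
  drop (there i) = i
... | no x∉ = ℕₚ.≤-trans (ℕₚ.≤-reflexive (trans (cong ∣_∣ (⟦∷⟧ x xs)) (∣⁅x⁆∪p∣ (λ i → x∉ (∈⟦⟧⁻ i))))) (s≤s (∣⟦⟧∣≤ xs))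

∃-fresh : (xs : List (Fin N)) → length xs < N → ∃ λ x → x ∉ˡ xs
∃-fresh {N} xs l< with any? (λ x → ¬? (x ∈ˡ? xs))
... | yes p = p
... | no all = ⊥-elim (ℕₚ.<⇒≱ l< (ℕₚ.≤-trans (ℕₚ.≤-reflexive (sym (∣⊤∣≡n N)))
                  (ℕₚ.≤-trans (p⊆q⇒∣p∣≤∣q∣ ⊤⊆) (∣⟦⟧∣≤ xs))))
  where
  ⊤⊆ : ⊤ ⊆ ⟦ xs ⟧
  ⊤⊆ {x} _ = ∈⟦⟧⁺ (decidable-stable (x ∈ˡ? xs) (λ x∉ → all (x , x∉)))

-- Walks, paths and cycles in a multigraph

module Walks (G : Graph) where

  open Graph G

  V E : Set
  V = Fin n
  E = Fin m

  Inc : E → V → Set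
  Inc e w = src G e ≡ w ⊎ tgt G e ≡ w

  Step : V → E → V → Set
  Step x e y = (src G e ≡ x × tgt G e ≡ y) ⊎ (src G e ≡ y × tgt G e ≡ x)

  step-sym : ∀ {x e y} → Step x e y → Step y e x
  step-sym = swap

  step-ends : ∀ e → Step (src G e) e (tgt G e)
  step-ends e = inj₁ (refl , refl)

  step-incˡ : ∀ {x e y} → Step x e y → Inc e x
  step-incˡ (inj₁ (p , _)) = inj₁ p
  step-incˡ (inj₂ (_ , q)) = inj₂ q

  step-incʳ : ∀ {x e y} → Step x e y → Inc e y
  step-incʳ s = step-incˡ (step-sym s)

  step-inc⁻ : ∀ {x e y w} → Step x e y → Inc e w → w ≡ x ⊎ w ≡ y
  step-inc⁻ (inj₁ (p , _)) (inj₁ r) = inj₁ (trans (sym r) p)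
  step-inc⁻ (inj₁ (_ , q)) (inj₂ r) = inj₂ (trans (sym r) q)
  step-inc⁻ (inj₂ (p , _)) (inj₁ r) = inj₂ (trans (sym r) p)
  step-inc⁻ (inj₂ (_ , q)) (inj₂ r) = inj₁ (trans (sym r) q)

  inc⇒step : ∀ {e w} → Inc e w → ∃ λ y → Step w e y
  inc⇒step {e} (inj₁ refl) = tgt G e , step-ends e
  inc⇒step {e} (inj₂ refl) = src G e , step-sym (step-ends e)

  module _ {ok : E → Set} where

    reach-trans : ∀ {a b c} → Reach G ok a b → Reach G ok b c → Reach G ok a c
    reach-trans here q = q
    reach-trans (fwd e o p) q = fwd e o (reach-trans p q)
    reach-trans (bwd e o p) q = bwd e o (reach-trans p q)

    reach-step : ∀ {a e b c} → Step a e b → ok e → Reach G ok b c → Reach G ok a c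
    reach-step {e = e} (inj₁ (refl , refl)) o r = fwd e o r
    reach-step {e = e} (inj₂ (refl , refl)) o r = bwd e o r

    reach-sym : ∀ {a b} → Reach G ok a b → Reach G ok b a
    reach-sym here = here
    reach-sym (fwd e o p) = reach-trans (reach-sym p) (bwd e o here)
    reach-sym (bwd e o p) = reach-trans (reach-sym p) (fwd e o here)

  reach-mono : ∀ {ok ok' : E → Set} → (∀ {e} → ok e → ok' e) → ∀ {a b} → Reach G ok a b → Reach G ok' a b
  reach-mono f here = here
  reach-mono f (fwd e o p) = fwd e (f o) (reach-mono f p)
  reach-mono f (bwd e o p) = bwd e (f o) (reach-mono f p)

  -- Turns connectivity into one edge leaving a vertex set. Every later construction that enlarges a
  -- set by one vertex takes its new edge from here.
  reach-cross : ∀ {ok : E → Set} {U : V → Set} → (∀ v → Dec (U v)) → ∀ {a b} → Reach G ok a b → U a → ¬ U b →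
    ∃ λ x → ∃ λ e → ∃ λ y → Step x e y × ok e × U x × ¬ U y
  reach-cross U? here ua ub = ⊥-elim (ub ua)
  reach-cross U? (fwd e o p) ua ub with U? (tgt G e)
  ... | yes ut = reach-cross U? p ut ub
  ... | no ¬ut = _ , e , _ , step-ends e , o , ua , ¬ut
  reach-cross U? (bwd e o p) ua ub with U? (src G e)
  ... | yes ut = reach-cross U? p ut ub
  ... | no ¬ut = _ , e , _ , step-sym (step-ends e) , o , ua , ¬ut

  reach-invariant : ∀ {ok : E → Set} {U : V → Set} → (∀ {x e y} → Step x e y → ok e → U x → U y) →
    ∀ {a b} → Reach G ok a b → U a → U b
  reach-invariant f here ua = ua
  reach-invariant f (fwd e o p) ua = reach-invariant f p (f (step-ends e) o ua)
  reach-invariant f (bwd e o p) ua = reach-invariant f p (f (step-sym (step-ends e)) o ua)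

  -- A simple path from x to z; its vertices are x ∷ ts and its edges are es.
  data Path : V → List V → List E → V → Set where
    []   : ∀ {x} → Path x [] [] x
    cons : ∀ {x e y z ts es} → Step x e y → x ∉ˡ y ∷ ts → Path y ts es z → Path x (y ∷ ts) (e ∷ es) z

  path-last : ∀ {x ts es z} → Path x ts es z → z ∈ˡ x ∷ ts
  path-last [] = here refl
  path-last (cons _ _ p) = there (path-last p)

  path-vs-unique : ∀ {x ts es z} → Path x ts es z → Unique (x ∷ ts)
  path-vs-unique [] = _∷_ (∉⇒All≢ (λ ())) []
  path-vs-unique (cons _ x∉ p) = _∷_ (∉⇒All≢ x∉) (path-vs-unique p)

  path-inc : ∀ {x ts es z e w} → Path x ts es z → e ∈ˡ es → Inc e w → w ∈ˡ x ∷ ts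
  path-inc (cons s x∉ p) (here refl) i with step-inc⁻ s i
  ... | inj₁ refl = here refl
  ... | inj₂ refl = there (here refl)
  path-inc (cons s x∉ p) (there e∈) i = there (path-inc p e∈ i)

  path-es-unique : ∀ {x ts es z} → Path x ts es z → Unique es
  path-es-unique [] = []
  path-es-unique (cons s x∉ p) =
    _∷_ (∉⇒All≢ (λ e∈ → x∉ (path-inc p e∈ (step-incˡ s)))) (path-es-unique p)

  path-length : ∀ {x ts es z} → Path x ts es z → length es ≡ length ts
  path-length [] = refl
  path-length (cons _ _ p) = cong suc (path-length p)

  path-edge-step : ∀ {x ts es z e} → Path x ts es z → e ∈ˡ es → ∃ λ a → ∃ λ b → Step a e b × a ≢ b
  path-edge-step (cons s x∉ p) (here refl) = _ , _ , s , λ { refl → x∉ (here refl) }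
  path-edge-step (cons s x∉ p) (there e∈) = path-edge-step p e∈

  path-vertex-inc : ∀ {x t ts es z w} → Path x (t ∷ ts) es z → w ∈ˡ x ∷ t ∷ ts → ∃ λ e → e ∈ˡ es × Inc e w
  path-vertex-inc (cons s x∉ p) (here refl) = _ , here refl , step-incˡ s
  path-vertex-inc (cons s x∉ []) (there (here refl)) = _ , here refl , step-incʳ s
  path-vertex-inc (cons s x∉ p@(cons _ _ _)) (there w∈) with path-vertex-inc p w∈
  ... | e , e∈ , i = e , there e∈ , i

  path-reach : ∀ {x ts es z} {ok : E → Set} → Path x ts es z → (∀ {e} → e ∈ˡ es → ok e) →
    ∀ {w} → w ∈ˡ x ∷ ts → Reach G ok w z
  path-reach [] o (here refl) = here
  path-reach (cons s x∉ p) o (here refl) = reach-step s (o (here refl)) (path-reach p (λ e∈ → o (there e∈)) (here refl))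
  path-reach (cons s x∉ p) o (there w∈) = path-reach p (λ e∈ → o (there e∈)) w∈

  path-++ : ∀ {x ts es y ts' es' z} → Path x ts es y → Path y ts' es' z →
    (∀ {w} → w ∈ˡ x ∷ ts → w ∉ˡ ts') → Path x (ts ++ ts') (es ++ es') z
  path-++ [] q d = q
  path-++ {ts = t ∷ ts} (cons s x∉ p) q d =
    cons s (λ x∈ → [ (λ i → x∉ i) , (λ i → d (here refl) i) ]′ (∈-++⁻ (t ∷ ts) x∈))
      (path-++ p q (λ w∈ → d (there w∈)))

  path-snoc : ∀ {x ts es y e z} → Path x ts es y → Step y e z → z ∉ˡ x ∷ ts → Path x (ts ++ [ z ]) (es ++ [ e ]) z
  path-snoc p s z∉ = path-++ p (cons s (λ { (here refl) → z∉ (path-last p) }) []) (λ { w∈ (here refl) → z∉ w∈ })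

  -- The reversed lists are described only up to membership. This is all that `⟦_⟧` retains, and it
  -- spares any reasoning about the order of the lists.
  record Reversed {x ts es z} (p : Path x ts es z) : Set where
    constructor reversed
    field
      {ts'} : List V
      {es'} : List E
      path  : Path z ts' es' x
      vs⇒   : ∀ {w} → w ∈ˡ x ∷ ts → w ∈ˡ z ∷ ts'
      vs⇐   : ∀ {w} → w ∈ˡ z ∷ ts' → w ∈ˡ x ∷ ts
      es⇒   : ∀ {e} → e ∈ˡ es → e ∈ˡ es'
      es⇐   : ∀ {e} → e ∈ˡ es' → e ∈ˡ es

  reverse : ∀ {x ts es z} (p : Path x ts es z) → Reversed p
  reverse [] = reversed [] (λ w∈ → w∈) (λ w∈ → w∈) (λ e∈ → e∈) (λ e∈ → e∈)
  reverse {x} {z = z} (cons {e = e} {y} s x∉ p) = reversed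
    (path-snoc R.path (step-sym s) (λ x∈ → x∉ (R.vs⇐ x∈)))
    (λ { (here refl) → ∈-++⁺ʳ (z ∷ R.ts') (here refl) ; (there w∈) → ∈-++⁺ˡ (R.vs⇒ w∈) })
    (λ w∈ → [ (λ i → there (R.vs⇐ i)) , (λ { (here refl) → here refl }) ]′ (∈-++⁻ (z ∷ R.ts') w∈))
    (λ { (here refl) → ∈-++⁺ʳ R.es' (here refl) ; (there e∈) → ∈-++⁺ˡ (R.es⇒ e∈) })
    (λ e∈ → [ (λ i → there (R.es⇐ i)) , (λ { (here refl) → here refl }) ]′ (∈-++⁻ R.es' e∈))
    where module R = Reversed (reverse p)

  data SplitAt (x : V) (z w : V) : List V → List E → Set where
    split : ∀ {ts₁ es₁ ts₂ es₂} → Path x ts₁ es₁ w → Path w ts₂ es₂ z → SplitAt x z w (ts₁ ++ ts₂) (es₁ ++ es₂)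

  splitAt : ∀ {x ts es z w} → Path x ts es z → w ∈ˡ x ∷ ts → SplitAt x z w ts es
  splitAt p (here refl) = split [] p
  splitAt (cons s x∉ p) (there w∈) with splitAt p w∈
  ... | split {ts₁} p₁ p₂ = split (cons s (λ x∈ → x∉ (∈-++⁺ˡ x∈)) p₁) p₂

  data SplitEdge (x : V) (z : V) (e : E) : List V → List E → Set where
    split : ∀ {a b ts₁ es₁ ts₂ es₂} → Path x ts₁ es₁ a → Step a e b → Path b ts₂ es₂ z →
      SplitEdge x z e (ts₁ ++ b ∷ ts₂) (es₁ ++ e ∷ es₂)

  splitEdge : ∀ {x ts es z e} → Path x ts es z → e ∈ˡ es → SplitEdge x z e ts es
  splitEdge (cons s x∉ p) (here refl) = split [] s p
  splitEdge (cons s x∉ p) (there e∈) with splitEdge p e∈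
  ... | split {ts₁ = ts₁} p₁ t p₂ = split (cons s (λ x∈ → x∉ (∈-++⁺ˡ x∈)) p₁) t p₂

  ++-disjoint : ∀ {x : V} {ts₁ ts₂} → Unique (x ∷ ts₁ ++ ts₂) → ∀ {w} → w ∈ˡ x ∷ ts₁ → w ∉ˡ ts₂
  ++-disjoint (_∷_ x∉ u) (here refl) w∈ = All≢⇒∉ x∉ (∈-++⁺ʳ _ w∈)
  ++-disjoint {ts₁ = _ ∷ _} (_∷_ x∉ u) (there w∈₁) w∈ = ++-disjoint u w∈₁ w∈

  record PathIn (ok : E → Set) (x z : V) : Set where
    constructor pathIn
    field
      {ts} : List V
      {es} : List E
      path : Path x ts es z
      within : ∀ {e} → e ∈ˡ es → ok e

  -- Loop erasure: if the new vertex already lies on the path, the part before it is discarded.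
  path-extend : ∀ {ok x e y z} → Step x e y → ok e → PathIn ok y z → PathIn ok x z
  path-extend {x = x} {y = y} s o (pathIn {ts} p i) with x ∈ˡ? (y ∷ ts)
  ... | no x∉ = pathIn (cons s x∉ p) (λ { (here refl) → o ; (there e∈) → i e∈ })
  ... | yes x∈ with splitAt p x∈
  ...   | split {es₁ = es₁} _ p₂ = pathIn p₂ (λ e∈ → i (∈-++⁺ʳ es₁ e∈))

  reach⇒path : ∀ {ok x z} → Reach G ok x z → PathIn ok x z
  reach⇒path here = pathIn [] (λ ())
  reach⇒path (fwd e o r) = path-extend (step-ends e) o (reach⇒path r)
  reach⇒path (bwd e o r) = path-extend (step-sym (step-ends e)) o (reach⇒path r)

  -- The prefix meets `A` in its last vertex only. This is the source of internal disjointness when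
  -- thetas and handcuffs are assembled.
  data SplitFirst (A : V → Set) (x z : V) : List V → List E → Set where
    split : ∀ {h ts₁ es₁ ts₂ es₂} → Path x ts₁ es₁ h → Path h ts₂ es₂ z → A h → (∀ {w} → w ∈ˡ x ∷ ts₁ → A w → w ≡ h) →
      SplitFirst A x z (ts₁ ++ ts₂) (es₁ ++ es₂)

  splitFirst : ∀ {A : V → Set} (A? : ∀ v → Dec (A v)) {x ts es z} → Path x ts es z → A z → SplitFirst A x z ts es
  splitFirst A? {x} p az with A? x
  splitFirst A? p az | yes ax = split [] p ax (λ { (here refl) _ → refl })
  splitFirst A? [] az | no ¬ax = ⊥-elim (¬ax az)
  splitFirst A? (cons s x∉ p) az | no ¬ax with splitFirst A? p az
  ... | split {ts₁ = ts₁} p₁ p₂ ah only = split (cons s (λ x∈ → x∉ (∈-++⁺ˡ x∈)) p₁) p₂ ah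
          (λ { (here refl) aw → ⊥-elim (¬ax aw) ; (there w∈) aw → only w∈ aw })

  -- Degrees

  ∑-zero : (f : Fin N → ℕ) → (∀ i → f i ≡ 0) → ∑ G f ≡ 0
  ∑-zero {zero} f z = refl
  ∑-zero {suc N} f z = cong₂ _+_ (z zero) (∑-zero (λ i → f (suc i)) (λ i → z (suc i)))

  ∑-single : (f : Fin N → ℕ) (e : Fin N) → (∀ i → i ≢ e → f i ≡ 0) → ∑ G f ≡ f e
  ∑-single f zero z = trans (cong (f zero +_) (∑-zero _ (λ i → z (suc i) (λ ())))) (ℕₚ.+-identityʳ _)
  ∑-single f (suc e) z = trans (cong (_+ ∑ G (λ i → f (suc i))) (z zero (λ ())))
    (∑-single (λ i → f (suc i)) e (λ i i≢ → z (suc i) (λ { refl → i≢ refl })))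

  ∑-positive : (f : Fin N → ℕ) → ∑ G f ≢ 0 → ∃ λ i → f i ≢ 0
  ∑-positive {zero} f s = ⊥-elim (s refl)
  ∑-positive {suc N} f s with f zero ℕₚ.≟ 0
  ... | no f0 = zero , f0
  ... | yes f0 with ∑-positive (λ i → f (suc i)) (λ t → s (cong₂ _+_ f0 t))
  ...   | i , fi = suc i , fi

  ∑-insert : (f : Fin N → ℕ) (S : Subset N) {e : Fin N} → e ∉ S →
    ∑ G (λ i → if lookup (⁅ e ⁆ ∪ S) i then f i else 0) ≡ f e + ∑ G (λ i → if lookup S i then f i else 0)
  ∑-insert f (inside ∷ S) {zero} e∉ = ⊥-elim (e∉ Data.Vec.here)
  ∑-insert f (outside ∷ S) {zero} e∉ rewrite ∪-identityˡ S = refl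
  ∑-insert f (s ∷ S) {suc e} e∉ = trans
    (cong ((if s then f zero else 0) +_) (∑-insert (λ i → f (suc i)) S (λ e∈ → e∉ (Data.Vec.there e∈))))
    (exchange (if s then f zero else 0) (f (suc e)) _)
    where
    exchange : ∀ a b c → a + (b + c) ≡ b + (a + c)
    exchange = solve-∀

  δ : V → V → ℕ
  δ x w = ind G (does (x ≟ w))

  δ-refl : ∀ w → δ w w ≡ 1
  δ-refl w rewrite dec-true (w ≟ w) refl = refl

  δ-≢ : ∀ {x w} → x ≢ w → δ x w ≡ 0
  δ-≢ {x} {w} x≢ rewrite dec-false (x ≟ w) x≢ = refl

  δ-positive : ∀ {x w} → δ x w ≢ 0 → x ≡ w
  δ-positive {x} {w} d with x ≟ w
  ... | yes p = p
  ... | no _  = ⊥-elim (d refl)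

  edgeDeg : E → V → ℕ
  edgeDeg e w = δ (src G e) w + δ (tgt G e) w

  edgeDeg-step : ∀ {x e y} w → Step x e y → edgeDeg e w ≡ δ x w + δ y w
  edgeDeg-step w (inj₁ (refl , refl)) = refl
  edgeDeg-step {x} {e} w (inj₂ (refl , refl)) = ℕₚ.+-comm (δ (src G e) w) (δ (tgt G e) w)

  listDeg : List E → V → ℕ
  listDeg [] w = 0
  listDeg (e ∷ es) w = edgeDeg e w + listDeg es w

  deg-⟦⟧ : ∀ {es} → Unique es → ∀ w → deg G ⟦ es ⟧ w ≡ listDeg es w
  deg-⟦⟧ [] w = trans (cong (λ S → deg G S w) ⟦[]⟧) (∑-zero {m} _ (λ i → cong (λ b → if b then edgeDeg i w else 0) (lookup-replicate i outside)))
  deg-⟦⟧ {e ∷ es} (_∷_ e∉ u) w = trans (cong (λ S → deg G S w) (⟦∷⟧ e es)) (trans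
    (∑-insert (λ i → edgeDeg i w) ⟦ es ⟧ (λ e∈ → All≢⇒∉ e∉ (∈⟦⟧⁻ e∈)))
    (cong (edgeDeg e w +_) (deg-⟦⟧ u w)))

  deg-positive : ∀ {S w} → deg G S w ≢ 0 → InV G S w
  deg-positive {S} {w} d with ∑-positive {m} _ d
  ... | e , fe with lookup S e in eq
  ...   | false = ⊥-elim (fe refl)
  ...   | true with δ (src G e) w ℕₚ.≟ 0
  ...     | no s = e , lookup⇒[]= e S eq , inj₁ (δ-positive s)
  ...     | yes s with δ (tgt G e) w ℕₚ.≟ 0
  ...       | no t = e , lookup⇒[]= e S eq , inj₂ (δ-positive t)
  ...       | yes t = ⊥-elim (fe (cong₂ _+_ s t))

  deg≡1⇒InV : ∀ {S w} → deg G S w ≡ 1 → InV G S w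
  deg≡1⇒InV d = deg-positive (λ z → ℕₚ.1+n≢0 (trans (sym d) z))

  -- A leaf of `S`, kept together with its edge. In contrast to a bare degree condition, this
  -- survives in every subset that still contains the edge.
  record Lone (w : V) (e : E) (S : Subset m) : Set where
    constructor lone
    field
      {other} : V
      step    : Step w e other
      nonloop : other ≢ w
      member  : e ∈ S
      unique  : ∀ {e'} → e' ∈ S → Inc e' w → e' ≡ e

  lone⇒deg≡1 : ∀ {w e S} → Lone w e S → deg G S w ≡ 1
  lone⇒deg≡1 {w} {e} {S} (lone {y} s y≢ e∈ u) = trans (∑-single _ e zeros) at-e
    where
    zeros : ∀ i → i ≢ e → (if lookup S i then edgeDeg i w else 0) ≡ 0
    zeros i i≢ with lookup S i in eq
    ... | false = refl
    ... | true = cong₂ _+_ (δ-≢ (λ p → i≢ (u (lookup⇒[]= i S eq) (inj₁ p)))) (δ-≢ (λ p → i≢ (u (lookup⇒[]= i S eq) (inj₂ p))))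
    at-e : (if lookup S e then edgeDeg e w else 0) ≡ 1
    at-e rewrite []=⇒lookup e∈ = trans (edgeDeg-step w s) (cong₂ _+_ (δ-refl w) (δ-≢ y≢))

  count : List V → V → ℕ
  count [] w = 0
  count (v ∷ vs) w = δ v w + count vs w

  count-∉ : ∀ {vs w} → w ∉ˡ vs → count vs w ≡ 0
  count-∉ {[]} w∉ = refl
  count-∉ {v ∷ vs} {w} w∉ = cong₂ _+_ (δ-≢ {v} {w} (λ { refl → w∉ (here refl) })) (count-∉ (λ w∈ → w∉ (there w∈)))

  count-∈ : ∀ {vs w} → Unique vs → w ∈ˡ vs → count vs w ≡ 1
  count-∈ {v ∷ vs} (_∷_ v∉ u) (here refl) = cong₂ _+_ (δ-refl v) (count-∉ (All≢⇒∉ v∉))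
  count-∈ {v ∷ vs} {w} (_∷_ v∉ u) (there w∈) = cong₂ _+_ (δ-≢ {v} {w} (λ { refl → All≢⇒∉ v∉ w∈ })) (count-∈ u w∈)

  count-dichotomy : ∀ {vs} → Unique vs → ∀ w → count vs w ≡ 0 ⊎ count vs w ≡ 1
  count-dichotomy {vs} u w with w ∈ˡ? vs
  ... | yes w∈ = inj₂ (count-∈ u w∈)
  ... | no w∉ = inj₁ (count-∉ w∉)

  -- The two end indicators act like an edge closing the path, after which each of its vertices has
  -- degree two. Written this way the identity needs no subtraction and also holds for the path with
  -- one vertex.
  path-degree : ∀ {x ts es z} → Path x ts es z → ∀ w →
    listDeg es w + δ x w + δ z w ≡ count (x ∷ ts) w + count (x ∷ ts) w
  path-degree {x} [] w = cong₂ _+_ (sym (ℕₚ.+-identityʳ (δ x w))) (sym (ℕₚ.+-identityʳ (δ x w)))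
  path-degree {x} {z = z} (cons {e = e} {y} {ts = ts} {es} s x∉ p) w = begin
    edgeDeg e w + listDeg es w + δ x w + δ z w       ≡⟨ cong (λ d → d + listDeg es w + δ x w + δ z w) (edgeDeg-step w s) ⟩
    δ x w + δ y w + listDeg es w + δ x w + δ z w     ≡⟨ shuffle (δ x w) (δ y w) (listDeg es w) (δ z w) ⟩
    δ x w + δ x w + (listDeg es w + δ y w + δ z w)   ≡⟨ cong (δ x w + δ x w +_) (path-degree p w) ⟩
    δ x w + δ x w + (count (y ∷ ts) w + count (y ∷ ts) w) ≡⟨ shuffle' (δ x w) (count (y ∷ ts) w) ⟩
    δ x w + count (y ∷ ts) w + (δ x w + count (y ∷ ts) w) ∎
    where
    open ≡-Reasoning
    shuffle : ∀ a b c d → a + b + c + a + d ≡ a + a + (c + b + d)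
    shuffle = solve-∀
    shuffle' : ∀ a b → a + a + (b + b) ≡ a + b + (a + b)
    shuffle' = solve-∀

  path-InV⁻ : ∀ {x ts es z w} → Path x ts es z → InV G ⟦ es ⟧ w → w ∈ˡ x ∷ ts
  path-InV⁻ p (e , e∈ , i) = path-inc p (∈⟦⟧⁻ e∈) i

  path-isPath : ∀ {x ts es z} → Path x ts es z → x ≢ z → IsPath G x z ⟦ es ⟧
  path-isPath {x} {ts} {es} {z} p x≢z = x≢z , conn , dx , dz , rest
    where
    degree : ∀ w → deg G ⟦ es ⟧ w + δ x w + δ z w ≡ count (x ∷ ts) w + count (x ∷ ts) w
    degree w = trans (cong (λ d → d + δ x w + δ z w) (deg-⟦⟧ (path-es-unique p) w)) (path-degree p w)
    uniq = path-vs-unique p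
    conn : ConnectedES G ⟦ es ⟧
    conn u v iu iv = reach-trans (path-reach p ∈⟦⟧⁺ (path-InV⁻ p iu)) (reach-sym (path-reach p ∈⟦⟧⁺ (path-InV⁻ p iv)))
    dx : deg G ⟦ es ⟧ x ≡ 1
    dx = ℕₚ.+-cancelʳ-≡ 1 _ 1 (trans (sym (trans (cong₂ (λ a b → deg G ⟦ es ⟧ x + a + b) (δ-refl x) (δ-≢ (λ q → x≢z (sym q)))) (ℕₚ.+-identityʳ _)))
           (trans (degree x) (cong₂ _+_ (count-∈ uniq (here refl)) (count-∈ uniq (here refl)))))
    dz : deg G ⟦ es ⟧ z ≡ 1
    dz = ℕₚ.+-cancelʳ-≡ 1 _ 1 (trans (sym (cong (_+ 1) (trans (cong (deg G ⟦ es ⟧ z +_) (δ-≢ x≢z)) (ℕₚ.+-identityʳ _))))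
           (trans (sym (cong (deg G ⟦ es ⟧ z + δ x z +_) (δ-refl z))) (trans (degree z) (cong₂ _+_ (count-∈ uniq (path-last p)) (count-∈ uniq (path-last p))))))
    rest : ∀ w → w ≢ x → w ≢ z → deg G ⟦ es ⟧ w ≡ 0 ⊎ deg G ⟦ es ⟧ w ≡ 2
    rest w w≢x w≢z with trans (sym (trans (cong₂ (λ a b → deg G ⟦ es ⟧ w + a + b) (δ-≢ (λ q → w≢x (sym q))) (δ-≢ (λ q → w≢z (sym q)))) (trans (ℕₚ.+-identityʳ _) (ℕₚ.+-identityʳ _)))) (degree w) | count-dichotomy uniq w
    ... | d | inj₁ c = inj₁ (trans d (cong₂ _+_ c c))
    ... | d | inj₂ c = inj₂ (trans d (cong₂ _+_ c c))

  -- The cycle with vertices x ∷ ts and edges f ∷ es; a loop when es is empty.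
  record Cyc : Set where
    constructor cyc
    field
      {x z}  : V
      {ts}   : List V
      {es}   : List E
      {f}    : E
      path   : Path x ts es z
      close  : Step z f x
      fresh  : f ∉ˡ es

    vertices : List V
    vertices = x ∷ ts

    edges : List E
    edges = f ∷ es

    edgeSet : Subset m
    edgeSet = ⟦ edges ⟧

  open Cyc public using (vertices; edges; edgeSet)

  cyc-edges-unique : ∀ c → Unique (edges c)
  cyc-edges-unique (cyc p s f) = _∷_ (∉⇒All≢ f) (path-es-unique p)

  cyc-vertices-unique : ∀ c → Unique (vertices c)
  cyc-vertices-unique c = path-vs-unique (Cyc.path c)

  cyc-inc : ∀ c {e w} → e ∈ˡ edges c → Inc e w → w ∈ˡ vertices c
  cyc-inc (cyc p s f) (here refl) i with step-inc⁻ s i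
  ... | inj₁ refl = path-last p
  ... | inj₂ refl = here refl
  cyc-inc (cyc p s f) (there e∈) i = path-inc p e∈ i

  cyc-InV⁻ : ∀ c {w} → InV G (edgeSet c) w → w ∈ˡ vertices c
  cyc-InV⁻ c (e , e∈ , i) = cyc-inc c (∈⟦⟧⁻ e∈) i

  cyc-vertex-inc : ∀ c {w} → w ∈ˡ vertices c → ∃ λ e → e ∈ˡ edges c × Inc e w
  cyc-vertex-inc (cyc [] s f) (here refl) = _ , here refl , step-incˡ s
  cyc-vertex-inc (cyc p@(cons _ _ _) s f) w∈ with path-vertex-inc p w∈
  ... | e , e∈ , i = e , there e∈ , i

  cyc-InV⁺ : ∀ c {w} → w ∈ˡ vertices c → InV G (edgeSet c) w
  cyc-InV⁺ c w∈ with cyc-vertex-inc c w∈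
  ... | e , e∈ , i = e , ∈⟦⟧⁺ e∈ , i

  cyc-reach : ∀ c {ok : E → Set} → (∀ {e} → e ∈ˡ edges c → ok e) → ∀ {a b} → a ∈ˡ vertices c → b ∈ˡ vertices c → Reach G ok a b
  cyc-reach (cyc p s f) o a∈ b∈ =
    reach-trans (path-reach p (λ e∈ → o (there e∈)) a∈) (reach-sym (path-reach p (λ e∈ → o (there e∈)) b∈))

  cyc-isCycle : ∀ c → IsCycle G (edgeSet c)
  cyc-isCycle c@(cyc {x} {z} {ts} {es} {f} p s fr) =
    (f , ∈⟦⟧⁺ {xs = f ∷ es} (here refl)) , (λ u v iu iv → cyc-reach c ∈⟦⟧⁺ (cyc-InV⁻ c iu) (cyc-InV⁻ c iv)) , degrees
    where
    degrees : ∀ w → deg G (edgeSet c) w ≡ 0 ⊎ deg G (edgeSet c) w ≡ 2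
    -- The closing edge contributes exactly the two end indicators of `path-degree`; a loop
    -- contributes twice at its only vertex.
    degrees w with trans (deg-⟦⟧ (cyc-edges-unique c) w) (trans (cong (_+ listDeg es w) (edgeDeg-step w s)) (trans (shuffle (δ z w) (δ x w) (listDeg es w)) (path-degree p w))) | count-dichotomy (path-vs-unique p) w
      where
      shuffle : ∀ a b c → a + b + c ≡ c + b + a
      shuffle = solve-∀
    ... | d | inj₁ c = inj₁ (trans d (cong₂ _+_ c c))
    ... | d | inj₂ c = inj₂ (trans d (cong₂ _+_ c c))

  cyc-length : ∀ c → length (edges c) ≡ length (vertices c)
  cyc-length c = cong suc (path-length (Cyc.path c))

  -- The ends of a non-trivial path differ, so a loop can occur only as a cycle of one edge.
  cyc-nonloop : ∀ c {a b e} → e ∈ˡ edges c → Step a e b → a ≢ b → ∀ {e'} → e' ∈ˡ edges c → ∃ λ a' → ∃ λ b' → Step a' e' b' × a' ≢ b'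
  cyc-nonloop (cyc [] s f) (here refl) st a≢b (here refl) = _ , _ , st , a≢b
  cyc-nonloop (cyc p@(cons _ x∉ q) s f) e∈ st a≢b (here refl) = _ , _ , s , λ { refl → x∉ (path-last q) }
  cyc-nonloop (cyc p@(cons _ x∉ q) s f) e∈ st a≢b (there e'∈) = path-edge-step p e'∈

  record Same (c d : Cyc) : Set where
    constructor same
    field
      vs⇒ : ∀ {w} → w ∈ˡ vertices c → w ∈ˡ vertices d
      vs⇐ : ∀ {w} → w ∈ˡ vertices d → w ∈ˡ vertices c
      es⇒ : ∀ {e} → e ∈ˡ edges c → e ∈ˡ edges d
      es⇐ : ∀ {e} → e ∈ˡ edges d → e ∈ˡ edges c

  same-refl : ∀ {c} → Same c c
  same-refl = same (λ i → i) (λ i → i) (λ i → i) (λ i → i)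

  same-edgeSet : ∀ {c d} → Same c d → edgeSet c ≡ edgeSet d
  same-edgeSet s = ⟦⟧-cong (Same.es⇒ s) (Same.es⇐ s)

  module _ {x ts₁ es₁ a e b ts₂ es₂ z f} (p₁ : Path x ts₁ es₁ a) (s : Step a e b) (p₂ : Path b ts₂ es₂ z)
           (t : Step z f x) (fr : f ∉ˡ es₁ ++ e ∷ es₂)
           (p : Path x (ts₁ ++ b ∷ ts₂) (es₁ ++ e ∷ es₂) z) where

    private
      disj : ∀ {w} → w ∈ˡ x ∷ ts₁ → w ∉ˡ b ∷ ts₂
      disj = ++-disjoint (path-vs-unique p)

    rotate : Cyc
    rotate = cyc (path-++ p₂ (cons t (λ z∈ → disj z∈ (path-last p₂)) p₁) (λ w∈ w∈' → disj w∈' w∈)) s fresh'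
      where
      fresh' : e ∉ˡ es₂ ++ f ∷ es₁
      fresh' e∈ with ∈-++⁻ es₂ e∈
      ... | inj₁ i = disj (path-last p₁) (path-inc p₂ i (step-incˡ s))
      ... | inj₂ (here refl) = fr (∈-++⁺ʳ es₁ (here refl))
      ... | inj₂ (there i) = disj (path-inc p₁ i (step-incʳ s)) (here refl)

    rotate-same : Same (cyc p t fr) rotate
    rotate-same = same
      (λ w∈ → [ (λ i → ∈-++⁺ʳ (b ∷ ts₂) i) , (λ i → ∈-++⁺ˡ i) ]′ (∈-++⁻ (x ∷ ts₁) w∈))
      (λ w∈ → [ (λ i → ∈-++⁺ʳ (x ∷ ts₁) i) , (λ i → ∈-++⁺ˡ i) ]′ (∈-++⁻ (b ∷ ts₂) w∈))
      es⇒ es⇐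
      where
      es⇒ : ∀ {d} → d ∈ˡ f ∷ es₁ ++ e ∷ es₂ → d ∈ˡ e ∷ es₂ ++ f ∷ es₁
      es⇒ (here refl) = there (∈-++⁺ʳ es₂ (here refl))
      es⇒ (there d∈) with ∈-++⁻ es₁ d∈
      ... | inj₁ i = there (∈-++⁺ʳ es₂ (there i))
      ... | inj₂ (here refl) = here refl
      ... | inj₂ (there i) = there (∈-++⁺ˡ i)
      es⇐ : ∀ {d} → d ∈ˡ e ∷ es₂ ++ f ∷ es₁ → d ∈ˡ f ∷ es₁ ++ e ∷ es₂
      es⇐ (here refl) = there (∈-++⁺ʳ es₁ (here refl))
      es⇐ (there d∈) with ∈-++⁻ es₂ d∈
      ... | inj₁ i = there (∈-++⁺ʳ es₁ (there i))
      ... | inj₂ (here refl) = here refl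
      ... | inj₂ (there i) = there (∈-++⁺ˡ i)

  -- Any edge may be taken as the closing one; without it the cycle is visibly a path.
  rotateToEdge : ∀ c {e} → e ∈ˡ edges c → Σ Cyc λ d → Cyc.f d ≡ e × Same c d
  rotateToEdge c (here refl) = c , refl , same-refl
  rotateToEdge (cyc p t fr) (there e∈) with splitEdge p e∈
  ... | split p₁ s p₂ = rotate p₁ s p₂ t fr p , refl , rotate-same p₁ s p₂ t fr p

  data SplitBefore (x : V) (z w : V) : List V → List E → Set where
    split : ∀ {a e ts₁ es₁ ts₂ es₂} → Path x ts₁ es₁ a → Step a e w → Path w ts₂ es₂ z →
      SplitBefore x z w (ts₁ ++ w ∷ ts₂) (es₁ ++ e ∷ es₂)

  splitBefore : ∀ {x ts es z w} → Path x ts es z → w ∈ˡ ts → SplitBefore x z w ts es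
  splitBefore (cons s x∉ p) (here refl) = split [] s p
  splitBefore (cons s x∉ p) (there w∈) with splitBefore p w∈
  ... | split p₁ t p₂ = split (cons s (λ x∈ → x∉ (∈-++⁺ˡ x∈)) p₁) t p₂

  rotateToVertex : ∀ c {w} → w ∈ˡ vertices c → Σ Cyc λ d → Cyc.x d ≡ w × Same c d
  rotateToVertex c (here refl) = c , refl , same-refl
  rotateToVertex (cyc p t fr) (there w∈) with splitBefore p w∈
  ... | split p₁ s p₂ = rotate p₁ s p₂ t fr p , refl , rotate-same p₁ s p₂ t fr p

  -- Internally disjoint paths and thetas

  record Parallel {x y ts es ts' es'} (p : Path x ts es y) (q : Path x ts' es' y) : Set where
    constructor parallel
    field
      vs : ∀ {w} → w ∈ˡ x ∷ ts → w ∈ˡ x ∷ ts' → w ≡ x ⊎ w ≡ y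
      -- Demanded separately: two one-edge paths with the same ends have no inner vertices that
      -- could tell their edges apart.
      es∩ : ∀ {e} → e ∈ˡ es → e ∉ˡ es'

  record CycOf {x y ts es ts' es'} (p : Path x ts es y) (q : Path x ts' es' y) : Set where
    field
      c   : Cyc
      vs⇒ : ∀ {w} → w ∈ˡ vertices c → w ∈ˡ x ∷ ts ⊎ w ∈ˡ x ∷ ts'
      es⇒ : ∀ {e} → e ∈ˡ edges c → e ∈ˡ es ++ es'
      es⇐ : ∀ {e} → e ∈ˡ es ++ es' → e ∈ˡ edges c

    set : edgeSet c ≡ ⟦ es ++ es' ⟧
    set = ⟦⟧-cong es⇒ es⇐

  -- The first edge of `q` closes the cycle, so the rest of `q`, reversed, simply continues `p`. The
  -- hypothesis `x ≢ y` guarantees that `q` has a first edge.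
  cycOf : ∀ {x y ts es ts' es'} (p : Path x ts es y) (q : Path x ts' es' y) → x ≢ y → Parallel p q → CycOf p q
  cycOf p [] x≢y _ = ⊥-elim (x≢y refl)
  cycOf {x} {y} {ts} {es} p q@(cons {e = e} {y = x'} {ts = ts'} {es = es'} s x∉ q') x≢y (parallel vs es∩) = record
    { c = cyc (path-++ p R.path disj) (step-sym s) fresh'
    ; vs⇒ = λ w∈ → [ inj₁ , (λ i → inj₂ (there (R.vs⇐ (there i)))) ]′ (∈-++⁻ (x ∷ ts) w∈)
    ; es⇒ = es⇒
    ; es⇐ = es⇐
    }
    where
    module R = Reversed (reverse q')
    disj : ∀ {w} → w ∈ˡ x ∷ ts → w ∉ˡ R.ts'
    disj w∈ w∈' with vs w∈ (there (R.vs⇐ (there w∈')))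
    ... | inj₁ refl = x∉ (R.vs⇐ (there w∈'))
    ... | inj₂ refl = ++-disjoint {ts₁ = []} (path-vs-unique R.path) (here refl) w∈'
    fresh' : e ∉ˡ es ++ R.es'
    fresh' e∈ with ∈-++⁻ es e∈
    ... | inj₁ i = es∩ i (here refl)
    ... | inj₂ i = x∉ (path-inc q' (R.es⇐ i) (step-incˡ s))
    es⇒ : ∀ {d} → d ∈ˡ e ∷ es ++ R.es' → d ∈ˡ es ++ e ∷ es'
    es⇒ (here refl) = ∈-++⁺ʳ es (here refl)
    es⇒ (there d∈) with ∈-++⁻ es d∈
    ... | inj₁ i = ∈-++⁺ˡ i
    ... | inj₂ i = ∈-++⁺ʳ es (there (R.es⇐ i))
    es⇐ : ∀ {d} → d ∈ˡ es ++ e ∷ es' → d ∈ˡ e ∷ es ++ R.es'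
    es⇐ d∈ with ∈-++⁻ es d∈
    ... | inj₁ i = there (∈-++⁺ˡ i)
    ... | inj₂ (here refl) = here refl
    ... | inj₂ (there i) = there (∈-++⁺ʳ es (R.es⇒ i))

  parallel-sym : ∀ {x y ts es ts' es'} {p : Path x ts es y} {q : Path x ts' es' y} → Parallel p q → Parallel q p
  parallel-sym (parallel vs es) = parallel (λ a b → vs b a) (λ a b → es b a)

  isTheta : ∀ {x y ts₁ es₁ ts₂ es₂ ts₃ es₃} {p : Path x ts₁ es₁ y} {q : Path x ts₂ es₂ y} {r : Path x ts₃ es₃ y} →
    x ≢ y → Parallel p q → Parallel p r → Parallel q r → IsTheta G ((⟦ es₁ ⟧ ∪ ⟦ es₂ ⟧) ∪ ⟦ es₃ ⟧)
  isTheta {p = p} {q} {r} x≢y pq pr qr = _ , _ , _ , _ , _ ,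
    path-isPath p x≢y , path-isPath q x≢y , path-isPath r x≢y , ed pq , ed pr , ed qr , vd pq , vd pr , vd qr , refl
    where
    ed : ∀ {x y ts es ts' es'} {p : Path x ts es y} {q : Path x ts' es' y} → Parallel p q → EdgeDisjoint G ⟦ es ⟧ ⟦ es' ⟧
    ed pq e e∈ e∈' = Parallel.es∩ pq (∈⟦⟧⁻ e∈) (∈⟦⟧⁻ e∈')
    vd : ∀ {x y ts es ts' es'} {p : Path x ts es y} {q : Path x ts' es' y} → Parallel p q → ∀ w → InV G ⟦ es ⟧ w → InV G ⟦ es' ⟧ w → w ≡ x ⊎ w ≡ y
    vd {p = p} {q} pq w i j = Parallel.vs pq (path-InV⁻ p i) (path-InV⁻ q j)

  record Arcs (c : Cyc) (m : V) : Set where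
    field
      {ts₁ ts₂} : List V
      {es₁ es₂} : List E
      p₁   : Path (Cyc.x c) ts₁ es₁ m
      p₂   : Path (Cyc.x c) ts₂ es₂ m
      par  : Parallel p₁ p₂
      vs₁  : ∀ {w} → w ∈ˡ Cyc.x c ∷ ts₁ → w ∈ˡ vertices c
      vs₂  : ∀ {w} → w ∈ˡ Cyc.x c ∷ ts₂ → w ∈ˡ vertices c
      es₁⊆ : ∀ {e} → e ∈ˡ es₁ → e ∈ˡ edges c
      es₂⊆ : ∀ {e} → e ∈ˡ es₂ → e ∈ˡ edges c

  arcs : ∀ c {m} → m ∈ˡ Cyc.ts c → Arcs c m
  arcs (cyc {x} {z} {f = f} p s fr) {m} m∈ with splitAt p (there m∈)
  ... | split {ts₁} {es₁} {ts₂} {es₂} p₁ p₂ = record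
    { p₁ = p₁
    ; p₂ = cons (step-sym s) (λ x∈ → x∉ (R.vs⇐ x∈)) R.path
    ; par = parallel vs es∩
    ; vs₁ = ∈-++⁺ˡ
    ; vs₂ = λ { (here refl) → here refl ; (there w∈) → vs₂ (R.vs⇐ w∈) }
    ; es₁⊆ = λ e∈ → there (∈-++⁺ˡ e∈)
    ; es₂⊆ = λ { (here refl) → here refl ; (there e∈) → there (∈-++⁺ʳ es₁ (R.es⇐ e∈)) }
    }
    where
    module R = Reversed (reverse p₂)
    disj : ∀ {w} → w ∈ˡ x ∷ ts₁ → w ∉ˡ ts₂
    disj = ++-disjoint (path-vs-unique p)
    x∉ : x ∉ˡ m ∷ ts₂
    x∉ (here refl) = ++-disjoint {ts₁ = []} (path-vs-unique p) (here refl) m∈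
    x∉ (there x∈) = disj (here refl) x∈
    vs₂ : ∀ {w} → w ∈ˡ m ∷ ts₂ → w ∈ˡ x ∷ ts₁ ++ ts₂
    vs₂ (here refl) = ∈-++⁺ˡ (path-last p₁)
    vs₂ (there i) = ∈-++⁺ʳ (x ∷ ts₁) i
    vs : ∀ {w} → w ∈ˡ x ∷ ts₁ → w ∈ˡ x ∷ z ∷ R.ts' → w ≡ x ⊎ w ≡ m
    vs w∈ (here refl) = inj₁ refl
    vs w∈ (there w∈') with R.vs⇐ w∈'
    ... | here refl = inj₂ refl
    ... | there i = ⊥-elim (disj w∈ i)
    -- Both ends of a common edge would have to be `m`, the only vertex shared by the two halves,
    -- but an edge of a path is no loop.
    no-common : ∀ {e} → e ∈ˡ es₁ → e ∉ˡ es₂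
    no-common e∈ e∈' with path-edge-step p₂ e∈'
    ... | a , b , st , a≢b with path-inc p₂ e∈' (step-incˡ st) | path-inc p₂ e∈' (step-incʳ st)
    ...   | there i | _ = disj (path-inc p₁ e∈ (step-incˡ st)) i
    ...   | here refl | there i = disj (path-inc p₁ e∈ (step-incʳ st)) i
    ...   | here refl | here refl = a≢b refl
    es∩ : ∀ {e} → e ∈ˡ es₁ → e ∉ˡ f ∷ R.es'
    es∩ e∈ (here refl) = fr (∈-++⁺ˡ e∈)
    es∩ e∈ (there i) = no-common e∈ (R.es⇐ i)

-- Circuits and independent sets

module Matroid (G : Graph) (cls : EdgeSet G → Cls G) where

  open Graph G
  open Walks G

  -- Wrapped in a record so that types mentioning independence stay folded.
  record Independent (I : Subset m) : Set where
    constructor independent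
    field
      no-circuit : Indep G cls I

  open Independent public

  record QuasiBiased : Set where
    field
      theta-closed : ∀ T → IsTheta G T → ∀ C₁ C₂ → IsCycle G C₁ → IsCycle G C₂ → C₁ ⊆ T → C₂ ⊆ T
        → C₁ ≢ C₂ → cls C₁ ≡ 𝓑 → cls C₂ ≡ 𝓑 → ∀ C → IsCycle G C → C ⊆ T → cls C ≡ 𝓑
      𝓛-meets-𝓕 : ∀ C D → IsCycle G C → IsCycle G D → cls C ≡ 𝓛 → cls D ≡ 𝓕 → ∃ λ w → InV G C w × InV G D w

  record FlatContractions : Set where
    field
      contraction-connected : ∀ F → IsFlat G cls F → ContractionConnected G cls F

  record ThreeConnected : Set where
    field
      4≤n : 4 ≤ n
      connected-off : ∀ (X : Subset n) → ∣ X ∣ ≤ 2 → ∀ u v → u ∉ X → v ∉ X → Reach G (λ e → src G e ∉ X × tgt G e ∉ X) u v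

  open QuasiBiased public
  open FlatContractions public
  open ThreeConnected public

  NoLone : Subset m → Set
  NoLone S = ∀ {w e} → ¬ Lone w e S

  lone-restrict : ∀ {w e S T} → S ⊆ T → e ∈ S → Lone w e T → Lone w e S
  lone-restrict S⊆T e∈ (lone s l _ u) = lone s l e∈ (λ e'∈ → u (S⊆T e'∈))

  cycle-noLone : ∀ {C} → IsCycle G C → NoLone C
  cycle-noLone (_ , _ , d) {w} l with d w
  ... | inj₁ z = ℕₚ.1+n≢0 (trans (sym (lone⇒deg≡1 l)) z)
  ... | inj₂ t = ℕₚ.1+n≢0 (sym (ℕₚ.suc-injective (trans (sym (lone⇒deg≡1 l)) t)))

  path-lone : ∀ {a b P w e} → IsPath G a b P → Lone w e P → w ≡ a ⊎ w ≡ b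
  path-lone {a} {b} {w = w} (_ , _ , _ , _ , d) l with w ≟ a | w ≟ b
  ... | yes p | _ = inj₁ p
  ... | _ | yes q = inj₂ q
  ... | no p | no q with d w p q
  ...   | inj₁ z = ⊥-elim (ℕₚ.1+n≢0 (trans (sym (lone⇒deg≡1 l)) z))
  ...   | inj₂ t = ⊥-elim (ℕₚ.1+n≢0 (sym (ℕₚ.suc-injective (trans (sym (lone⇒deg≡1 l)) t))))

  path-InVˡ : ∀ {a b P} → IsPath G a b P → InV G P a
  path-InVˡ (_ , _ , d , _) = deg≡1⇒InV d

  path-InVʳ : ∀ {a b P} → IsPath G a b P → InV G P b
  path-InVʳ (_ , _ , _ , d , _) = deg≡1⇒InV d

  path-InV-end : ∀ {a b P w} → IsPath G a b P → w ≡ a ⊎ w ≡ b → InV G P w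
  path-InV-end ip (inj₁ refl) = path-InVˡ ip
  path-InV-end ip (inj₂ refl) = path-InVʳ ip

  -- A leaf on `P` can only be an end of `P`, and there the disjoint path `Q` supplies a second
  -- edge.
  two-paths-lone : ∀ {a b P Q X w e} → IsPath G a b P → IsPath G a b Q → EdgeDisjoint G P Q → P ⊆ X → Q ⊆ X → e ∈ P → ¬ Lone w e X
  two-paths-lone ip iq d P⊆ Q⊆ e∈ l with path-InV-end iq (path-lone ip (lone-restrict P⊆ e∈ l))
  ... | e' , e'∈ , i = d _ (subst (_∈ _) (sym (Lone.unique l (Q⊆ e'∈) i)) e∈) e'∈

  two-paths-noLone : ∀ {a b P Q} → IsPath G a b P → IsPath G a b Q → EdgeDisjoint G P Q → NoLone (P ∪ Q)
  two-paths-noLone {P = P} {Q} ip iq d l with x∈p∪q⁻ P Q (Lone.member l)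
  ... | inj₁ e∈ = two-paths-lone ip iq d (p⊆p∪q Q) (q⊆p∪q P Q) e∈ l
  ... | inj₂ e∈ = two-paths-lone iq ip (λ e i j → d e j i) (q⊆p∪q P Q) (p⊆p∪q Q) e∈ l

  -- In all five shapes a leaf would have to be the end of a path, where another path or a cycle
  -- contributes a further edge. This is the only information about circuits that growing
  -- independent sets requires, apart from their being non-empty.
  circuit-noLone : ∀ {X} → IsCircuit G cls X → NoLone X
  circuit-noLone (inj₁ (c , _)) = cycle-noLone c
  circuit-noLone (inj₂ (inj₁ ((a , b , P , Q , R , ip , iq , ir , pq , pr , qr , _ , _ , _ , refl) , _))) l
    with x∈p∪q⁻ (P ∪ Q) R (Lone.member l)
  ... | inj₁ e∈ = two-paths-noLone ip iq pq (lone-restrict (p⊆p∪q R) e∈ l)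
  ... | inj₂ e∈ = two-paths-lone ir ip (λ e i j → pr e j i) (q⊆p∪q (P ∪ Q) R) (λ i → p⊆p∪q R (p⊆p∪q Q i)) e∈ l
  circuit-noLone (inj₂ (inj₂ (inj₁ (C , D , c , d , _ , _ , _ , _ , refl)))) l with x∈p∪q⁻ C D (Lone.member l)
  ... | inj₁ e∈ = cycle-noLone c (lone-restrict (p⊆p∪q D) e∈ l)
  ... | inj₂ e∈ = cycle-noLone d (lone-restrict (q⊆p∪q C D) e∈ l)
  circuit-noLone (inj₂ (inj₂ (inj₂ (inj₁ (C , D , c , d , _ , _ , _ , refl))))) l with x∈p∪q⁻ C D (Lone.member l)
  ... | inj₁ e∈ = cycle-noLone c (lone-restrict (p⊆p∪q D) e∈ l)
  ... | inj₂ e∈ = cycle-noLone d (lone-restrict (q⊆p∪q C D) e∈ l)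
  circuit-noLone (inj₂ (inj₂ (inj₂ (inj₂ (C , D , P , u , v , c , d , _ , p , uC , vD , _ , _ , _ , _ , refl))))) l
    with x∈p∪q⁻ (C ∪ D) P (Lone.member l)
  ... | inj₁ e∈ with x∈p∪q⁻ C D e∈
  ...   | inj₁ e∈C = cycle-noLone c (lone-restrict (λ i → p⊆p∪q P (p⊆p∪q D i)) e∈C l)
  ...   | inj₂ e∈D = cycle-noLone d (lone-restrict (λ i → p⊆p∪q P (q⊆p∪q C D i)) e∈D l)
  circuit-noLone (inj₂ (inj₂ (inj₂ (inj₂ (C , D , P , u , v , c , d , _ , p , uC , vD , _ , _ , _ , _ , refl))))) l
      | inj₂ e∈ with path-lone p (lone-restrict (q⊆p∪q (C ∪ D) P) e∈ l)
  ...   | inj₁ refl with uC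
  ...     | e' , e'∈ , i = cycle-noLone c (lone-restrict C⊆ (subst (_∈ C) (Lone.unique l (C⊆ e'∈) i) e'∈) l)
    where
    C⊆ : C ⊆ (C ∪ D) ∪ P
    C⊆ i = p⊆p∪q P (p⊆p∪q D i)
  circuit-noLone (inj₂ (inj₂ (inj₂ (inj₂ (C , D , P , u , v , c , d , _ , p , uC , vD , _ , _ , _ , _ , refl))))) l
      | inj₂ e∈ | inj₂ refl with vD
  ...     | e' , e'∈ , i = cycle-noLone d (lone-restrict D⊆ (subst (_∈ D) (Lone.unique l (D⊆ e'∈) i) e'∈) l)
    where
    D⊆ : D ⊆ (C ∪ D) ∪ P
    D⊆ i = p⊆p∪q P (q⊆p∪q C D i)

  circuit-nonempty : ∀ {X} → IsCircuit G cls X → Nonempty X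
  circuit-nonempty (inj₁ ((ne , _) , _)) = ne
  circuit-nonempty (inj₂ (inj₁ ((_ , _ , P , Q , R , ip , _ , _ , _ , _ , _ , _ , _ , _ , refl) , _))) with path-InVˡ ip
  ... | e , e∈ , _ = e , p⊆p∪q R (p⊆p∪q Q e∈)
  circuit-nonempty (inj₂ (inj₂ (inj₁ (C , D , ((e , e∈) , _) , _ , _ , _ , _ , _ , refl)))) = e , p⊆p∪q D e∈
  circuit-nonempty (inj₂ (inj₂ (inj₂ (inj₁ (C , D , ((e , e∈) , _) , _ , _ , _ , _ , refl))))) = e , p⊆p∪q D e∈
  circuit-nonempty (inj₂ (inj₂ (inj₂ (inj₂ (C , D , P , _ , _ , ((e , e∈) , _) , _ , _ , _ , _ , _ , _ , _ , _ , _ , refl))))) =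
    e , p⊆p∪q P (p⊆p∪q D e∈)

  indep-⊆ : ∀ {S T} → S ⊆ T → Independent T → Independent S
  indep-⊆ S⊆T iT = independent λ X c X⊆ → no-circuit iT X c (λ i → S⊆T (X⊆ i))

  indep-⊥ : Independent ⊥
  indep-⊥ = independent λ X c X⊆ → ∉⊥ (X⊆ (proj₂ (circuit-nonempty c)))

  indep-pendant : ∀ {S x e y} → Independent S → Step x e y → y ≢ x → (∀ {e'} → e' ∈ S → ¬ Inc e' x) → Independent (⁅ e ⁆ ∪ S)
  indep-pendant {S} {x} {e} iS s y≢x free = independent λ X c X⊆ → go X c X⊆ (e ∈? X)
    where
    go : ∀ X → IsCircuit G cls X → X ⊆ ⁅ e ⁆ ∪ S → Dec (e ∈ X) → Absurd
    go X c X⊆ (yes e∈) = circuit-noLone c (lone s y≢x e∈ uniq)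
      where
      uniq : ∀ {e'} → e' ∈ X → Inc e' x → e' ≡ e
      uniq e'∈ i with x∈p∪q⁻ ⁅ e ⁆ S (X⊆ e'∈)
      ... | inj₁ q = x∈⁅y⁆⇒x≡y e q
      ... | inj₂ q = ⊥-elim (free q i)
    go X c X⊆ (no e∉) = no-circuit iS X c X⊆S
      where
      X⊆S : X ⊆ S
      X⊆S e'∈ with x∈p∪q⁻ ⁅ e ⁆ S (X⊆ e'∈)
      ... | inj₁ q = ⊥-elim (e∉ (subst (_∈ X) (x∈⁅y⁆⇒x≡y e q) e'∈))
      ... | inj₂ q = q

  -- The first edge of the path would be a leaf edge of `X`, so it is absent from `X`; then the rest
  -- of the path is treated in the same way.
  noLone-in-path : ∀ {X x ts es z} → NoLone X → Path x ts es z → (∀ {e} → e ∈ X → e ∈ˡ es) → ∀ {e} → e ∉ X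
  noLone-in-path nl [] sub e∈ with sub e∈
  ... | ()
  noLone-in-path {X} nl (cons {x} {e} {y} {es = es} s x∉ p) sub = noLone-in-path nl p sub'
    where
    e∉ : e ∉ X
    e∉ e∈ = nl (lone s (λ { refl → x∉ (here refl) }) e∈ uniq)
      where
      uniq : ∀ {e'} → e' ∈ X → Inc e' x → e' ≡ e
      uniq e'∈ i with sub e'∈
      ... | here q = q
      ... | there q = ⊥-elim (x∉ (path-inc p q i))
    sub' : ∀ {e'} → e' ∈ X → e' ∈ˡ es
    sub' e'∈ with sub e'∈
    ... | here refl = ⊥-elim (e∉ e'∈)
    ... | there q = q

  -- If an edge were missing, rotating it into closing position would place `X` inside a path, which
  -- contains no non-empty set without leaves.
  cyc-minimal : ∀ {X} c → NoLone X → Nonempty X → X ⊆ edgeSet c → X ≡ edgeSet c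
  cyc-minimal {X} c nl (e₀ , e₀∈) X⊆ = ⊆-antisym X⊆ c⊆
    where
    c⊆ : edgeSet c ⊆ X
    c⊆ {f} f∈ with f ∈? X
    ... | yes q = q
    ... | no f∉ with rotateToEdge c (∈⟦⟧⁻ f∈)
    ...   | d , refl , sm = ⊥-elim (noLone-in-path nl (Cyc.path d) sub e₀∈)
      where
      sub : ∀ {e} → e ∈ X → e ∈ˡ Cyc.es d
      sub e∈ with Same.es⇒ sm (∈⟦⟧⁻ (X⊆ e∈))
      ... | here refl = ⊥-elim (f∉ e∈)
      ... | there q = q

  cycle-in-cyc : ∀ {C} c → IsCycle G C → C ⊆ edgeSet c → C ≡ edgeSet c
  cycle-in-cyc c ic = cyc-minimal c (cycle-noLone ic) (proj₁ ic)

  -- Two of the paths already form a set without leaves, hence fill the whole cycle by minimality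
  -- and leave no edge for the third.
  three-paths-in-cyc : ∀ c {a b P Q R} → IsPath G a b P → IsPath G a b Q → IsPath G a b R →
    EdgeDisjoint G P Q → EdgeDisjoint G P R → EdgeDisjoint G Q R → ¬ ((P ∪ Q) ∪ R ⊆ edgeSet c)
  three-paths-in-cyc c {P = P} {Q} {R} ip iq ir pq pr qr sub
    with path-InVˡ ip | path-InVˡ ir
  ... | e , e∈ , _ | f , f∈ , _ with cyc-minimal c (two-paths-noLone ip iq pq) (e , p⊆p∪q Q e∈) (λ i → sub (p⊆p∪q R i))
  ...   | eq with x∈p∪q⁻ P Q (subst (f ∈_) (sym eq) (sub (q⊆p∪q (P ∪ Q) R f∈)))
  ...     | inj₁ f∈P = pr f f∈P f∈
  ...     | inj₂ f∈Q = qr f f∈Q f∈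

  -- By minimality the cycle contains no cycle but itself and no theta, whereas every circuit that
  -- is not a single `𝓑`-cycle is a theta or contains two distinct cycles.
  indep-cyc : ∀ c → cls (edgeSet c) ≢ 𝓑 → Independent (edgeSet c)
  indep-cyc c c≢𝓑 = independent go
    where
    go : Indep G cls (edgeSet c)
    go X (inj₁ (ic , b)) X⊆ = c≢𝓑 (subst (λ C → cls C ≡ 𝓑) (cycle-in-cyc c ic X⊆) b)
    go X (inj₂ (inj₁ ((_ , _ , P , Q , R , ip , iq , ir , pq , pr , qr , _ , _ , _ , refl) , _))) X⊆ =
      three-paths-in-cyc c ip iq ir pq pr qr X⊆
    go X (inj₂ (inj₂ (inj₁ (C , D , ic@((e , e∈) , _) , id , dis , _ , _ , _ , refl)))) X⊆
      with cycle-in-cyc c ic (λ i → X⊆ (p⊆p∪q D i)) | cycle-in-cyc c id (λ i → X⊆ (q⊆p∪q C D i))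
    ... | refl | refl = dis e e∈ e∈
    go X (inj₂ (inj₂ (inj₂ (inj₁ (C , D , ic@((e , e∈) , _) , id , dis , _ , _ , refl))))) X⊆
      with cycle-in-cyc c ic (λ i → X⊆ (p⊆p∪q D i)) | cycle-in-cyc c id (λ i → X⊆ (q⊆p∪q C D i))
    ... | refl | refl = dis (src G e) (e , e∈ , inj₁ refl) (e , e∈ , inj₁ refl)
    go X (inj₂ (inj₂ (inj₂ (inj₂ (C , D , P , _ , _ , ic@((e , e∈) , _) , id , dis , _ , _ , _ , _ , _ , _ , _ , refl))))) X⊆
      with cycle-in-cyc c ic (λ i → X⊆ (p⊆p∪q P (p⊆p∪q D i))) | cycle-in-cyc c id (λ i → X⊆ (p⊆p∪q P (q⊆p∪q C D i)))
    ... | refl | refl = dis (src G e) (e , e∈ , inj₁ refl) (e , e∈ , inj₁ refl)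

  module _ (c d : Cyc) (disjoint : ∀ {w} → w ∈ˡ vertices c → w ∉ˡ vertices d) where

    private
      one-side : ∀ c d → (∀ {w} → w ∈ˡ vertices c → w ∉ˡ vertices d) → ∀ {S e} → ConnectedES G S → S ⊆ edgeSet c ∪ edgeSet d →
        e ∈ S → e ∈ edgeSet c → S ⊆ edgeSet c
      one-side c d dj {S} {e} conn S⊆ e∈S e∈c {e'} e'∈ with x∈p∪q⁻ (edgeSet c) (edgeSet d) (S⊆ e'∈)
      ... | inj₁ q = q
      ... | inj₂ q = ⊥-elim (dj (reach-invariant stay (conn _ _ (e , e∈S , inj₁ refl) (e' , e'∈ , inj₁ refl)) (cyc-inc c (∈⟦⟧⁻ e∈c) (inj₁ refl)))
                             (cyc-inc d (∈⟦⟧⁻ q) (inj₁ refl)))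
        where
        stay : ∀ {x f y} → Step x f y → f ∈ S → x ∈ˡ vertices c → y ∈ˡ vertices c
        stay st f∈ x∈ with x∈p∪q⁻ (edgeSet c) (edgeSet d) (S⊆ f∈)
        ... | inj₁ r = cyc-inc c (∈⟦⟧⁻ r) (step-incʳ st)
        ... | inj₂ r = ⊥-elim (dj x∈ (cyc-inc d (∈⟦⟧⁻ r) (step-incˡ st)))

      sides : ∀ {S e} → ConnectedES G S → S ⊆ edgeSet c ∪ edgeSet d → e ∈ S → S ⊆ edgeSet c ⊎ S ⊆ edgeSet d
      sides conn S⊆ e∈ with x∈p∪q⁻ (edgeSet c) (edgeSet d) (S⊆ e∈)
      ... | inj₁ q = inj₁ (one-side c d disjoint conn S⊆ e∈ q)
      ... | inj₂ q = inj₂ (one-side d c (λ a b → disjoint b a) conn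
                       (λ i → subst (_ ∈_) (∪-comm (edgeSet c) (edgeSet d)) (S⊆ i)) e∈ q)

      cycle-side : ∀ {C} → IsCycle G C → C ⊆ edgeSet c ∪ edgeSet d → C ≡ edgeSet c ⊎ C ≡ edgeSet d
      cycle-side ic C⊆ with sides (proj₁ (proj₂ ic)) C⊆ (proj₂ (proj₁ ic))
      ... | inj₁ s = inj₁ (cycle-in-cyc c ic s)
      ... | inj₂ s = inj₂ (cycle-in-cyc d ic s)

      no-common : ∀ {S T w} → S ⊆ edgeSet c → T ⊆ edgeSet d → InV G S w → ¬ InV G T w
      no-common S⊆ T⊆ (e , e∈ , i) (f , f∈ , j) = disjoint (cyc-inc c (∈⟦⟧⁻ (S⊆ e∈)) i) (cyc-inc d (∈⟦⟧⁻ (T⊆ f∈)) j)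

      path-side : ∀ {a b P} → IsPath G a b P → P ⊆ edgeSet c ∪ edgeSet d → P ⊆ edgeSet c ⊎ P ⊆ edgeSet d
      path-side ip P⊆ = sides (proj₁ (proj₂ ip)) P⊆ (proj₁ (proj₂ (path-InVˡ ip)))

    -- Each connected part of a circuit lies on one side, so neither a tight handcuff nor the link
    -- of a loose one fits, and the union of two disjoint cycles alone is a circuit only for the
    -- label `𝓛`.
    indep-disjoint-cycs : cls (edgeSet c) ≡ 𝓕 → cls (edgeSet d) ≡ 𝓕 → Independent (edgeSet c ∪ edgeSet d)
    indep-disjoint-cycs c𝓕 d𝓕 = independent go
      where
      go : Indep G cls (edgeSet c ∪ edgeSet d)
      go X (inj₁ (ic , b)) X⊆ with cycle-side ic X⊆
      ... | inj₁ refl with trans (sym c𝓕) b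
      ...   | ()
      go X (inj₁ (ic , b)) X⊆ | inj₂ refl with trans (sym d𝓕) b
      ...   | ()
      go X (inj₂ (inj₁ ((_ , _ , P , Q , R , ip , iq , ir , pq , pr , qr , _ , _ , _ , refl) , _))) X⊆
        with path-side ip (λ i → X⊆ (p⊆p∪q R (p⊆p∪q Q i))) | path-side iq (λ i → X⊆ (p⊆p∪q R (q⊆p∪q P Q i))) | path-side ir (λ i → X⊆ (q⊆p∪q (P ∪ Q) R i))
      ... | inj₁ p | inj₂ q | _ = no-common p q (path-InVˡ ip) (path-InVˡ iq)
      ... | inj₂ p | inj₁ q | _ = no-common q p (path-InVˡ iq) (path-InVˡ ip)
      ... | inj₁ p | _ | inj₂ r = no-common p r (path-InVˡ ip) (path-InVˡ ir)
      ... | inj₂ p | _ | inj₁ r = no-common r p (path-InVˡ ir) (path-InVˡ ip)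
      ... | inj₁ p | inj₁ q | inj₁ r = three-paths-in-cyc c ip iq ir pq pr qr
              (λ i → [ (λ j → [ p , q ]′ (x∈p∪q⁻ P Q j)) , r ]′ (x∈p∪q⁻ (P ∪ Q) R i))
      ... | inj₂ p | inj₂ q | inj₂ r = three-paths-in-cyc d ip iq ir pq pr qr
              (λ i → [ (λ j → [ p , q ]′ (x∈p∪q⁻ P Q j)) , r ]′ (x∈p∪q⁻ (P ∪ Q) R i))
      go X (inj₂ (inj₂ (inj₁ (C , D , ic@((e , e∈) , _) , id , dis , (w , wC , wD , _) , _ , _ , refl)))) X⊆
        with cycle-side ic (λ i → X⊆ (p⊆p∪q D i)) | cycle-side id (λ i → X⊆ (q⊆p∪q C D i))
      ... | inj₁ refl | inj₁ refl = dis e e∈ e∈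
      ... | inj₂ refl | inj₂ refl = dis e e∈ e∈
      ... | inj₁ refl | inj₂ refl = no-common (λ i → i) (λ i → i) wC wD
      ... | inj₂ refl | inj₁ refl = no-common (λ i → i) (λ i → i) wD wC
      go X (inj₂ (inj₂ (inj₂ (inj₁ (C , D , ic , id , _ , l , _ , refl))))) X⊆
        with cycle-side ic (λ i → X⊆ (p⊆p∪q D i))
      ... | inj₁ refl with trans (sym c𝓕) l
      ...   | ()
      go X (inj₂ (inj₂ (inj₂ (inj₁ (C , D , ic , id , _ , l , _ , refl))))) X⊆ | inj₂ refl with trans (sym d𝓕) l
      ...   | ()
      go X (inj₂ (inj₂ (inj₂ (inj₂ (C , D , P , u , v , ic@((e , e∈) , _) , id , dis , ip , uC , vD , _ , _ , _ , _ , refl))))) X⊆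
        with cycle-side ic (λ i → X⊆ (p⊆p∪q P (p⊆p∪q D i))) | cycle-side id (λ i → X⊆ (p⊆p∪q P (q⊆p∪q C D i))) | path-side ip (λ i → X⊆ (q⊆p∪q (C ∪ D) P i))
      ... | inj₁ refl | inj₁ refl | _ = dis (src G e) (e , e∈ , inj₁ refl) (e , e∈ , inj₁ refl)
      ... | inj₂ refl | inj₂ refl | _ = dis (src G e) (e , e∈ , inj₁ refl) (e , e∈ , inj₁ refl)
      ... | inj₁ refl | inj₂ refl | inj₁ p = no-common p (λ i → i) (path-InVʳ ip) vD
      ... | inj₁ refl | inj₂ refl | inj₂ p = no-common (λ i → i) p uC (path-InVˡ ip)
      ... | inj₂ refl | inj₁ refl | inj₁ p = no-common p (λ i → i) (path-InVˡ ip) uC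
      ... | inj₂ refl | inj₁ refl | inj₂ p = no-common (λ i → i) p vD (path-InVʳ ip)

  -- Growing independent sets

  Touches : Subset m → Subset n → Set
  Touches S W = ∀ {e w} → e ∈ S → Inc e w → w ∈ W

  -- The equation `card` says that one edge is spent for each vertex of `W` outside `U`. Starting
  -- from a single vertex this gives a spanning tree of `W`, starting from a cycle a spanning set
  -- with as many edges as vertices.
  record Grown (K : E → Set) (W : Subset n) (S : Subset m) (U : Subset n) : Set where
    field
      T       : Subset m
      T⊆      : ∀ {e} → e ∈ T → e ∈ S ⊎ K e
      indep   : Independent T
      touches : Touches T W
      card    : ∣ T ∣ + ∣ U ∣ ≡ ∣ S ∣ + ∣ W ∣

  opaque
    -- Adding edges that each reach one new vertex preserves independence, since no circuit contains a lone edge.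
    grow : ∀ {K : E → Set} {W S U} → (∀ {e w} → K e → Inc e w → w ∈ W) → (∀ {w} → w ∈ W → ∃ λ u → u ∈ U × Reach G K w u) →
      Independent S → Touches S U → U ⊆ W → Grown K W S U
    grow {K} {W} {U = U₀} K-in reach-U iS tS U₀⊆W = go ∣ W ∣ reach-U iS tS U₀⊆W (ℕₚ.m≤m+n ∣ W ∣ ∣ U₀ ∣)
      where
      -- `d` bounds the number of vertices of `W` that are still outside `U`.
      go : ∀ d {S U} → (∀ {w} → w ∈ W → ∃ λ u → u ∈ U × Reach G K w u) →
        Independent S → Touches S U → U ⊆ W → ∣ W ∣ ≤ d + ∣ U ∣ → Grown K W S U
      go d {S} {U} rU iS tS U⊆W le with nonempty? (W ∩ ∁ U)
      ... | no none = record
        { T = S ; T⊆ = inj₁ ; indep = iS ; touches = λ e∈ i → U⊆W (tS e∈ i)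
        ; card = cong (∣ S ∣ +_) (ℕₚ.≤-antisym (p⊆q⇒∣p∣≤∣q∣ U⊆W) (p⊆q⇒∣p∣≤∣q∣ W⊆U)) }
        where
        W⊆U : W ⊆ U
        W⊆U {w} w∈ with w ∈? U
        ... | yes q = q
        ... | no w∉ = ⊥-elim (none (w , x∈p∩q⁺ (w∈ , x∉p⇒x∈∁p w∉)))
      ... | yes (w , w∈') with x∈p∩q⁻ W (∁ U) w∈'
      ...   | w∈ , w∈∁ with rU w∈
      ...     | u , u∈ , r with reach-cross {U = _∉ U} (λ v → ¬? (v ∈? U)) r (x∈∁p⇒x∉p w∈∁) (λ u∉ → u∉ u∈)
      ...       | x , e , y , st , ke , x∉ , ¬y∉ with y ∈? U
      ...         | no y∉ = ⊥-elim (¬y∉ y∉)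
      ...         | yes y∈ with d
      ...           | zero = ⊥-elim (ℕₚ.<⇒≱ (s≤s le) (subst (_≤ ∣ W ∣) (∣⁅x⁆∪p∣ x∉) (p⊆q⇒∣p∣≤∣q∣ U'⊆W)))
        where
        U'⊆W : ⁅ x ⁆ ∪ U ⊆ W
        U'⊆W i with x∈p∪q⁻ ⁅ x ⁆ U i
        ... | inj₁ q rewrite x∈⁅y⁆⇒x≡y x q = K-in ke (step-incˡ st)
        ... | inj₂ q = U⊆W q
      ...           | suc d' = result (go d' {⁅ e ⁆ ∪ S} {⁅ x ⁆ ∪ U}
                        (λ v∈ → proj₁ (rU v∈) , q⊆p∪q ⁅ x ⁆ U (proj₁ (proj₂ (rU v∈))) , proj₂ (proj₂ (rU v∈)))
                        (indep-pendant iS st (λ { refl → x∉ y∈ }) (λ e'∈ i → x∉ (tS e'∈ i)))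
                        touch U'⊆W
                        (ℕₚ.≤-trans le (ℕₚ.≤-reflexive (trans (sym (ℕₚ.+-suc d' ∣ U ∣)) (cong (d' +_) (sym (∣⁅x⁆∪p∣ x∉)))))))
        where
        U'⊆W : ⁅ x ⁆ ∪ U ⊆ W
        U'⊆W i with x∈p∪q⁻ ⁅ x ⁆ U i
        ... | inj₁ q rewrite x∈⁅y⁆⇒x≡y x q = K-in ke (step-incˡ st)
        ... | inj₂ q = U⊆W q
        touch : Touches (⁅ e ⁆ ∪ S) (⁅ x ⁆ ∪ U)
        touch e'∈ i with x∈p∪q⁻ ⁅ e ⁆ S e'∈
        ... | inj₂ q = q⊆p∪q ⁅ x ⁆ U (tS q i)
        ... | inj₁ q rewrite x∈⁅y⁆⇒x≡y e q with step-inc⁻ st i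
        ...   | inj₁ refl = p⊆p∪q U (x∈⁅x⁆ x)
        ...   | inj₂ refl = q⊆p∪q ⁅ x ⁆ U y∈
        e∉S : e ∉ S
        e∉S e∈ = x∉ (tS e∈ (step-incˡ st))
        result : Grown K W (⁅ e ⁆ ∪ S) (⁅ x ⁆ ∪ U) → Grown K W S U
        result g = record { T = T ; T⊆ = T⊆' ; indep = indep ; touches = touches ; card = card' }
          where
          open Grown g
          T⊆' : ∀ {e'} → e' ∈ T → e' ∈ S ⊎ K e'
          T⊆' e'∈ with T⊆ e'∈
          ... | inj₂ k = inj₂ k
          ... | inj₁ q with x∈p∪q⁻ ⁅ e ⁆ S q
          ...   | inj₁ r rewrite x∈⁅y⁆⇒x≡y e r = inj₂ ke
          ...   | inj₂ r = inj₁ r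
          card' : ∣ T ∣ + ∣ U ∣ ≡ ∣ S ∣ + ∣ W ∣
          card' = ℕₚ.suc-injective (trans (sym (ℕₚ.+-suc ∣ T ∣ ∣ U ∣)) (trans (cong (∣ T ∣ +_) (sym (∣⁅x⁆∪p∣ x∉)))
                    (trans card (cong (_+ ∣ W ∣) (∣⁅x⁆∪p∣ e∉S)))))

-- Upper bounds for independent sets

module Rank (G : Graph) (cls : EdgeSet G → Cls G) (qb : Matroid.QuasiBiased G cls) where

  open Graph G
  open Walks G
  open Matroid G cls

  _⊆ᶜ_ : Cyc → Subset m → Set
  c ⊆ᶜ S = ∀ {e} → e ∈ˡ edges c → e ∈ S

  Apart : Cyc → Cyc → Set
  Apart c d = ∀ {w} → w ∈ˡ vertices c → w ∉ˡ vertices d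

  module _ {S : Subset m} (iS : Independent S) where

    cyc-unbalanced : ∀ c → c ⊆ᶜ S → cls (edgeSet c) ≢ 𝓑
    cyc-unbalanced c c⊆ b = no-circuit iS _ (inj₁ (cyc-isCycle c , b)) (λ i → c⊆ (∈⟦⟧⁻ i))

    -- No labels have to be known: if one of the cycles is in `𝓑` it is a circuit, and otherwise the
    -- theta itself is one.
    no-theta : ∀ {x y ts₁ es₁ ts₂ es₂ ts₃ es₃} {p : Path x ts₁ es₁ y} {q : Path x ts₂ es₂ y} {r : Path x ts₃ es₃ y} →
      x ≢ y → Parallel p q → Parallel p r → Parallel q r →
      (∀ {e} → e ∈ˡ es₁ → e ∈ S) → (∀ {e} → e ∈ˡ es₂ → e ∈ S) → (∀ {e} → e ∈ˡ es₃ → e ∈ S) → Absurd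
    no-theta {es₁ = es₁} {es₂ = es₂} {es₃ = es₃} x≢y pq pr qr s₁ s₂ s₃ =
      no-circuit iS _ (inj₂ (inj₁ (isTheta x≢y pq pr qr , λ C ic C⊆ b → no-circuit iS C (inj₁ (ic , b)) (λ i → sub (C⊆ i))))) sub
      where
      sub : (⟦ es₁ ⟧ ∪ ⟦ es₂ ⟧) ∪ ⟦ es₃ ⟧ ⊆ S
      sub i with x∈p∪q⁻ (⟦ es₁ ⟧ ∪ ⟦ es₂ ⟧) ⟦ es₃ ⟧ i
      ... | inj₂ j = s₃ (∈⟦⟧⁻ j)
      ... | inj₁ j with x∈p∪q⁻ ⟦ es₁ ⟧ ⟦ es₂ ⟧ j
      ...   | inj₁ k = s₁ (∈⟦⟧⁻ k)
      ...   | inj₂ k = s₂ (∈⟦⟧⁻ k)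

    private
      ∪-sub : ∀ c d → c ⊆ᶜ S → d ⊆ᶜ S → edgeSet c ∪ edgeSet d ⊆ S
      ∪-sub c d c⊆ d⊆ i = [ (λ j → c⊆ (∈⟦⟧⁻ j)) , (λ j → d⊆ (∈⟦⟧⁻ j)) ]′ (x∈p∪q⁻ (edgeSet c) (edgeSet d) i)

    no-tight-handcuff : ∀ c d {w} → c ⊆ᶜ S → d ⊆ᶜ S → (∀ {e} → e ∈ˡ edges c → e ∉ˡ edges d) →
      w ∈ˡ vertices c → w ∈ˡ vertices d → (∀ {v} → v ∈ˡ vertices c → v ∈ˡ vertices d → v ≡ w) → Absurd
    no-tight-handcuff c d c⊆ d⊆ dis wc wd only =
      no-circuit iS _ (inj₂ (inj₂ (inj₁ (_ , _ , cyc-isCycle c , cyc-isCycle d , (λ e i j → dis (∈⟦⟧⁻ i) (∈⟦⟧⁻ j)) ,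
        (_ , cyc-InV⁺ c wc , cyc-InV⁺ d wd , λ x i j → only (cyc-InV⁻ c i) (cyc-InV⁻ d j)) ,
        cyc-unbalanced c c⊆ , cyc-unbalanced d d⊆ , refl)))) (∪-sub c d c⊆ d⊆)

    -- Two 𝓛-cycles would form a circuit, and an 𝓛-cycle meets every 𝓕-cycle.
    apart-𝓕 : ∀ c d → c ⊆ᶜ S → d ⊆ᶜ S → Apart c d → cls (edgeSet c) ≡ 𝓕 × cls (edgeSet d) ≡ 𝓕
    apart-𝓕 c d c⊆ d⊆ ap with cls (edgeSet c) in ceq | cls (edgeSet d) in deq
    ... | 𝓑 | _ = ⊥-elim (cyc-unbalanced c c⊆ ceq)
    ... | _ | 𝓑 = ⊥-elim (cyc-unbalanced d d⊆ deq)
    ... | 𝓕 | 𝓕 = refl , refl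
    ... | 𝓛 | 𝓛 = ⊥-elim (no-circuit iS _ (inj₂ (inj₂ (inj₂ (inj₁ (_ , _ , cyc-isCycle c , cyc-isCycle d ,
                     (λ w i j → ap (cyc-InV⁻ c i) (cyc-InV⁻ d j)) , ceq , deq , refl))))) (∪-sub c d c⊆ d⊆))
    ... | 𝓛 | 𝓕 with 𝓛-meets-𝓕 qb _ _ (cyc-isCycle c) (cyc-isCycle d) ceq deq
    ...   | w , i , j = ⊥-elim (ap (cyc-InV⁻ c i) (cyc-InV⁻ d j))
    apart-𝓕 c d c⊆ d⊆ ap | 𝓕 | 𝓛 with 𝓛-meets-𝓕 qb _ _ (cyc-isCycle d) (cyc-isCycle c) deq ceq
    ...   | w , i , j = ⊥-elim (ap (cyc-InV⁻ c j) (cyc-InV⁻ d i))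

    -- Disjoint cycles in an independent set are forced to have label `𝓕`, and exactly then a
    -- linking path completes a circuit.
    no-loose-handcuff : ∀ c d {u ts es v} → c ⊆ᶜ S → d ⊆ᶜ S → Apart c d → Path u ts es v → (∀ {e} → e ∈ˡ es → e ∈ S) →
      u ∈ˡ vertices c → v ∈ˡ vertices d → (∀ {w} → w ∈ˡ u ∷ ts → w ∈ˡ vertices c → w ≡ u) →
      (∀ {w} → w ∈ˡ u ∷ ts → w ∈ˡ vertices d → w ≡ v) → Absurd
    no-loose-handcuff c d {es = es} c⊆ d⊆ ap p p⊆ u∈ v∈ onlyc onlyd =
      no-circuit iS _ (inj₂ (inj₂ (inj₂ (inj₂ (_ , _ , _ , _ , _ , cyc-isCycle c , cyc-isCycle d ,
        (λ w i j → ap (cyc-InV⁻ c i) (cyc-InV⁻ d j)) , path-isPath p (λ { refl → ap u∈ v∈ }) , cyc-InV⁺ c u∈ , cyc-InV⁺ d v∈ ,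
        (λ x i j → onlyc (path-InV⁻ p i) (cyc-InV⁻ c j)) , (λ x i j → onlyd (path-InV⁻ p i) (cyc-InV⁻ d j)) ,
        proj₁ both , proj₂ both , refl)))))
        (λ i → [ ∪-sub c d c⊆ d⊆ , (λ j → p⊆ (∈⟦⟧⁻ j)) ]′ (x∈p∪q⁻ (edgeSet c ∪ edgeSet d) ⟦ es ⟧ i))
      where both = apart-𝓕 c d c⊆ d⊆ ap

  -- Says that the component of `w` in `J` is not a tree, without introducing components.
  record CycleNear (J : Subset m) (w : V) : Set where
    constructor near
    field
      c     : Cyc
      c⊆    : c ⊆ᶜ J
      {v}   : V
      v∈    : v ∈ˡ vertices c
      reach : Reach G (_∈ J) w v

  module _ {J e x y} (e∉J : e ∉ J) (st : Step x e y) (iS : Independent (⁅ e ⁆ ∪ J)) where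

    private
      S = ⁅ e ⁆ ∪ J

      J⊆ : J ⊆ S
      J⊆ = q⊆p∪q ⁅ e ⁆ J

      e∈S : e ∈ S
      e∈S = p⊆p∪q J (x∈⁅x⁆ e)

      -- The stick `P` runs from `x` to the first vertex `x'` on the cycle `c`, and `A` collects the
      -- vertices of stick and cycle. A path from `y` is followed up to its first vertex `m` in `A`;
      -- together with `e` it forms an ear, and the position of `m` decides which circuit arises.
      module Lollipop (c : Cyc) (c⊆ : c ⊆ᶜ J) {x' tsP esP} (P : Path x tsP esP x') (P⊆ : ∀ {d} → d ∈ˡ esP → d ∈ J)
                      (x'∈ : x' ∈ˡ vertices c) (onlyP : ∀ {w} → w ∈ˡ x ∷ tsP → w ∈ˡ vertices c → w ≡ x') where

        A : List V
        A = (x ∷ tsP) ++ vertices c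

        P∈A : ∀ {w} → w ∈ˡ x ∷ tsP → w ∈ˡ A
        P∈A = ∈-++⁺ˡ

        c∈A : ∀ {w} → w ∈ˡ vertices c → w ∈ˡ A
        c∈A = ∈-++⁺ʳ (x ∷ tsP)

        module R = Reversed (reverse P)

        R⊆ : ∀ {d} → d ∈ˡ R.es' → d ∈ J
        R⊆ i = P⊆ (R.es⇐ i)

        P-edge : ∀ {d} → d ∈ˡ esP → d ∉ˡ edges c
        P-edge d∈ d∈c with path-edge-step P d∈
        ... | a , b , s , a≢b = a≢b (trans (onlyP (path-inc P d∈ (step-incˡ s)) (cyc-inc c d∈c (step-incˡ s)))
                                     (sym (onlyP (path-inc P d∈ (step-incʳ s)) (cyc-inc c d∈c (step-incʳ s)))))

        module Ear {m tsQ esQ} (Q : Path y tsQ esQ m) (Q⊆ : ∀ {d} → d ∈ˡ esQ → d ∈ J)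
                   (onlyQ : ∀ {w} → w ∈ˡ y ∷ tsQ → w ∈ˡ A → w ≡ m) where

          Q-edge : ∀ {d} → d ∈ˡ esQ → d ∉ˡ edges c
          Q-edge d∈ d∈c with path-edge-step Q d∈
          ... | a , b , s , a≢b = a≢b (trans (onlyQ (path-inc Q d∈ (step-incˡ s)) (c∈A (cyc-inc c d∈c (step-incˡ s))))
                                       (sym (onlyQ (path-inc Q d∈ (step-incʳ s)) (c∈A (cyc-inc c d∈c (step-incʳ s))))))

          closeUp : ∀ {ts es} (Pr : Path m ts es x) → (∀ {w} → w ∈ˡ m ∷ ts → w ∈ˡ A) → (∀ {d} → d ∈ˡ es → d ∈ J) →
            Σ Cyc λ D → (D ⊆ᶜ S) × (∀ {w} → w ∈ˡ vertices D → w ∈ˡ y ∷ tsQ ⊎ w ∈ˡ ts) × (∀ {w} → w ∈ˡ y ∷ tsQ → w ∈ˡ vertices D)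
              × (∀ {d} → d ∈ˡ edges D → d ≡ e ⊎ d ∈ˡ esQ ⊎ d ∈ˡ es)
          closeUp {ts} {es} Pr Pr∈A Pr⊆ =
            cyc (path-++ Q Pr disj) st (λ i → e∉J ([ Q⊆ , Pr⊆ ]′ (∈-++⁻ esQ i))) ,
            (λ { (here refl) → e∈S ; (there i) → J⊆ ([ Q⊆ , Pr⊆ ]′ (∈-++⁻ esQ i)) }) ,
            ∈-++⁻ (y ∷ tsQ) , ∈-++⁺ˡ , λ { (here q) → inj₁ q ; (there i) → inj₂ (∈-++⁻ esQ i) }
            where
            disj : ∀ {w} → w ∈ˡ y ∷ tsQ → w ∉ˡ ts
            disj w∈ w∈' with onlyQ w∈ (Pr∈A (there w∈'))
            ... | refl = ++-disjoint {ts₁ = []} (path-vs-unique Pr) (here refl) w∈'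

          -- If the ear ends at `x'`, it closes through the stick to a cycle meeting `c` only there:
          -- a tight handcuff. If it ends elsewhere on `c`, stick and ear together join two vertices
          -- of `c`: a theta.
          contra-c : m ∈ˡ vertices c → Absurd
          contra-c m∈ with m ≟ x'
          ... | yes refl with closeUp R.path (λ i → P∈A (R.vs⇐ i)) R⊆
          ...   | D , D⊆ , vD , Q∈D , eD = no-tight-handcuff iS D c D⊆ (λ i → J⊆ (c⊆ i)) dis (Q∈D (path-last Q)) m∈ only
            where
            dis : ∀ {d} → d ∈ˡ edges D → d ∉ˡ edges c
            dis d∈ d∈c with eD d∈
            ... | inj₁ refl = e∉J (c⊆ d∈c)
            ... | inj₂ (inj₁ i) = Q-edge i d∈c
            ... | inj₂ (inj₂ i) = P-edge (R.es⇐ i) d∈c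
            only : ∀ {w} → w ∈ˡ vertices D → w ∈ˡ vertices c → w ≡ m
            only w∈ w∈c with vD w∈
            ... | inj₁ i = onlyQ i (c∈A w∈c)
            ... | inj₂ i = onlyP (R.vs⇐ (there i)) w∈c
          contra-c m∈ | no m≢x' with rotateToVertex c x'∈
          ...   | c' , refl , sm with Same.vs⇒ sm m∈
          ...     | here q = m≢x' q
          ...     | there m∈ts = no-theta iS {p = p₁} {q = p₂} {r = ear} (λ q → m≢x' (sym q)) par
                      (parallel (λ w∈ → vs (Same.vs⇐ sm (vs₁ w∈))) (λ d∈ → es∩ (Same.es⇐ sm (es₁⊆ d∈))))
                      (parallel (λ w∈ → vs (Same.vs⇐ sm (vs₂ w∈))) (λ d∈ → es∩ (Same.es⇐ sm (es₂⊆ d∈))))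
                      (λ i → J⊆ (c⊆ (Same.es⇐ sm (es₁⊆ i)))) (λ i → J⊆ (c⊆ (Same.es⇐ sm (es₂⊆ i)))) ear⊆
            where
            open Arcs (arcs c' m∈ts)
            P∩Q : ∀ {w} → w ∈ˡ x ∷ tsP → w ∉ˡ y ∷ tsQ
            P∩Q w∈ w∈' with onlyQ w∈' (P∈A w∈)
            ... | refl = m≢x' (onlyP w∈ m∈)
            ear : Path x' (R.ts' ++ y ∷ tsQ) (R.es' ++ e ∷ esQ) m
            ear = path-++ R.path (cons st (P∩Q (here refl)) Q) (λ w∈ → P∩Q (R.vs⇐ w∈))
            ear⊆ : ∀ {d} → d ∈ˡ R.es' ++ e ∷ esQ → d ∈ S
            ear⊆ d∈ with ∈-++⁻ R.es' d∈
            ... | inj₁ i = J⊆ (R⊆ i)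
            ... | inj₂ (here refl) = e∈S
            ... | inj₂ (there i) = J⊆ (Q⊆ i)
            vs : ∀ {w} → w ∈ˡ vertices c → w ∈ˡ x' ∷ R.ts' ++ y ∷ tsQ → w ≡ x' ⊎ w ≡ m
            vs w∈c w∈ with ∈-++⁻ (x' ∷ R.ts') w∈
            ... | inj₁ i = inj₁ (onlyP (R.vs⇐ i) w∈c)
            ... | inj₂ i = inj₂ (onlyQ i (c∈A w∈c))
            es∩ : ∀ {d} → d ∈ˡ edges c → d ∉ˡ R.es' ++ e ∷ esQ
            es∩ d∈c d∈ with ∈-++⁻ R.es' d∈
            ... | inj₁ i = P-edge (R.es⇐ i) d∈c
            ... | inj₂ (here refl) = e∉J (c⊆ d∈c)
            ... | inj₂ (there i) = Q-edge i d∈c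

          -- The ear closes with the front part of the stick to a cycle away from `c`, and the
          -- remaining part of the stick links the two: a loose handcuff.
          contra-P : m ∈ˡ x ∷ tsP → m ∉ˡ vertices c → Absurd
          contra-P m∈ m∉c = go (splitAt P m∈) (path-vs-unique P) P∈A P⊆ onlyP
            where
            go : ∀ {ts es} → SplitAt x x' m ts es → Unique (x ∷ ts) → (∀ {w} → w ∈ˡ x ∷ ts → w ∈ˡ A) → (∀ {d} → d ∈ˡ es → d ∈ J) →
              (∀ {w} → w ∈ˡ x ∷ ts → w ∈ˡ vertices c → w ≡ x') → Absurd
            go (split {ts₁} {es₁} {ts₂} {es₂} Pa Pb) uniq ∈A ⊆J only with closeUp (Reversed.path (reverse Pa)) (λ i → ∈A (∈-++⁺ˡ (Reversed.vs⇐ (reverse Pa) i))) (λ i → ⊆J (∈-++⁺ˡ (Reversed.es⇐ (reverse Pa) i)))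
            ... | D , D⊆ , vD , Q∈D , _ = no-loose-handcuff iS D c D⊆ (λ i → J⊆ (c⊆ i)) apart Pb (λ i → J⊆ (⊆J (∈-++⁺ʳ es₁ i)))
                    (Q∈D (path-last Q)) x'∈ onlyD (λ w∈ → only (Pb⊆ w∈))
              where
              module Ra = Reversed (reverse Pa)
              disj : ∀ {w} → w ∈ˡ x ∷ ts₁ → w ∉ˡ ts₂
              disj = ++-disjoint uniq
              Pb⊆ : ∀ {w} → w ∈ˡ m ∷ ts₂ → w ∈ˡ x ∷ ts₁ ++ ts₂
              Pb⊆ (here refl) = ∈-++⁺ˡ (path-last Pa)
              Pb⊆ (there i) = ∈-++⁺ʳ (x ∷ ts₁) i
              apart : Apart D c
              apart w∈ w∈c with vD w∈
              ... | inj₁ i with onlyQ i (c∈A w∈c)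
              ...   | refl = m∉c w∈c
              apart w∈ w∈c | inj₂ i with only (∈-++⁺ˡ (Ra.vs⇐ (there i))) w∈c | path-last Pb
              ...   | refl | here refl = m∉c w∈c
              ...   | refl | there j = disj (Ra.vs⇐ (there i)) j
              onlyD : ∀ {w} → w ∈ˡ m ∷ ts₂ → w ∈ˡ vertices D → w ≡ m
              onlyD (here refl) _ = refl
              onlyD (there i) w∈ with vD w∈
              ... | inj₁ j = onlyQ j (∈A (Pb⊆ (there i)))
              ... | inj₂ j = ⊥-elim (disj (Ra.vs⇐ (there j)) i)

    -- The reason why a component of an independent set carries at most one cycle: an edge joining
    -- two vertices that each see a cycle always completes a theta or a handcuff.
    two-near-cycles : CycleNear J x → CycleNear J y → Absurd
    two-near-cycles (near c c⊆ {v} v∈ r) (near c' c'⊆ {v'} v'∈ r') with reach⇒path r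
    ... | pathIn p p⊆ with splitFirst {A = _∈ˡ vertices c} (λ w → w ∈ˡ? vertices c) p v∈
    ...   | split {x'} {tsP} {esP} P _ x'∈ onlyP = unreached (λ a a∈ ra → reached a a∈ ra)
      where
      open Lollipop c c⊆ P (λ i → p⊆ (∈-++⁺ˡ i)) x'∈ onlyP
      reached : ∀ a → a ∈ˡ A → ¬ Reach G (_∈ J) y a
      reached a a∈ ra with reach⇒path ra
      ... | pathIn q q⊆ with splitFirst {A = _∈ˡ A} (λ w → w ∈ˡ? A) q a∈
      ...   | split {m} Q _ m∈ onlyQ with m ∈ˡ? vertices c
      ...     | yes m∈c = Ear.contra-c Q (λ i → q⊆ (∈-++⁺ˡ i)) onlyQ m∈c
      ...     | no m∉c with ∈-++⁻ (x ∷ tsP) m∈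
      ...       | inj₁ m∈P = Ear.contra-P Q (λ i → q⊆ (∈-++⁺ˡ i)) onlyQ m∈P m∉c
      ...       | inj₂ m∈c = m∉c m∈c
      -- Now the component of `y` misses the lollipop entirely, so `c` and `c'` are disjoint and
      -- stick, `e` and `Q` link them.
      unreached : (∀ a → a ∈ˡ A → ¬ Reach G (_∈ J) y a) → Absurd
      unreached none with reach⇒path r'
      ... | pathIn q q⊆ with splitFirst {A = _∈ˡ vertices c'} (λ w → w ∈ˡ? vertices c') q v'∈
      ...   | split {y'} {tsQ} {esQ} Q _ y'∈ onlyQ =
        no-loose-handcuff iS c c' (λ i → J⊆ (c⊆ i)) (λ i → J⊆ (c'⊆ i)) (λ i j → none _ (c∈A i) (c'-reach j))
          (path-++ R.path (cons st (P∩Q (here refl)) Q) (λ w∈ → P∩Q (R.vs⇐ w∈))) link⊆ x'∈ y'∈ onlyc onlyc'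
        where
        Q-reach : ∀ {w} → w ∈ˡ y ∷ tsQ → Reach G (_∈ J) y w
        Q-reach w∈ = reach-trans (path-reach Q (λ i → q⊆ (∈-++⁺ˡ i)) (here refl)) (reach-sym (path-reach Q (λ i → q⊆ (∈-++⁺ˡ i)) w∈))
        c'-reach : ∀ {w} → w ∈ˡ vertices c' → Reach G (_∈ J) y w
        c'-reach w∈ = reach-trans r' (cyc-reach c' c'⊆ v'∈ w∈)
        P∩Q : ∀ {w} → w ∈ˡ x ∷ tsP → w ∉ˡ y ∷ tsQ
        P∩Q w∈ w∈' = none _ (P∈A w∈) (Q-reach w∈')
        link⊆ : ∀ {d} → d ∈ˡ R.es' ++ e ∷ esQ → d ∈ S
        link⊆ d∈ with ∈-++⁻ R.es' d∈
        ... | inj₁ i = J⊆ (R⊆ i)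
        ... | inj₂ (here refl) = e∈S
        ... | inj₂ (there i) = J⊆ (q⊆ (∈-++⁺ˡ i))
        onlyc : ∀ {w} → w ∈ˡ x' ∷ R.ts' ++ y ∷ tsQ → w ∈ˡ vertices c → w ≡ x'
        onlyc w∈ w∈c with ∈-++⁻ (x' ∷ R.ts') w∈
        ... | inj₁ i = onlyP (R.vs⇐ i) w∈c
        ... | inj₂ i = ⊥-elim (none _ (c∈A w∈c) (Q-reach i))
        onlyc' : ∀ {w} → w ∈ˡ x' ∷ R.ts' ++ y ∷ tsQ → w ∈ˡ vertices c' → w ≡ y'
        onlyc' w∈ w∈c with ∈-++⁻ (x' ∷ R.ts') w∈
        ... | inj₁ i = ⊥-elim (none _ (P∈A (R.vs⇐ i)) (c'-reach w∈c))
        ... | inj₂ i = onlyQ i w∈c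

  -- The count is an equation, so a single root already yields `∣ I ∣ < ∣ W ∣`; without a root at
  -- hand, the vertex in question sees a cycle.
  record Roots (I : Subset m) (W : Subset n) : Set where
    constructor roots
    field
      R    : Subset n
      card : ∣ I ∣ + ∣ R ∣ ≡ ∣ W ∣
      root : ∀ {w} → w ∈ W → (∃ λ r → r ∈ R × Reach G (_∈ I) w r) ⊎ CycleNear I w

  private
    roots-of : ∀ {I W} → Independent I → Touches I W → Roots I W
    roots-of {I} {W} iI tI = go ∣ I ∣ ℕₚ.≤-refl iI tI
      where
      go : ∀ d {I} → ∣ I ∣ ≤ d → Independent I → Touches I W → Roots I W
      go d {I} le iI tI with nonempty? I
      ... | no none = roots W (cong (_+ ∣ W ∣) (trans (cong ∣_∣ (Empty-unique none)) (∣⊥∣≡0 m))) (λ w∈ → inj₁ (_ , w∈ , here))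
      go zero {I} le iI tI | yes (e , e∈) = ⊥-elim (ℕₚ.1+n≢0 (trans (sym (∣p∖x∣ e∈)) (ℕₚ.n≤0⇒n≡0 le)))
      go (suc d) {I} le iI tI | yes (e , e∈) =
        add (go d {J} (ℕₚ.≤-pred (subst (_≤ suc d) (∣p∖x∣ e∈) le)) (indep-⊆ J⊆I iI) (λ d∈ → tI (J⊆I d∈)))
        where
        J : Subset m
        J = I ∖ e
        J⊆I : J ⊆ I
        J⊆I i = proj₁ (∈∖⁻ {p = I} i)
        x : V
        x = src G e
        y : V
        y = tgt G e
        mono : ∀ {a b} → Reach G (_∈ J) a b → Reach G (_∈ I) a b
        mono = reach-mono J⊆I
        near-mono : ∀ {w} → CycleNear J w → CycleNear I w
        near-mono (near c c⊆ v∈ r) = near c (λ i → J⊆I (c⊆ i)) v∈ (mono r)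
        near-pull : ∀ {w w'} → Reach G (_∈ I) w w' → CycleNear I w' → CycleNear I w
        near-pull r (near c c⊆ v∈ s) = near c c⊆ v∈ (reach-trans r s)
        x~y : Reach G (_∈ I) x y
        x~y = reach-step (step-ends e) e∈ here

        module _ (old : Roots J W) where
          open Roots old

          -- Dropping the root r is sound as soon as r is connected to another root or to a cycle.
          drop : ∀ {r} → r ∈ R → (∃ λ s → s ∈ R × s ≢ r × Reach G (_∈ I) r s) ⊎ CycleNear I r → Roots I W
          drop {r} r∈ new = roots (R ∖ r) card' root'
            where
            card' : ∣ I ∣ + ∣ R ∖ r ∣ ≡ ∣ W ∣
            card' = trans (cong (_+ ∣ R ∖ r ∣) (∣p∖x∣ e∈)) (trans (sym (ℕₚ.+-suc ∣ J ∣ _)) (trans (cong (∣ J ∣ +_) (sym (∣p∖x∣ r∈))) card))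
            root' : ∀ {w} → w ∈ W → (∃ λ s → s ∈ R ∖ r × Reach G (_∈ I) w s) ⊎ CycleNear I w
            root' w∈ with root w∈
            ... | inj₂ nr = inj₂ (near-mono nr)
            ... | inj₁ (s , s∈ , ws) with s ≟ r
            ...   | no s≢ = inj₁ (s , ∈∖⁺ s∈ s≢ , mono ws)
            ...   | yes refl = [ (λ { (t , t∈ , t≢ , rt) → inj₁ (t , ∈∖⁺ t∈ t≢ , reach-trans (mono ws) rt) })
                               , (λ nr → inj₂ (near-pull (mono ws) nr)) ]′ new

        -- Putting `e` back must cost one root. Two cycles cannot be joined; a tree joined to a
        -- cycle or to another tree gives up its root; an edge inside one tree closes a cycle with
        -- the path through the common root.
        add : Roots J W → Roots I W
        add old with Roots.root old (tI e∈ (inj₁ refl)) | Roots.root old (tI e∈ (inj₂ refl))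
        ... | inj₂ nx | inj₂ ny = ⊥-elim (two-near-cycles (λ e∈J → proj₂ (∈∖⁻ {p = I} e∈J) refl) (step-ends e) (subst (Independent) (insert-∖ e∈) iI) nx ny)
        ... | inj₁ (r , r∈ , xr) | inj₂ ny = drop old r∈ (inj₂ (near-pull (reach-trans (reach-sym (mono xr)) x~y) (near-mono ny)))
        ... | inj₂ nx | inj₁ (s , s∈ , ys) = drop old s∈ (inj₂ (near-pull (reach-trans (reach-sym (mono ys)) (reach-sym x~y)) (near-mono nx)))
        ... | inj₁ (r , r∈ , xr) | inj₁ (s , s∈ , ys) with s ≟ r
        ...   | no s≢ = drop old r∈ (inj₁ (s , s∈ , s≢ , reach-trans (reach-sym (mono xr)) (reach-trans x~y (mono ys))))
        ...   | yes refl with reach⇒path (reach-trans xr (reach-sym ys))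
        ...     | pathIn p p⊆ = drop old r∈ (inj₂ (near (cyc p (step-sym (step-ends e)) (λ i → proj₂ (∈∖⁻ {p = I} (p⊆ i)) refl))
                    (λ { (here refl) → e∈ ; (there i) → J⊆I (p⊆ i) }) (here refl) (reach-sym (mono xr))))

  opaque
    indep-roots : ∀ {I W} → Independent I → Touches I W → Roots I W
    indep-roots = roots-of

  indep-card≤ : ∀ {I W} → Independent I → Touches I W → ∣ I ∣ ≤ ∣ W ∣
  indep-card≤ iI tI = subst (_ ≤_) (Roots.card r) (ℕₚ.m≤m+n _ _)
    where r = indep-roots iI tI

  roots-nonempty : ∀ {I W r} (ρ : Roots I W) → r ∈ Roots.R ρ → suc ∣ I ∣ ≤ ∣ W ∣
  roots-nonempty {I} ρ r∈ = subst (suc ∣ I ∣ ≤_) (Roots.card ρ)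
    (ℕₚ.≤-trans (ℕₚ.≤-reflexive (ℕₚ.+-comm 1 ∣ I ∣)) (ℕₚ.+-monoʳ-≤ ∣ I ∣ (subst (1 ≤_) (sym (∣p∖x∣ r∈)) (s≤s z≤n))))

  -- An independent set has no cycle in `𝓑`, so here it is a forest and `w` must reach a root.
  indep-balanced-card< : ∀ {I W w} → Independent I → Touches I W → w ∈ W → (∀ c → c ⊆ᶜ I → cls (edgeSet c) ≡ 𝓑) → suc ∣ I ∣ ≤ ∣ W ∣
  indep-balanced-card< iI tI w∈ bal with indep-roots iI tI
  ... | ρ with Roots.root ρ w∈
  ...   | inj₁ (r , r∈ , _) = roots-nonempty ρ r∈
  ...   | inj₂ (near c c⊆ _ _) = ⊥-elim (cyc-unbalanced iI c c⊆ (bal c c⊆))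

  -- Balanced edge sets and the theta property

  𝓑? : (K : Cls G) → Dec (K ≡ 𝓑)
  𝓑? 𝓑 = yes refl
  𝓑? 𝓛 = no (λ ())
  𝓑? 𝓕 = no (λ ())

  Balanced : Subset m → Set
  Balanced S = ∀ c → c ⊆ᶜ S → cls (edgeSet c) ≡ 𝓑

  theta-balanced : ∀ {x y ts₁ es₁ ts₂ es₂ ts₃ es₃} {p : Path x ts₁ es₁ y} {q : Path x ts₂ es₂ y} {r : Path x ts₃ es₃ y} →
    x ≢ y → Parallel p q → Parallel p r → Parallel q r →
    cls ⟦ es₁ ++ es₂ ⟧ ≡ 𝓑 → cls ⟦ es₁ ++ es₃ ⟧ ≡ 𝓑 → cls ⟦ es₂ ++ es₃ ⟧ ≡ 𝓑
  theta-balanced {es₁ = es₁} {es₂ = es₂} {es₃ = es₃} {p = p} {q} {r} x≢y pq pr qr b b' =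
    theta-closed qb _ (isTheta x≢y pq pr qr) _ _ (isCycle pq) (isCycle pr) (sub₁₂ ∈₁ ∈₂) (sub₁₂ ∈₁ ∈₃) differ b b' _ (isCycle qr) (sub₁₂ ∈₂ ∈₃)
    where
    T = (⟦ es₁ ⟧ ∪ ⟦ es₂ ⟧) ∪ ⟦ es₃ ⟧
    isCycle : ∀ {ts es ts' es'} {p : Path _ ts es _} {q : Path _ ts' es' _} → Parallel p q → IsCycle G ⟦ es ++ es' ⟧
    isCycle {p = p} {q} par = subst (IsCycle G) (CycOf.set (cycOf p q x≢y par)) (cyc-isCycle (CycOf.c (cycOf p q x≢y par)))
    ∈₁ : ∀ {e} → e ∈ˡ es₁ → e ∈ T
    ∈₁ i = p⊆p∪q ⟦ es₃ ⟧ (p⊆p∪q ⟦ es₂ ⟧ (∈⟦⟧⁺ i))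
    ∈₂ : ∀ {e} → e ∈ˡ es₂ → e ∈ T
    ∈₂ i = p⊆p∪q ⟦ es₃ ⟧ (q⊆p∪q ⟦ es₁ ⟧ ⟦ es₂ ⟧ (∈⟦⟧⁺ i))
    ∈₃ : ∀ {e} → e ∈ˡ es₃ → e ∈ T
    ∈₃ i = q⊆p∪q (⟦ es₁ ⟧ ∪ ⟦ es₂ ⟧) ⟦ es₃ ⟧ (∈⟦⟧⁺ i)
    sub₁₂ : ∀ {es es'} → (∀ {e} → e ∈ˡ es → e ∈ T) → (∀ {e} → e ∈ˡ es' → e ∈ T) → ⟦ es ++ es' ⟧ ⊆ T
    sub₁₂ {es} f g i = [ f , g ]′ (∈-++⁻ es (∈⟦⟧⁻ i))
    nonempty : ∀ {ts es} → Path _ ts es _ → ∃ λ e → e ∈ˡ es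
    nonempty [] = ⊥-elim (x≢y refl)
    nonempty (cons _ _ _) = _ , here refl
    -- The theta property requires two different cycles; an edge of `q` lies in the first and not in
    -- the second.
    differ : ⟦ es₁ ++ es₂ ⟧ ≢ ⟦ es₁ ++ es₃ ⟧
    differ eq with nonempty q
    ... | e , e∈ with ∈-++⁻ es₁ (∈⟦⟧⁻ (subst (e ∈_) eq (∈⟦⟧⁺ (∈-++⁺ʳ es₁ e∈))))
    ...   | inj₁ i = Parallel.es∩ pq i e∈
    ...   | inj₂ i = Parallel.es∩ qr e∈ i

  path-closed : ∀ {x ts es} → Path x ts es x → es ≡ []
  path-closed [] = refl
  path-closed (cons s x∉ p) = ⊥-elim (x∉ (path-last p))

  -- A common edge would have two distinct common ends, since edges of a path are no loops.
  path-shares-no-edge : ∀ {x ts es y x' ts' es' y' h} → Path x ts es y → Path x' ts' es' y' →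
    (∀ {w} → w ∈ˡ x ∷ ts → w ∈ˡ x' ∷ ts' → w ≡ h) → ∀ {d} → d ∈ˡ es → d ∉ˡ es'
  path-shares-no-edge p q only d∈ d∈' with path-edge-step p d∈
  ... | a , b , s , a≢b = a≢b (trans (only (path-inc p d∈ (step-incˡ s)) (path-inc q d∈' (step-incˡ s)))
                              (sym (only (path-inc p d∈ (step-incʳ s)) (path-inc q d∈' (step-incʳ s)))))

  step-unique : ∀ {x e y a b} → Step x e y → Step a e b → (a ≡ x × b ≡ y) ⊎ (a ≡ y × b ≡ x)
  step-unique (inj₁ (refl , refl)) (inj₁ (refl , refl)) = inj₁ (refl , refl)
  step-unique (inj₁ (refl , refl)) (inj₂ (refl , refl)) = inj₂ (refl , refl)
  step-unique (inj₂ (refl , refl)) (inj₁ (refl , refl)) = inj₂ (refl , refl)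
  step-unique (inj₂ (refl , refl)) (inj₂ (refl , refl)) = inj₁ (refl , refl)

  module _ {S : Subset m} (balS : Balanced S) {x e y} (st : Step x e y) (e∉S : e ∉ S) where

    private
      module Detour
        {s tsA esA} (A : Path x tsA esA s) (A⊆ : ∀ {d} → d ∈ˡ esA → d ∈ S)
        {h tsa esa tsb esb} (Ra : Path s tsa esa h) (Rb : Path h tsb esb y)
        (R⊆ : ∀ {d} → d ∈ˡ esa ++ esb → d ∈ S)
        (uniqR : Unique (s ∷ tsa ++ tsb)) (A∩R : ∀ {w} → w ∈ˡ x ∷ tsA → w ∉ˡ tsa ++ tsb)
        {f s' tsg esg} (sf : Step s f s') (s∉ : s ∉ˡ s' ∷ tsg) (Sg : Path s' tsg esg h) (Sg⊆ : ∀ {d} → d ∈ˡ f ∷ esg → d ∈ S)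
        (A∩Sg : ∀ {w} → w ∈ˡ x ∷ tsA → w ∉ˡ s' ∷ tsg)
        (only : ∀ {w} → w ∈ˡ s' ∷ tsg → w ∈ˡ s ∷ tsa ++ tsb → w ≡ h)
        (f∉ : f ∉ˡ esa ++ esb)
        where

        seg : Path s (s' ∷ tsg) (f ∷ esg) h
        seg = cons sf s∉ Sg

        s≢h : s ≢ h
        s≢h refl = s∉ (path-last Sg)

        Ra⊆ : ∀ {w} → w ∈ˡ s ∷ tsa → w ∈ˡ s ∷ tsa ++ tsb
        Ra⊆ = ∈-++⁺ˡ

        Rb⊆ : ∀ {w} → w ∈ˡ h ∷ tsb → w ∈ˡ s ∷ tsa ++ tsb
        Rb⊆ (here refl) = ∈-++⁺ˡ (path-last Ra)
        Rb⊆ (there i) = ∈-++⁺ʳ (s ∷ tsa) i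

        a∩b : ∀ {w} → w ∈ˡ s ∷ tsa → w ∉ˡ tsb
        a∩b = ++-disjoint uniqR

        s∉Rb : s ∉ˡ h ∷ tsb
        s∉Rb (here q) = s≢h q
        s∉Rb (there i) = a∩b (here refl) i

        A∩Ra : ∀ {w} → w ∈ˡ x ∷ tsA → w ∈ˡ s ∷ tsa → w ≡ s
        A∩Ra i (here q) = q
        A∩Ra i (there j) = ⊥-elim (A∩R i (∈-++⁺ˡ j))

        A∩Rb : ∀ {w} → w ∈ˡ x ∷ tsA → w ∉ˡ h ∷ tsb
        A∩Rb i j with Rb⊆ j
        ... | here refl = s∉Rb j
        ... | there k = A∩R i k

        Ra∩Rb : ∀ {w} → w ∈ˡ s ∷ tsa → w ∈ˡ h ∷ tsb → w ≡ h
        Ra∩Rb i (here q) = q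
        Ra∩Rb i (there j) = ⊥-elim (a∩b i j)

        A∩seg : ∀ {w} → w ∈ˡ x ∷ tsA → w ∈ˡ s ∷ s' ∷ tsg → w ≡ s
        A∩seg i (here q) = q
        A∩seg i (there j) = ⊥-elim (A∩Sg i j)

        Rb∩seg : ∀ {w} → w ∈ˡ h ∷ tsb → w ∈ˡ s ∷ s' ∷ tsg → w ≡ h
        Rb∩seg i (here refl) = ⊥-elim (s∉Rb i)
        Rb∩seg i (there j) = only j (Rb⊆ i)

        module VA = Reversed (reverse A)
        module VB = Reversed (reverse Rb)

        y∷rB : Path x (y ∷ VB.ts') (e ∷ VB.es') h
        y∷rB = cons st (λ i → A∩Rb (here refl) (VB.vs⇐ i)) VB.path

        -- the part of the cycle that is left alone: from s backwards to x, then e, then backwards to h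
        back : Path s (VA.ts' ++ y ∷ VB.ts') (VA.es' ++ e ∷ VB.es') h
        back = path-++ VA.path y∷rB (λ i j → A∩Rb (VA.vs⇐ i) (VB.vs⇐ j))

        back-vs : ∀ {w} → w ∈ˡ s ∷ VA.ts' ++ y ∷ VB.ts' → w ∈ˡ x ∷ tsA ⊎ w ∈ˡ h ∷ tsb
        back-vs i = [ (λ j → inj₁ (VA.vs⇐ j)) , (λ j → inj₂ (VB.vs⇐ j)) ]′ (∈-++⁻ (s ∷ VA.ts') i)

        back-es : ∀ {d} → d ∈ˡ VA.es' ++ e ∷ VB.es' → d ∈ˡ esA ⊎ d ≡ e ⊎ d ∈ˡ esb
        back-es i with ∈-++⁻ VA.es' i
        ... | inj₁ j = inj₁ (VA.es⇐ j)
        ... | inj₂ (here q) = inj₂ (inj₁ q)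
        ... | inj₂ (there j) = inj₂ (inj₂ (VB.es⇐ j))

        back-es⁺ : ∀ {d} → d ∈ˡ esA ⊎ d ≡ e ⊎ d ∈ˡ esb → d ∈ˡ VA.es' ++ e ∷ VB.es'
        back-es⁺ (inj₁ j) = ∈-++⁺ˡ (VA.es⇒ j)
        back-es⁺ (inj₂ (inj₁ q)) = ∈-++⁺ʳ VA.es' (here q)
        back-es⁺ (inj₂ (inj₂ j)) = ∈-++⁺ʳ VA.es' (there (VB.es⇒ j))

        par-a-back : Parallel Ra back
        par-a-back = parallel
          (λ i j → [ (λ k → inj₁ (A∩Ra k i)) , (λ k → inj₂ (Ra∩Rb i k)) ]′ (back-vs j))
          (λ i j → [ (λ k → path-shares-no-edge A Ra A∩Ra k i)
                   , [ (λ { refl → e∉S (R⊆ (∈-++⁺ˡ i)) }) , (λ k → path-shares-no-edge Ra Rb Ra∩Rb i k) ]′ ]′ (back-es j))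

        par-seg-back : Parallel seg back
        par-seg-back = parallel
          (λ i j → [ (λ k → inj₁ (A∩seg k i)) , (λ k → inj₂ (Rb∩seg k i)) ]′ (back-vs j))
          (λ i j → [ (λ k → path-shares-no-edge A seg A∩seg k i)
                   , [ (λ { refl → e∉S (Sg⊆ i) }) , (λ k → path-shares-no-edge Rb seg Rb∩seg k i) ]′ ]′ (back-es j))

        par-a-seg : Parallel Ra seg
        par-a-seg = parallel
          (λ { i (here q) → inj₁ q ; i (there j) → inj₂ (only j (Ra⊆ i)) })
          (λ { i (here refl) → f∉ (∈-++⁺ˡ i) ; i (there j) → path-shares-no-edge Sg Ra (λ a b → only a (Ra⊆ b)) j i })

        -- `Ra`, `seg` and `back` form a theta. One of its cycles is the given balanced one, the
        -- cycle of `Ra` and `seg` avoids `e` and so lies in the balanced set `S`, and the third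
        -- cycle is the detour.
        detour : cls ⟦ e ∷ esA ++ (esa ++ esb) ⟧ ≡ 𝓑 → cls ⟦ e ∷ (esA ++ f ∷ esg) ++ esb ⟧ ≡ 𝓑
        detour b = subst (λ C → cls C ≡ 𝓑) (⟦⟧-cong to₂ from₂)
          (theta-balanced s≢h par-a-back par-a-seg (parallel-sym par-seg-back)
            (subst (λ C → cls C ≡ 𝓑) (⟦⟧-cong to₁ from₁) b)
            (subst (λ C → cls C ≡ 𝓑) (CycOf.set cs) (balS (CycOf.c cs)
              (λ i → [ (λ j → R⊆ (∈-++⁺ˡ j)) , Sg⊆ ]′ (∈-++⁻ esa (CycOf.es⇒ cs i))))))
          where
          cs = cycOf Ra seg s≢h par-a-seg
          to₁ : ∀ {d} → d ∈ˡ e ∷ esA ++ (esa ++ esb) → d ∈ˡ esa ++ (VA.es' ++ e ∷ VB.es')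
          to₁ (here q) = ∈-++⁺ʳ esa (back-es⁺ (inj₂ (inj₁ q)))
          to₁ (there i) with ∈-++⁻ esA i
          ... | inj₁ j = ∈-++⁺ʳ esa (back-es⁺ (inj₁ j))
          ... | inj₂ j = [ ∈-++⁺ˡ , (λ k → ∈-++⁺ʳ esa (back-es⁺ (inj₂ (inj₂ k)))) ]′ (∈-++⁻ esa j)
          from₁ : ∀ {d} → d ∈ˡ esa ++ (VA.es' ++ e ∷ VB.es') → d ∈ˡ e ∷ esA ++ (esa ++ esb)
          from₁ i with ∈-++⁻ esa i
          ... | inj₁ j = there (∈-++⁺ʳ esA (∈-++⁺ˡ j))
          ... | inj₂ j with back-es j
          ...   | inj₁ k = there (∈-++⁺ˡ k)
          ...   | inj₂ (inj₁ q) = here q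
          ...   | inj₂ (inj₂ k) = there (∈-++⁺ʳ esA (∈-++⁺ʳ esa k))
          to₂ : ∀ {d} → d ∈ˡ (VA.es' ++ e ∷ VB.es') ++ (f ∷ esg) → d ∈ˡ e ∷ (esA ++ f ∷ esg) ++ esb
          to₂ i with ∈-++⁻ (VA.es' ++ e ∷ VB.es') i
          ... | inj₂ j = there (∈-++⁺ˡ (∈-++⁺ʳ esA j))
          ... | inj₁ j with back-es j
          ...   | inj₁ k = there (∈-++⁺ˡ (∈-++⁺ˡ k))
          ...   | inj₂ (inj₁ q) = here q
          ...   | inj₂ (inj₂ k) = there (∈-++⁺ʳ (esA ++ f ∷ esg) k)
          from₂ : ∀ {d} → d ∈ˡ e ∷ (esA ++ f ∷ esg) ++ esb → d ∈ˡ (VA.es' ++ e ∷ VB.es') ++ (f ∷ esg)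
          from₂ (here q) = ∈-++⁺ˡ (back-es⁺ (inj₂ (inj₁ q)))
          from₂ (there i) with ∈-++⁻ (esA ++ f ∷ esg) i
          ... | inj₂ k = ∈-++⁺ˡ (back-es⁺ (inj₂ (inj₂ k)))
          ... | inj₁ j = [ (λ k → ∈-++⁺ˡ (back-es⁺ (inj₁ k))) , (λ k → ∈-++⁺ʳ (VA.es' ++ e ∷ VB.es') k) ]′ (∈-++⁻ esA j)

      record Fork (s : V) (tsA : List V) (esA : List E) (ts : List V) (es : List E) : Set where
        constructor fork
        field
          tail  : Path s ts es y
          inS   : ∀ {d} → d ∈ˡ es → d ∈ S
          apart : ∀ {w} → w ∈ˡ x ∷ tsA → w ∉ˡ ts

      -- A is the initial segment shared by the two paths; each round replaces one more piece of the first path by a piece of the second.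
      reroute : ∀ k {s tsA esA ts₁ es₁ ts₂ es₂} → length ts₂ ≤ k → Path x tsA esA s → (∀ {d} → d ∈ˡ esA → d ∈ S) →
        Fork s tsA esA ts₁ es₁ → Fork s tsA esA ts₂ es₂ → cls ⟦ e ∷ esA ++ es₁ ⟧ ≡ 𝓑 → cls ⟦ e ∷ esA ++ es₂ ⟧ ≡ 𝓑
      reroute k le A A⊆ (fork R₁ _ _) (fork [] _ _) b rewrite path-closed R₁ = b
      reroute k le A A⊆ (fork [] _ _) (fork (cons _ s∉ p) _ _) b = ⊥-elim (s∉ (path-last p))
      reroute (suc k) {s} {tsA} {esA} (s≤s le) A A⊆ (fork R₁@(cons {e = f₁} {ts = ts₁} {es₁} sf₁ s∉₁ R₁') R₁⊆ A∩₁) (fork (cons {e = f} {ts = ts₂} {es₂} sf s∉ R₂') R₂⊆ A∩₂) b with f ≟ f₁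
      ... | yes refl with step-unique sf₁ sf
      ...   | inj₂ (refl , _) = ⊥-elim (s∉₁ (here refl))
      ...   | inj₁ (_ , refl) = subst (λ es → cls ⟦ e ∷ es ⟧ ≡ 𝓑) (++-assoc esA [ f ] es₂)
              (reroute k le (path-snoc A sf (λ i → A∩₁ i (here refl))) (λ i → [ A⊆ , (λ { (here refl) → R₁⊆ (here refl) }) ]′ (∈-++⁻ esA i))
                (fork R₁' (λ i → R₁⊆ (there i)) (apart' R₁' A∩₁)) (fork R₂' (λ i → R₂⊆ (there i)) (apart' R₂' A∩₂))
                (subst (λ es → cls ⟦ e ∷ es ⟧ ≡ 𝓑) (sym (++-assoc esA [ f ] es₁)) b))
        where
        apart' : ∀ {s' ts es} → Path s' ts es y → (∀ {w} → w ∈ˡ x ∷ tsA → w ∉ˡ s' ∷ ts) → ∀ {w} → w ∈ˡ x ∷ tsA ++ [ s' ] → w ∉ˡ ts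
        apart' p d i j with ∈-++⁻ (x ∷ tsA) i
        ... | inj₁ q = d q (there j)
        ... | inj₂ (here refl) = ++-disjoint {ts₁ = []} (path-vs-unique p) (here refl) j
      reroute (suc k) {s} {tsA} {esA} (s≤s le) A A⊆ (fork R₁@(cons {e = f₁} sf₁ s∉₁ R₁') R₁⊆ A∩₁) (fork (cons {e = f} {s'} sf s∉ R₂') R₂⊆ A∩₂) b
          | no f≢ = via (splitFirst (λ w → w ∈ˡ? _) R₂' (path-last R₁)) le s∉ R₂⊆ A∩₂ (path-vs-unique R₂')
        where
        f∉₁ : f ∉ˡ _
        f∉₁ (here q) = f≢ q
        f∉₁ (there i) = s∉₁ (path-inc R₁' i (step-incˡ sf))
        via : ∀ {ts₂ es₂} → SplitFirst (_∈ˡ _) s' y ts₂ es₂ → length ts₂ ≤ k → s ∉ˡ s' ∷ ts₂ → (∀ {d} → d ∈ˡ f ∷ es₂ → d ∈ S) →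
          (∀ {w} → w ∈ˡ x ∷ tsA → w ∉ˡ s' ∷ ts₂) → Unique (s' ∷ ts₂) → cls ⟦ e ∷ esA ++ f ∷ es₂ ⟧ ≡ 𝓑
        -- The second path has left the first at `s`, and `h` is its first return. After the detour
        -- both paths agree up to `h`, and the remainder of the second has become shorter, which is
        -- what `k` measures.
        via (split {h} {tsg} {esg} {ts₂'} {es₂'} Sg R₂'' h∈ only) le s∉ R₂⊆ A∩₂ uniq₂ =
          via' (splitAt R₁ h∈) (path-vs-unique R₁) R₁⊆ A∩₁ only f∉₁ b
          where
          via' : ∀ {ts₁ es₁} → SplitAt s y h ts₁ es₁ → Unique (s ∷ ts₁) → (∀ {d} → d ∈ˡ es₁ → d ∈ S) → (∀ {w} → w ∈ˡ x ∷ tsA → w ∉ˡ ts₁) →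
            (∀ {w} → w ∈ˡ s' ∷ tsg → w ∈ˡ s ∷ ts₁ → w ≡ h) → f ∉ˡ es₁ → cls ⟦ e ∷ esA ++ es₁ ⟧ ≡ 𝓑 → cls ⟦ e ∷ esA ++ f ∷ esg ++ es₂' ⟧ ≡ 𝓑
          via' (split {tsa} {esa} {tsb} {esb} Ra Rb) uniq₁ R₁⊆ A∩₁ only f∉ b =
            subst (λ es → cls ⟦ e ∷ es ⟧ ≡ 𝓑) (++-assoc esA (f ∷ esg) es₂')
              (reroute k (ℕₚ.≤-trans (ℕₚ.≤-trans (ℕₚ.m≤n+m (length ts₂') (length tsg)) (ℕₚ.≤-reflexive (sym (length-++ tsg)))) le)
                (path-++ A D.seg (λ i → A∩Sg i)) (λ i → [ A⊆ , Sg⊆ ]′ (∈-++⁻ esA i))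
                (fork Rb (λ i → R₁⊆ (∈-++⁺ʳ esa i)) apart₁) (fork R₂'' (λ i → R₂⊆ (there (∈-++⁺ʳ esg i))) apart₂)
                (D.detour b))
            where
            Sg⊆ : ∀ {d} → d ∈ˡ f ∷ esg → d ∈ S
            Sg⊆ i = R₂⊆ (∈-++⁺ˡ i)
            A∩Sg : ∀ {w} → w ∈ˡ x ∷ tsA → w ∉ˡ s' ∷ tsg
            A∩Sg i j = A∩₂ i (∈-++⁺ˡ j)
            module D = Detour A A⊆ Ra Rb R₁⊆ uniq₁ A∩₁ sf (λ i → s∉ (∈-++⁺ˡ i)) Sg Sg⊆ A∩Sg only f∉
            apart₁ : ∀ {w} → w ∈ˡ x ∷ tsA ++ s' ∷ tsg → w ∉ˡ tsb
            apart₁ i j with ∈-++⁻ (x ∷ tsA) i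
            ... | inj₁ q = A∩₁ q (∈-++⁺ʳ tsa j)
            ... | inj₂ q with only q (∈-++⁺ʳ (s ∷ tsa) j)
            ...   | refl = ++-disjoint {ts₁ = []} (path-vs-unique Rb) (here refl) j
            apart₂ : ∀ {w} → w ∈ˡ x ∷ tsA ++ s' ∷ tsg → w ∉ˡ ts₂'
            apart₂ i j with ∈-++⁻ (x ∷ tsA) i
            ... | inj₁ q = A∩₂ q (there (∈-++⁺ʳ tsg j))
            ... | inj₂ q = ++-disjoint uniq₂ q j

    -- A cycle of the larger set either avoids `e` or, rotated and possibly reversed, consists of
    -- `e` and another path from `x` to `y` in `S`, to which `reroute` carries the balance of `P`.
    balanced-insert : ∀ {ts es} → Path x ts es y → (∀ {d} → d ∈ˡ es → d ∈ S) → cls ⟦ e ∷ es ⟧ ≡ 𝓑 → Balanced (⁅ e ⁆ ∪ S)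
    balanced-insert P P⊆ b c c⊆ with e ∈ˡ? edges c
    ... | no e∉ = balS c (λ i → [ (λ j → ⊥-elim (e∉ (subst (_∈ˡ edges c) (x∈⁅y⁆⇒x≡y e j) i))) , (λ j → j) ]′ (x∈p∪q⁻ ⁅ e ⁆ S (c⊆ i)))
    ... | yes e∈ with rotateToEdge c e∈
    ...   | d@(cyc Q t fr) , refl , sm = subst (λ C → cls C ≡ 𝓑) (sym (same-edgeSet sm)) (go Q t fr (λ i → Q⊆ i (Same.es⇐ sm (there i))))
      where
      Q⊆ : ∀ {d'} → d' ∈ˡ Cyc.es d → d' ∈ˡ edges c → d' ∈ S
      Q⊆ i j with x∈p∪q⁻ ⁅ e ⁆ S (c⊆ j)
      ... | inj₂ k = k
      ... | inj₁ k rewrite x∈⁅y⁆⇒x≡y e k = ⊥-elim (fr i)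
      from-x : ∀ {ts' es'} → Path x ts' es' y → (∀ {d} → d ∈ˡ es' → d ∈ S) → cls ⟦ e ∷ es' ⟧ ≡ 𝓑
      from-x {ts'} Q Q⊆ = reroute (length ts') ℕₚ.≤-refl [] (λ ())
        (fork P P⊆ (λ { (here refl) → ++-disjoint {ts₁ = []} (path-vs-unique P) (here refl) }))
        (fork Q Q⊆ (λ { (here refl) → ++-disjoint {ts₁ = []} (path-vs-unique Q) (here refl) })) b
      go : ∀ {a b ts' es'} → Path a ts' es' b → Step b e a → e ∉ˡ es' → (∀ {d} → d ∈ˡ es' → d ∈ S) → cls ⟦ e ∷ es' ⟧ ≡ 𝓑
      go Q t fr Q⊆ with step-unique st t
      ... | inj₂ (refl , refl) = from-x Q Q⊆
      ... | inj₁ (refl , refl) = subst (λ C → cls C ≡ 𝓑)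
        (⟦⟧-cong {xs = e ∷ V.es'} {ys = e ∷ _} (λ { (here q) → here q ; (there i) → there (V.es⇐ i) }) (λ { (here q) → here q ; (there i) → there (V.es⇒ i) }))
        (from-x V.path (λ i → Q⊆ (V.es⇐ i)))
        where module V = Reversed (reverse Q)

  balanced-⊆ : ∀ {S T} → S ⊆ T → Balanced T → Balanced S
  balanced-⊆ S⊆T b c c⊆ = b c (λ i → S⊆T (c⊆ i))

  record BalancedEar (S : Subset m) (e : E) : Set where
    constructor balancedEar
    field
      {x y}    : V
      {ts}     : List V
      {es}     : List E
      step     : Step x e y
      path     : Path x ts es y
      within   : ∀ {d} → d ∈ˡ es → d ∈ S
      balanced : cls ⟦ e ∷ es ⟧ ≡ 𝓑

  -- The ears all lie in the original `S`, so they remain available while edges are inserted one at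
  -- a time. For a given cycle, only its own finitely many edges have to be inserted.
  balanced-extend : ∀ {S T} → Balanced S → (∀ {e} → e ∈ T → e ∈ S ⊎ BalancedEar S e) → Balanced T
  balanced-extend {S} {T} bS ears c c⊆ = go (edges c) (λ i → ears (c⊆ i)) c (λ i → p⊆p∪q S (∈⟦⟧⁺ i))
    where
    go : ∀ xs → (∀ {e} → e ∈ˡ xs → e ∈ S ⊎ BalancedEar S e) → Balanced (⟦ xs ⟧ ∪ S)
    go [] _ = balanced-⊆ (λ i → [ (λ j → case ∈⟦⟧⁻ j of λ ()) , (λ j → j) ]′ (x∈p∪q⁻ _ S i)) bS
    go (e ∷ xs) ear = balanced-⊆ sub insert
      where
      S' = ⟦ xs ⟧ ∪ S
      rest : Balanced S'
      rest = go xs (λ i → ear (there i))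
      sub : ⟦ e ∷ xs ⟧ ∪ S ⊆ ⁅ e ⁆ ∪ S'
      sub {d} i = subst (d ∈_) (trans (cong (_∪ S) (⟦∷⟧ e xs)) (∪-assoc ⁅ e ⁆ ⟦ xs ⟧ S)) i
      already : e ∈ S' → Balanced (⁅ e ⁆ ∪ S')
      already e∈ = balanced-⊆ (λ i → [ (λ j → subst (_∈ S') (sym (x∈⁅y⁆⇒x≡y e j)) e∈) , (λ j → j) ]′ (x∈p∪q⁻ ⁅ e ⁆ S' i)) rest
      insert : Balanced (⁅ e ⁆ ∪ S')
      insert with e ∈? S' | ear (here refl)
      ... | yes e∈ | _ = already e∈
      ... | no e∉ | inj₁ e∈ = already (q⊆p∪q ⟦ xs ⟧ S e∈)
      ... | no e∉ | inj₂ (balancedEar st P P⊆ b) = balanced-insert rest st e∉ P (λ i → q⊆p∪q ⟦ xs ⟧ S (P⊆ i)) b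

-- Contractions of rank two that are disconnected

module Contraction (G : Graph) (cls : EdgeSet G → Cls G) (qb : Matroid.QuasiBiased G cls)
  (unb : Matroid.FlatContractions G cls) (g3 : Matroid.ThreeConnected G cls) where

  open Graph G
  open Walks G
  open Matroid G cls
  open Rank G cls qb

  UpperBound LowerBound : Subset m → ℕ → Set
  UpperBound S k = ∀ I → I ⊆ S → Independent I → ∣ I ∣ ≤ k
  LowerBound S k = ∃ λ I → I ⊆ S × Independent I × k ≤ ∣ I ∣

  opaque
    -- Descends from the upper bound to the first value that is attained. Whether an independent set
    -- of a given size exists is not decided, hence the double negation.
    rank-exists : ∀ {S} k → UpperBound S k → ¬ ¬ (∃ λ r → IsRank G cls S r)
    rank-exists zero ub none = none (0 , (⊥ , (λ i → ⊥-elim (∉⊥ i)) , no-circuit indep-⊥ , ∣⊥∣≡0 m) , λ I I⊆ iI → ub I I⊆ (independent iI))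
    rank-exists {S} (suc k) ub none = rank-exists k smaller none
      where
      smaller : UpperBound S k
      smaller I I⊆ iI with ∣ I ∣ ℕₚ.≟ suc k
      ... | yes eq = ⊥-elim (none (suc k , (I , I⊆ , no-circuit iI , eq) , λ J J⊆ iJ → ub J J⊆ (independent iJ)))
      ... | no neq = ℕₚ.≤-pred (ℕₚ.≤∧≢⇒< (ub I I⊆ iI) neq)

    -- The closure of F₀ is obtained as a superset maximal among those with rank at most k; such a set is a flat.
    break : ∀ {F₀ k} → UpperBound F₀ k → LowerBound F₀ k → LowerBound ⊤ (2 + k) →
      (∀ F → F₀ ⊆ F → UpperBound F k → ∃ λ X → EdgeDisjoint G X F × UpperBound (X ∪ F) (suc k) × UpperBound (∁ X) (suc k)) → Absurd
    break {F₀} {k} ub₀ (I₀ , I₀⊆ , iI₀ , k≤) (J , _ , iJ , d≤) sep = go ∣ ∁ F₀ ∣ F₀ (λ i → i) ub₀ ℕₚ.≤-refl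
      where
      separated : ∀ F → F₀ ⊆ F → UpperBound F k → (∀ e → e ∉ F → ¬ UpperBound (F ∪ ⁅ e ⁆) k) → Absurd
      separated F F₀⊆ ub maximal with sep F F₀⊆ ub
      ... | X , disj , ubX , ubY =
        rank-exists _ ubX λ { (a , ra) → rank-exists _ ubY λ { (b , rb) → rank-exists k ub λ { (c , rc) →
        rank-exists m (λ I _ _ → ∣p∣≤n I) λ { (d , rd) → contra a b c d ra rb rc rd } } } }
        where
        flat : IsFlat G cls F
        flat e e∉ a b ((I , I⊆ , iI , refl) , _) (_ , b≥) with ∣ I ∣ ℕₚ.<? b
        ... | yes lt = lt
        ... | no nlt = ⊥-elim (maximal e e∉ (λ J J⊆ iJ → ℕₚ.≤-trans (b≥ J J⊆ (no-circuit iJ)) (ℕₚ.≤-trans (ℕₚ.≮⇒≥ nlt) (ub I I⊆ (independent iI)))))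
        -- Were one part empty, the bound for the other side would cover a set of rank at least
        -- `k + 2`.
        X-nonempty : Nonempty X
        X-nonempty with nonempty? X
        ... | yes ne = ne
        ... | no em = ⊥-elim (ℕₚ.<⇒≱ d≤ (ubY J (λ {e} _ → x∉p⇒x∈∁p (λ e∈ → em (e , e∈))) iJ))
        Y-nonempty : Nonempty (∁ (X ∪ F))
        Y-nonempty with nonempty? (∁ (X ∪ F))
        ... | yes ne = ne
        ... | no em = ⊥-elim (ℕₚ.<⇒≱ d≤ (ubX J (λ {e} _ → x∉∁p⇒x∈p (λ e∈ → em (e , e∈))) iJ))
        contra : ∀ a b c d → IsRank G cls (X ∪ F) a → IsRank G cls (∁ X) b → IsRank G cls F c → IsRank G cls ⊤ d → Absurd
        -- Both sides have rank at most `k + 1`, while the flat has rank at least `k` and the whole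
        -- matroid at least `k + 2`; so `a + b ≤ c + d`, against the connectedness of the
        -- contraction.
        contra a b c d ra@((A , A⊆ , iA , refl) , _) rb@((B , B⊆ , iB , refl) , _) rc@(_ , c≥) rd@(_ , d≥) =
          ℕₚ.<⇒≱ (contraction-connected unb F flat X disj X-nonempty Y-nonempty _ _ c d ra rb rc rd)
            (ℕₚ.≤-trans (ℕₚ.+-mono-≤ (ubX A A⊆ (independent iA)) (ubY B B⊆ (independent iB)))
            (ℕₚ.≤-trans (ℕₚ.≤-reflexive (sym (ℕₚ.+-suc k (suc k))))
            (ℕₚ.+-mono-≤ (ℕₚ.≤-trans k≤ (c≥ I₀ (λ i → F₀⊆ (I₀⊆ i)) (no-circuit iI₀))) (ℕₚ.≤-trans d≤ (d≥ J (λ _ → ∈⊤) (no-circuit iJ))))))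
      go : ∀ d F → F₀ ⊆ F → UpperBound F k → ∣ ∁ F ∣ ≤ d → Absurd
      go d F F₀⊆ ub le = separated F F₀⊆ ub (λ e e∉ ub' → next d e ub'
          (ℕₚ.<-≤-trans (p⊂q⇒∣p∣<∣q∣ (p⊂q⇒∁p⊃∁q (p⊆p∪q ⁅ e ⁆ , e , q⊆p∪q F ⁅ e ⁆ (x∈⁅x⁆ e) , e∉))) le))
        where
        next : ∀ d e → UpperBound (F ∪ ⁅ e ⁆) k → ∣ ∁ (F ∪ ⁅ e ⁆) ∣ < d → Absurd
        next (suc d') e ub' (s≤s lt) = go d' (F ∪ ⁅ e ⁆) (λ i → p⊆p∪q ⁅ e ⁆ (F₀⊆ i)) ub' lt

  Adj : V → V → Set
  Adj = SiAdj G

  step? : ∀ x e y → Dec (Step x e y)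
  step? x e y = ((src G e ≟ x) ×-dec (tgt G e ≟ y)) ⊎-dec ((src G e ≟ y) ×-dec (tgt G e ≟ x))

  adj? : ∀ x y → Dec (Adj x y)
  adj? x y = ¬? (x ≟ y) ×-dec any? (λ e → step? x e y)

  adj-sym : ∀ {x y} → Adj x y → Adj y x
  adj-sym (x≢y , e , s) = (λ q → x≢y (sym q)) , e , step-sym s

  Avoids : List V → E → Set
  Avoids xs e = src G e ∉ˡ xs × tgt G e ∉ˡ xs

  avoids? : ∀ xs e → Dec (Avoids xs e)
  avoids? xs e = ¬? (src G e ∈ˡ? xs) ×-dec ¬? (tgt G e ∈ˡ? xs)

  avoids-inc : ∀ {xs e w} → Avoids xs e → Inc e w → w ∉ˡ xs
  avoids-inc (s , _) (inj₁ refl) = s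
  avoids-inc (_ , t) (inj₂ refl) = t

  step-avoids : ∀ {xs x e y} → Step x e y → x ∉ˡ xs → y ∉ˡ xs → Avoids xs e
  step-avoids (inj₁ (refl , refl)) p q = p , q
  step-avoids (inj₂ (refl , refl)) p q = q , p

  connected : ∀ xs → length xs ≤ 2 → ∀ {a b} → a ∉ˡ xs → b ∉ˡ xs → Reach G (Avoids xs) a b
  connected xs le a∉ b∉ = reach-mono (λ { (s , t) → (λ i → s (∈⟦⟧⁺ i)) , (λ i → t (∈⟦⟧⁺ i)) })
    (connected-off g3 ⟦ xs ⟧ (ℕₚ.≤-trans (∣⟦⟧∣≤ xs) le) _ _ (λ i → a∉ (∈⟦⟧⁻ i)) (λ i → b∉ (∈⟦⟧⁻ i)))

  neighbour : ∀ w a b → w ∉ˡ a ∷ b ∷ [] → ∃ λ y → Adj w y × y ∉ˡ a ∷ b ∷ []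
  neighbour w a b w∉ with ∃-fresh (w ∷ a ∷ b ∷ []) (4≤n g3)
  ... | v , v∉ with reach-cross {U = _≡ w} (λ x → x ≟ w) (connected (a ∷ b ∷ []) ℕₚ.≤-refl w∉ (λ i → v∉ (there i))) refl (λ { refl → v∉ (here refl) })
  ...   | x , e , y , s , av , refl , y≢ = y , ((λ q → y≢ (sym q)) , e , s) , avoids-inc av (step-incʳ s)

  path-avoids : ∀ {xs x ts es z} → Path x ts es z → x ∉ˡ xs → (∀ {e} → e ∈ˡ es → Avoids xs e) → ∀ {w} → w ∈ˡ x ∷ ts → w ∉ˡ xs
  path-avoids p x∉ av (here refl) = x∉
  path-avoids (cons s _ p) x∉ av (there w∈) = path-avoids p (avoids-inc (av (here refl)) (step-incʳ s)) (λ i → av (there i)) w∈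

  opaque
    Off : List V → Subset n
    Off xs = ∁ ⟦ xs ⟧

    ∈Off⁺ : ∀ {xs w} → w ∉ˡ xs → w ∈ Off xs
    ∈Off⁺ w∉ = x∉p⇒x∈∁p (λ i → w∉ (∈⟦⟧⁻ i))

    ∈Off⁻ : ∀ {xs w} → w ∈ Off xs → w ∉ˡ xs
    ∈Off⁻ w∈ i = x∈∁p⇒x∉p w∈ (∈⟦⟧⁺ i)

    ∣Off∣ : ∀ {xs} → Unique xs → ∣ Off xs ∣ + length xs ≡ n
    ∣Off∣ {xs} u = trans (cong₂ _+_ (∣∁p∣≡n∸∣p∣ ⟦ xs ⟧) (sym (∣⟦⟧∣ u))) (ℕₚ.m∸n+n≡m (∣p∣≤n ⟦ xs ⟧))

  unique₁ : ∀ {k} {a : Fin k} → Unique (a ∷ [])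
  unique₁ = _∷_ (∉⇒All≢ (λ ())) []

  unique₂ : ∀ {k} {a b : Fin k} → a ≢ b → Unique (a ∷ b ∷ [])
  unique₂ a≢b = _∷_ (∉⇒All≢ (λ { (here q) → a≢b q })) unique₁

  Nonloop : V → E → Set
  Nonloop w e = Inc e w × src G e ≢ tgt G e

  nonloop? : ∀ w e → Dec (Nonloop w e)
  nonloop? w e = ((src G e ≟ w) ⊎-dec (tgt G e ≟ w)) ×-dec ¬? (src G e ≟ tgt G e)

  nonloop⇒step : ∀ {w e} → Nonloop w e → ∃ λ y → Step w e y × y ≢ w
  nonloop⇒step {w} {e} (inj₁ refl , l) = tgt G e , step-ends e , (λ q → l (sym q))
  nonloop⇒step {w} {e} (inj₂ refl , l) = src G e , step-sym (step-ends e) , l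

  step⇒nonloop : ∀ {w e y} → Step w e y → w ≢ y → Nonloop w e
  step⇒nonloop (inj₁ (refl , refl)) w≢y = inj₁ refl , w≢y
  step⇒nonloop (inj₂ (refl , refl)) w≢y = inj₂ refl , (λ q → w≢y (sym q))

  loop-step : ∀ {w e y} → src G e ≡ tgt G e → Step w e y → y ≡ w
  loop-step l (inj₁ (refl , refl)) = sym l
  loop-step l (inj₂ (refl , refl)) = l

  loop-inc : ∀ {v w e} → src G e ≡ tgt G e → Inc e v → Inc e w → w ≡ v
  loop-inc l (inj₁ refl) (inj₁ refl) = refl
  loop-inc l (inj₁ refl) (inj₂ refl) = sym l
  loop-inc l (inj₂ refl) (inj₁ refl) = l
  loop-inc l (inj₂ refl) (inj₂ refl) = refl

  loop-cyc : ∀ {w e} → src G e ≡ tgt G e → Inc e w → Cyc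
  loop-cyc {w} {e} l i = cyc {x = w} {z = w} {f = e} [] (s l i) (λ ())
    where
    s : src G e ≡ tgt G e → Inc e w → Step w e w
    s l (inj₁ refl) = inj₁ (refl , sym l)
    s l (inj₂ refl) = inj₁ (l , refl)

  cyc-with-loop : ∀ c {e} → e ∈ˡ edges c → src G e ≡ tgt G e → ∀ {w} → w ∈ˡ vertices c → Inc e w
  cyc-with-loop (cyc [] s f) (here refl) l (here refl) = step-incˡ s
  cyc-with-loop (cyc (cons _ x∉ p) s f) (here refl) l _ = ⊥-elim (x∉ (subst (_∈ˡ _) (sym (loop-step l s)) (path-last p)))
  cyc-with-loop (cyc p@(cons _ _ _) s f) (there e∈) l _ with path-edge-step p e∈
  ... | a , b , st , a≢b = ⊥-elim (a≢b (sym (loop-step l st)))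

  opaque
    grow-tree : ∀ {K : E → Set} {W r} → (∀ {e w} → K e → Inc e w → w ∈ W) → r ∈ W → (∀ {w} → w ∈ W → Reach G K w r) → Grown K W ⊥ ⁅ r ⁆
    grow-tree {r = r} K-in r∈ reach = grow K-in (λ w∈ → r , x∈⁅x⁆ r , reach w∈) indep-⊥ (λ e∈ → ⊥-elim (∉⊥ e∈))
      (λ i → subst (_∈ _) (sym (x∈⁅y⁆⇒x≡y r i)) r∈)

    tree-card : ∀ {K W r} (g : Grown K W ⊥ ⁅ r ⁆) → suc ∣ Grown.T g ∣ ≡ ∣ W ∣
    tree-card {W = W} {r} g = trans (ℕₚ.+-comm 1 _) (trans (cong (∣ Grown.T g ∣ +_) (sym (∣⁅x⁆∣≡1 r))) (trans (Grown.card g) (cong (_+ ∣ W ∣) (∣⊥∣≡0 m))))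

    grow-cyc : ∀ {K : E → Set} {W} c → (∀ {e w} → K e → Inc e w → w ∈ W) → cls (edgeSet c) ≢ 𝓑 → (∀ {w} → w ∈ˡ vertices c → w ∈ W) →
      (∀ {w} → w ∈ W → Reach G K w (Cyc.x c)) → Grown K W (edgeSet c) ⟦ vertices c ⟧
    grow-cyc c K-in c≢𝓑 c-in reach = grow K-in (λ w∈ → _ , ∈⟦⟧⁺ (here refl) , reach w∈) (indep-cyc c c≢𝓑)
      (λ e∈ i → ∈⟦⟧⁺ (cyc-inc c (∈⟦⟧⁻ e∈) i)) (λ i → c-in (∈⟦⟧⁻ i))

    cyc-card : ∀ {K W} c (g : Grown K W (edgeSet c) ⟦ vertices c ⟧) → ∣ Grown.T g ∣ ≡ ∣ W ∣
    cyc-card {W = W} c g = ℕₚ.+-cancelʳ-≡ _ _ _ (trans (Grown.card g) (trans (ℕₚ.+-comm _ ∣ W ∣)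
      (cong (∣ W ∣ +_) (trans (∣⟦⟧∣ (cyc-edges-unique c)) (trans (cyc-length c) (sym (∣⟦⟧∣ (cyc-vertices-unique c))))))))

    -- `T` already exhausts the rank bound of `F`, and an edge from a vertex that `T` misses would
    -- enlarge it independently. This describes the edges of the flat at the removed vertices up to
    -- loops.
    pendant-bound : ∀ {T F k w e} → UpperBound F k → Independent T → T ⊆ F → k ≤ ∣ T ∣ → (∀ {d} → d ∈ T → ¬ Inc d w) → Nonloop w e → e ∉ F
    pendant-bound {T} {F} {k} {w} {e} ub iT T⊆ k≤ free nl e∈ with nonloop⇒step nl
    ... | y , s , y≢ = ℕₚ.<⇒≱ (s≤s k≤) (subst (_≤ k) (∣⁅x⁆∪p∣ (λ i → free i (step-incˡ s)))
            (ub (⁅ e ⁆ ∪ T) (λ i → [ (λ j → subst (_∈ F) (sym (x∈⁅y⁆⇒x≡y e j)) e∈) , T⊆ ]′ (x∈p∪q⁻ ⁅ e ⁆ T i)) (indep-pendant iT s y≢ free)))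

  everywhere : ∀ {a b} → Reach G (λ _ → Unit) a b
  everywhere = reach-mono (λ _ → tt) (connected [] z≤n (λ ()) (λ ()))

  opaque
    lower-⊤ : ∀ c → cls (edgeSet c) ≢ 𝓑 → LowerBound ⊤ n
    lower-⊤ c c≢𝓑 = T , (λ _ → ∈⊤) , indep , ℕₚ.≤-reflexive (sym (trans (cyc-card c g) (∣⊤∣≡n n)))
      where
      g : Grown (λ _ → Unit) ⊤ (edgeSet c) ⟦ vertices c ⟧
      g = grow-cyc c (λ _ _ → ∈⊤) c≢𝓑 (λ _ → ∈⊤) (λ _ → everywhere)
      open Grown g

  -- Removing two non-adjacent vertices

  module NonAdjacent {u v} (u≢v : u ≢ v) (u≁v : ¬ Adj u v) where

    uv : List V
    uv = u ∷ v ∷ []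

    F₀ : Subset m
    F₀ = filterSet (avoids? uv)

    W : Subset n
    W = Off uv

    F₀-in : ∀ {e w} → Avoids uv e → Inc e w → w ∈ W
    F₀-in av i = ∈Off⁺ (avoids-inc av i)

    F₀-touches : ∀ {I} → I ⊆ F₀ → Touches I W
    F₀-touches I⊆ e∈ = F₀-in (∈filter⁻ (avoids? uv) (I⊆ e∈))

    ∣W∣ : 2 + ∣ W ∣ ≡ n
    ∣W∣ = trans (ℕₚ.+-comm 2 _) (∣Off∣ (unique₂ u≢v))

    no-uv : ∀ {e} → Inc e u → ¬ Inc e v
    no-uv i j with inc⇒step i
    ... | y , s with step-inc⁻ s j
    ...   | inj₁ q = u≢v (sym q)
    ...   | inj₂ refl = u≁v (u≢v , _ , s)

    reach-W : ∀ {a b} → a ∈ W → b ∈ W → Reach G (Avoids uv) a b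
    reach-W a∈ b∈ = connected uv ℕₚ.≤-refl (∈Off⁻ a∈) (∈Off⁻ b∈)

    W-free : ∀ {T} → Touches T W → ∀ {w} → w ∈ˡ uv → ∀ {d} → d ∈ T → ¬ Inc d w
    W-free tT w∈ d∈ i = ∈Off⁻ (tT d∈ i) w∈

    -- In a balanced graph independent sets are forests, so `E(G − {u, v})` has rank `n − 3` and the
    -- matroid rank `n − 1`. Up to loops, which no independent set contains here, one part misses
    -- `v` and the other misses `u`.
    unbalanced : ¬ Balanced ⊤
    unbalanced bal with ∃-fresh uv (ℕₚ.≤-trans (s≤s (s≤s (s≤s z≤n))) (4≤n g3))
    ... | r , r∉ = break ub₀ (T , T⊆F₀ , indep , ℕₚ.≤-refl) lower sep
      where
      g = grow-tree {K = Avoids uv} {W} F₀-in (∈Off⁺ r∉) (λ w∈ → reach-W w∈ (∈Off⁺ r∉))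
      open Grown g
      k = ∣ T ∣
      card-W : suc k ≡ ∣ W ∣
      card-W = tree-card g
      T⊆F₀ : T ⊆ F₀
      T⊆F₀ i = [ (λ j → ⊥-elim (∉⊥ j)) , ∈filter⁺ (avoids? uv) ]′ (T⊆ i)
      less : ∀ {I xs w} → Unique xs → Independent I → Touches I (Off xs) → w ∉ˡ xs → suc ∣ I ∣ + length xs ≤ n
      less {I} {xs} u iI tI w∉ = subst (suc ∣ I ∣ + length xs ≤_) (∣Off∣ u) (ℕₚ.+-monoˡ-≤ (length xs) (indep-balanced-card< iI tI (∈Off⁺ w∉) (λ c c⊆ → bal c (λ _ → ∈⊤))))
      ub₀ : UpperBound F₀ k
      ub₀ I I⊆ iI = ℕₚ.≤-pred (subst (suc ∣ I ∣ ≤_) (sym card-W) (indep-balanced-card< iI (F₀-touches I⊆) (∈Off⁺ r∉) (λ c c⊆ → bal c (λ _ → ∈⊤))))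
      n≡ : 3 + k ≡ n
      n≡ = trans (cong (2 +_) card-W) ∣W∣
      lower : LowerBound ⊤ (2 + k)
      lower = Grown.T h , (λ _ → ∈⊤) , Grown.indep h , ℕₚ.≤-reflexive (ℕₚ.suc-injective (trans n≡ (sym (trans (tree-card h) (∣⊤∣≡n n)))))
        where h = grow-tree {K = λ _ → Unit} {⊤} {r} (λ _ _ → ∈⊤) ∈⊤ (λ _ → everywhere)
      no-loops : ∀ {I e} → Independent I → e ∈ I → src G e ≢ tgt G e
      no-loops {I} {e} iI e∈ l = cyc-unbalanced iI (loop-cyc l (inj₁ refl)) (λ { (here refl) → e∈ }) (bal (loop-cyc l (inj₁ refl)) (λ _ → ∈⊤))
      -- A forest on the `n − 1` vertices other than `p` has at most `n − 2` edges, which is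
      -- `suc k`.
      bound : ∀ {I p} → Independent I → p ∈ˡ uv → (∀ {e} → e ∈ I → ¬ Nonloop p e) → ∣ I ∣ ≤ suc k
      bound {I} {p} iI p∈ none = ℕₚ.≤-pred (ℕₚ.≤-pred (subst (suc (suc ∣ I ∣) ≤_) (sym n≡)
        (subst (_≤ n) (ℕₚ.+-comm (suc ∣ I ∣) 1) (less {xs = p ∷ []} {w = r} unique₁ iI (λ e∈ i → ∈Off⁺ (λ { (here refl) → none e∈ (i , no-loops iI e∈) })) (λ { (here refl) → r∉ p∈ })))))
      sep : ∀ F → F₀ ⊆ F → UpperBound F k → ∃ λ X → EdgeDisjoint G X F × UpperBound (X ∪ F) (suc k) × UpperBound (∁ X) (suc k)
      sep F F₀⊆ ub = X , (λ e e∈X e∈F → not-in (here refl) (∈filter⁻ (nonloop? u) e∈X) e∈F) ,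
        (λ I I⊆ iI → bound iI (there (here refl)) (λ e∈ nl → [ (λ j → no-uv (proj₁ (∈filter⁻ (nonloop? u) j)) (proj₁ nl))
            , not-in (there (here refl)) nl ]′ (x∈p∪q⁻ X F (I⊆ e∈)))) ,
        (λ I I⊆ iI → bound iI (here refl) (λ e∈ nl → x∈∁p⇒x∉p (I⊆ e∈) (∈filter⁺ (nonloop? u) nl)))
        where
        X = filterSet (nonloop? u)
        not-in : ∀ {p e} → p ∈ˡ uv → Nonloop p e → e ∉ F
        not-in p∈ = pendant-bound ub indep (λ i → F₀⊆ (T⊆F₀ i)) ℕₚ.≤-refl (W-free touches p∈)

    c⊆F₀ : ∀ c → (∀ {w} → w ∈ˡ vertices c → w ∉ˡ uv) → c ⊆ᶜ F₀
    c⊆F₀ c c-off i = ∈filter⁺ (avoids? uv) (c-off (cyc-inc c i (inj₁ refl)) , c-off (cyc-inc c i (inj₂ refl)))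

    -- Names the two vertices in either order, so that the loop arguments are given once and serve
    -- for both.
    record Ends (p o : V) : Set where
      constructor mkEnds
      field
        p≢o   : p ≢ o
        p∈    : p ∈ˡ uv
        o∈    : o ∈ˡ uv
        cover : ∀ {w} → w ∈ˡ uv → w ≡ p ⊎ w ≡ o

    ends-uv : Ends u v
    ends-uv = mkEnds u≢v (here refl) (there (here refl)) (λ { (here q) → inj₁ q ; (there (here q)) → inj₂ q })

    ends-vu : Ends v u
    ends-vu = mkEnds (λ q → u≢v (sym q)) (there (here refl)) (here refl) (λ { (here q) → inj₂ q ; (there (here q)) → inj₁ q })

    module _ {p o} (po : Ends p o) (c : Cyc) (c-off : ∀ {w} → w ∈ˡ vertices c → w ∉ˡ uv) {e} (l : src G e ≡ tgt G e) (i : Inc e p) where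
      open Ends po

      apart-loop : Apart c (loop-cyc l i)
      apart-loop w∈ (here refl) = c-off w∈ p∈

      private
        W' : Subset n
        W' = Off (o ∷ [])

        reach-U : ∀ {w} → w ∈ W' → ∃ λ t → t ∈ ⟦ p ∷ vertices c ⟧ × Reach G (Avoids uv) w t
        reach-U {w} w∈ with w ≟ p
        ... | yes refl = w , ∈⟦⟧⁺ (here refl) , here
        ... | no w≢p = Cyc.x c , ∈⟦⟧⁺ {xs = p ∷ vertices c} (there (here refl)) , connected uv ℕₚ.≤-refl w∉ (c-off (here refl))
          where
          w∉ : w ∉ˡ uv
          w∉ q = [ w≢p , (λ { refl → ∈Off⁻ {xs = o ∷ []} w∈ (here refl) }) ]′ (cover q)

        touch : ∀ {d w} → d ∈ˡ e ∷ edges c → Inc d w → w ∈ˡ p ∷ vertices c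
        touch (here refl) j = here (loop-inc l i j)
        touch (there q) j = there (cyc-inc c q j)

        sub : ∀ {w} → w ∈ˡ p ∷ vertices c → w ∈ W'
        sub (here refl) = ∈Off⁺ (λ { (here q) → p≢o q })
        sub (there q) = ∈Off⁺ (λ { (here refl) → c-off q o∈ })

      opaque
        -- Both `𝓕`-cycles together are independent and can be grown over all vertices but `o`. The
        -- result has one edge more than a set of rank `∣ W ∣` permits, so such a loop cannot lie in
        -- the flat.
        loop-and-cyc : cls (edgeSet c) ≡ 𝓕 → cls (edgeSet (loop-cyc l i)) ≡ 𝓕 →
          ∃ λ T → Independent T × ∣ T ∣ ≡ suc ∣ W ∣ × (∀ {d} → d ∈ T → d ≡ e ⊎ d ∈ F₀)
        loop-and-cyc c𝓕 ℓ𝓕 = Grown.T h , Grown.indep h , card-T , T⊆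
          where
          ℓ : Cyc
          ℓ = loop-cyc l i
          iS : Independent ⟦ e ∷ edges c ⟧
          iS = indep-⊆ (λ j → [ (λ q → q⊆p∪q (edgeSet c) (edgeSet ℓ) (∈⟦⟧⁺ (here q))) , (λ q → p⊆p∪q (edgeSet ℓ) (∈⟦⟧⁺ q)) ]′ (split-∷ (∈⟦⟧⁻ j)))
                 (indep-disjoint-cycs c ℓ apart-loop c𝓕 ℓ𝓕)
            where
            split-∷ : ∀ {d} → d ∈ˡ e ∷ edges c → d ≡ e ⊎ d ∈ˡ edges c
            split-∷ (here q) = inj₁ q
            split-∷ (there q) = inj₂ q
          h : Grown (Avoids uv) W' ⟦ e ∷ edges c ⟧ ⟦ p ∷ vertices c ⟧
          h = grow (λ av j → ∈Off⁺ (λ { (here refl) → avoids-inc av j o∈ })) reach-U iS (λ e∈ j → ∈⟦⟧⁺ (touch (∈⟦⟧⁻ e∈) j)) (λ j → sub (∈⟦⟧⁻ j))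
          T⊆ : ∀ {d} → d ∈ Grown.T h → d ≡ e ⊎ d ∈ F₀
          T⊆ j with Grown.T⊆ h j
          ... | inj₂ av = inj₂ (∈filter⁺ (avoids? uv) av)
          ... | inj₁ q with ∈⟦⟧⁻ q
          ...   | here r = inj₁ r
          ...   | there r = inj₂ (c⊆F₀ c c-off r)
          card-T : ∣ Grown.T h ∣ ≡ suc ∣ W ∣
          card-T = trans
            (ℕₚ.+-cancelʳ-≡ _ _ _ (trans (Grown.card h) (trans (ℕₚ.+-comm _ ∣ W' ∣) (cong (∣ W' ∣ +_)
              (trans (∣⟦⟧∣ (_∷_ (∉⇒All≢ (λ q → c-off (cyc-inc c q i) p∈)) (cyc-edges-unique c))) (trans (cong suc (cyc-length c))
                (sym (∣⟦⟧∣ (_∷_ (∉⇒All≢ (λ q → c-off q p∈)) (cyc-vertices-unique c))))))))))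
            (ℕₚ.suc-injective (trans (ℕₚ.+-comm 1 _) (trans (∣Off∣ unique₁) (sym ∣W∣))))

    module _ (c : Cyc) (c-off : ∀ {w} → w ∈ˡ vertices c → w ∉ˡ uv) (c≢𝓑 : cls (edgeSet c) ≢ 𝓑) where

      -- If I meets p only in loops of F, then such a loop is an 𝓕-loop, and c together with it makes F too big.
      loops-bound : ∀ {p o I F} → Ends p o → F₀ ⊆ F → UpperBound F ∣ W ∣ → Independent I →
        (∀ {e} → e ∈ I → Inc e p → src G e ≡ tgt G e × e ∈ F) → ∣ I ∣ ≤ suc ∣ W ∣
      loops-bound {p} {o} {I} {F} po F₀⊆ ub iI only = finish (Roots.root ρ {p} ∈⊤) (Roots.root ρ {o} ∈⊤)
        where
        ρ : Roots I ⊤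
        ρ = indep-roots iI (λ _ _ → ∈⊤)
        done : ∀ {r} → r ∈ Roots.R ρ → ∣ I ∣ ≤ suc ∣ W ∣
        done r∈ = ℕₚ.≤-pred (subst (suc ∣ I ∣ ≤_) (trans (∣⊤∣≡n n) (sym ∣W∣)) (roots-nonempty ρ r∈))
        stuck : ∀ {w} → Reach G (_∈ I) p w → w ≡ p
        stuck r = reach-invariant {U = _≡ p} (λ { s e∈ refl → loop-step (proj₁ (only e∈ (step-incˡ s))) s }) r refl
        two-𝓕 : ∀ {e} (l : src G e ≡ tgt G e) (i : Inc e p) → e ∈ F → cls (edgeSet (loop-cyc l i)) ≡ 𝓕 → ∀ K → cls (edgeSet c) ≡ K → Absurd
        two-𝓕 l i e∈F ℓ𝓕 𝓑 ceq = c≢𝓑 ceq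
        two-𝓕 l i e∈F ℓ𝓕 𝓛 ceq =
          let (w , a , b) = 𝓛-meets-𝓕 qb _ _ (cyc-isCycle c) (cyc-isCycle (loop-cyc l i)) ceq ℓ𝓕
          in apart-loop po c c-off l i (cyc-InV⁻ c a) (cyc-InV⁻ (loop-cyc l i) b)
        two-𝓕 l i e∈F ℓ𝓕 𝓕 ceq =
          let (T , iT , card , T⊆) = loop-and-cyc po c c-off l i ceq ℓ𝓕
          in ℕₚ.<⇒≱ (s≤s (ℕₚ.≤-refl {∣ W ∣})) (subst (_≤ ∣ W ∣) card (ub T (λ j → [ (λ { refl → e∈F }) , F₀⊆ ]′ (T⊆ j)) iT))
        -- The loop at `p` is disjoint from the cycle near `o`, hence in `𝓕`. Then `c` cannot be in
        -- `𝓛`, which would force it to meet the loop, and if it is in `𝓕` the flat becomes too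
        -- large.
        two-cycles : CycleNear I o → ∀ {e} → e ∈ I → Inc e p → Absurd
        two-cycles (near d d⊆ v∈ r) {e} e∈ i =
          two-𝓕 l i (proj₂ (only e∈ i)) (proj₁ (apart-𝓕 iI (loop-cyc l i) d (λ { (here refl) → e∈ }) d⊆ apart)) _ refl
          where
          l = proj₁ (only e∈ i)
          apart : Apart (loop-cyc l i) d
          apart (here refl) p∈d = Ends.p≢o po (sym (stuck (reach-sym (reach-trans r (cyc-reach d d⊆ v∈ p∈d)))))
        finish : (∃ λ r → r ∈ Roots.R ρ × Reach G (_∈ I) p r) ⊎ CycleNear I p → (∃ λ r → r ∈ Roots.R ρ × Reach G (_∈ I) o r) ⊎ CycleNear I o → ∣ I ∣ ≤ suc ∣ W ∣
        finish (inj₁ (_ , r∈ , _)) _ = done r∈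
        finish (inj₂ _) (inj₁ (_ , r∈ , _)) = done r∈
        finish (inj₂ (near c₁ c₁⊆ v∈ r₁)) (inj₂ near-o) =
          let (e , e∈ , i) = cyc-vertex-inc c₁ v∈ in ⊥-elim (two-cycles near-o (c₁⊆ e∈) (subst (Inc e) (stuck r₁) i))

      opaque
        -- The cycle `c` raises the rank of the base to `n − 2` and that of the matroid to `n`. The
        -- flat may contain loops at `u` or `v`, for instance `𝓛`-loops when `c` is in `𝓛`; so the
        -- separation consists of the edges at `u` outside `F`, and `loops-bound` bounds both sides
        -- by `n − 1`.
        unbalanced-off : Absurd
        unbalanced-off = break {F₀} {∣ W ∣} (λ I I⊆ iI → indep-card≤ iI (F₀-touches I⊆)) (T , T⊆F₀ , indep , ℕₚ.≤-reflexive (sym card-T))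
          (subst (LowerBound ⊤) (sym ∣W∣) (lower-⊤ c c≢𝓑)) sep
          where
          g : Grown (Avoids uv) W (edgeSet c) ⟦ vertices c ⟧
          g = grow-cyc c F₀-in c≢𝓑 (λ i → ∈Off⁺ (c-off i)) (λ w∈ → reach-W w∈ (∈Off⁺ (c-off (here refl))))
          open Grown g
          T⊆F₀ : T ⊆ F₀
          T⊆F₀ i = [ (λ j → c⊆F₀ c c-off (∈⟦⟧⁻ j)) , ∈filter⁺ (avoids? uv) ]′ (T⊆ i)
          card-T : ∣ T ∣ ≡ ∣ W ∣
          card-T = cyc-card c g
          sep : ∀ F → F₀ ⊆ F → UpperBound F ∣ W ∣ → ∃ λ X → EdgeDisjoint G X F × UpperBound (X ∪ F) (suc ∣ W ∣) × UpperBound (∁ X) (suc ∣ W ∣)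
          sep F F₀⊆ ub = X , (λ e e∈X → proj₂ (∈filter⁻ X? e∈X)) ,
            (λ I I⊆ iI → loops-bound ends-vu F₀⊆ ub iI
              (λ e∈ i → [ (λ j → ⊥-elim (no-uv (proj₁ (∈filter⁻ X? j)) i)) , (λ j → loop (there (here refl)) i j , j) ]′ (x∈p∪q⁻ X F (I⊆ e∈)))) ,
            (λ I I⊆ iI → loops-bound ends-uv F₀⊆ ub iI (λ e∈ i → loop (here refl) i (in-F (I⊆ e∈) i) , in-F (I⊆ e∈) i))
            where
            X? : ∀ e → Dec (Inc e u × e ∉ F)
            X? e = ((src G e ≟ u) ⊎-dec (tgt G e ≟ u)) ×-dec ¬? (e ∈? F)
            X : Subset m
            X = filterSet X?
            loop : ∀ {p e} → p ∈ˡ uv → Inc e p → e ∈ F → src G e ≡ tgt G e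
            loop {p} {e} p∈ i e∈ = decidable-stable (src G e ≟ tgt G e)
              (λ q → pendant-bound ub indep (λ j → F₀⊆ (T⊆F₀ j)) (ℕₚ.≤-reflexive (sym card-T)) (W-free touches p∈) (i , q) e∈)
            in-F : ∀ {e} → e ∈ ∁ X → Inc e u → e ∈ F
            in-F {e} e∈ i = decidable-stable (e ∈? F) (λ q → x∈∁p⇒x∉p e∈ (∈filter⁺ X? (i , q)))

    -- From here on balance is obtained without any rank computation, by exhibiting two non-adjacent
    -- vertices that a cycle misses.
    balanced-off : ∀ c → (∀ {w} → w ∈ˡ vertices c → w ∉ˡ uv) → cls (edgeSet c) ≡ 𝓑
    balanced-off c c-off = decidable-stable (𝓑? _) (unbalanced-off c c-off)

  -- The covering property

  ConnectedOff : List V → Set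
  ConnectedOff xs = ∀ {a b} → a ∉ˡ xs → b ∉ˡ xs → Reach G (Avoids xs) a b

  -- A cycle t, s, …, z, t that avoids t' and misses two non-adjacent vertices.
  record NonCover (t z t' : V) : Set where
    constructor nonCover
    field
      {s}        : V
      {ts}       : List V
      {es}       : List E
      first      : Adj t s
      path       : Path s ts es z
      t∉         : t ∉ˡ s ∷ ts
      t'∉        : t' ∉ˡ s ∷ ts
      s≢z        : s ≢ z
      {w x}      : V
      w≢x        : w ≢ x
      w≁x        : ¬ Adj w x
      w∉         : w ∉ˡ t ∷ s ∷ ts
      x∉         : x ∉ˡ t ∷ s ∷ ts

  -- The failure of the covering property at `t`. What has to be shown is that it cannot fail at
  -- both vertices of a non-adjacent pair.
  Loose : V → V → V → Set
  Loose t z t' = ¬ Adj t z ⊎ NonCover t z t'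

  -- The edge `f` is the only one by which `t` will be attached to the contracted set. The field
  -- `ear` provides, for each edge `tz`, the single balanced cycle through `f` that testing its
  -- balance requires.
  record Foot (t z t' : V) : Set where
    field
      {s}   : V
      {f}   : E
      step  : Step t f s
      s∉    : s ∉ˡ t ∷ t' ∷ z ∷ []
      ear   : ∀ {e} → Step t e z → ∃ λ ts → ∃ λ es → Path s ts es z × t ∉ˡ s ∷ ts × t' ∉ˡ s ∷ ts × cls ⟦ e ∷ f ∷ es ⟧ ≡ 𝓑

  -- Without an edge `tz` the field `ear` is vacuous, and 3-connectedness supplies a suitable
  -- neighbour. Otherwise the cycle of `NonCover` misses two non-adjacent vertices and is balanced
  -- for that reason.
  foot : ∀ {t z t'} → t ≢ z → t ≢ t' → ¬ Adj t t' → Loose t z t' → Foot t z t'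
  foot {t} {z} {t'} t≢z t≢t' t≁t' (inj₁ t≁z) with neighbour t t' z (λ { (here q) → t≢t' q ; (there (here q)) → t≢z q })
  ... | s , (t≢s , f , st) , s∉ = record
    { step = st
    ; s∉ = λ { (here q) → t≢s (sym q) ; (there i) → s∉ i }
    ; ear = λ st' → ⊥-elim (t≁z (t≢z , _ , st')) }
  foot {t} {z} {t'} t≢z t≢t' t≁t' (inj₂ (nonCover {s} {ts} {es} (t≢s , f , st) p t∉ t'∉ s≢z w≢x w≁x w∉ x∉)) = record
    { step = st
    ; s∉ = λ { (here q) → t≢s (sym q) ; (there (here q)) → t'∉ (here (sym q)) ; (there (there (here q))) → s≢z q }
    ; ear = λ {e} st' → ts , es , p , t∉ , t'∉ , NonAdjacent.balanced-off w≢x w≁x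
        (cyc (cons st t∉ p) (step-sym st') (fresh st'))
        (λ { i (here refl) → w∉ i ; i (there (here refl)) → x∉ i }) }
    where
    fresh : ∀ {e} → Step t e z → e ∉ˡ f ∷ es
    fresh st' (here refl) with step-unique st st'
    ... | inj₁ (_ , q) = s≢z (sym q)
    ... | inj₂ (q , _) = t≢s q
    fresh st' (there i) = t∉ (path-inc p i (step-incˡ st'))

  module _ {u v z} (u≢v : u ≢ v) (u≁v : ¬ Adj u v) (u≢z : u ≢ z) (v≢z : v ≢ z) (conn : ConnectedOff (u ∷ v ∷ z ∷ []))
           (fu : Foot u z v) (fv : Foot v z u) where

    private
      open NonAdjacent u≢v u≁v using (uv; balanced-off; unbalanced)
      module U = Foot fu
      module U' = Foot fv

      uvz : List V
      uvz = u ∷ v ∷ z ∷ []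

      z∉uv : z ∉ˡ uv
      z∉uv (here q) = u≢z (sym q)
      z∉uv (there (here q)) = v≢z (sym q)

      su∉ : U.s ∉ˡ uvz
      su∉ = U.s∉

      sv∉ : U'.s ∉ˡ uvz
      sv∉ (here q) = U'.s∉ (there (here q))
      sv∉ (there (here q)) = U'.s∉ (here q)
      sv∉ (there (there (here q))) = U'.s∉ (there (there (here q)))

      Base : E → Set
      Base e = Avoids uvz e ⊎ e ≡ U.f ⊎ e ≡ U'.f

      base? : ∀ e → Dec (Base e)
      base? e = avoids? uvz e ⊎-dec ((e ≟ U.f) ⊎-dec (e ≟ U'.f))

      F₀ : Subset m
      F₀ = filterSet base?

      W : Subset n
      W = Off (z ∷ [])

      ∣W∣ : suc ∣ W ∣ ≡ n
      ∣W∣ = trans (ℕₚ.+-comm 1 _) (∣Off∣ unique₁)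

      base-z : ∀ {e} → Base e → ¬ Inc e z
      base-z (inj₁ av) i = avoids-inc av i (there (there (here refl)))
      base-z (inj₂ (inj₁ refl)) i = [ (λ q → u≢z (sym q)) , (λ q → su∉ (there (there (here (sym q))))) ]′ (step-inc⁻ U.step i)
      base-z (inj₂ (inj₂ refl)) i = [ (λ q → v≢z (sym q)) , (λ q → sv∉ (there (there (here (sym q))))) ]′ (step-inc⁻ U'.step i)

      base-u : ∀ {e} → Base e → Inc e u → e ≡ U.f
      base-u (inj₁ av) i = ⊥-elim (avoids-inc av i (here refl))
      base-u (inj₂ (inj₁ q)) i = q
      base-u (inj₂ (inj₂ refl)) i = ⊥-elim ([ u≢v , (λ q → sv∉ (here (sym q))) ]′ (step-inc⁻ U'.step i))

      base-v : ∀ {e} → Base e → Inc e v → e ≡ U'.f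
      base-v (inj₁ av) i = ⊥-elim (avoids-inc av i (there (here refl)))
      base-v (inj₂ (inj₂ q)) i = q
      base-v (inj₂ (inj₁ refl)) i = ⊥-elim ([ (λ q → u≢v (sym q)) , (λ q → su∉ (there (here (sym q)))) ]′ (step-inc⁻ U.step i))

      base-in : ∀ {e w} → Base e → Inc e w → w ∈ W
      base-in b i = ∈Off⁺ (λ { (here refl) → base-z b i })

      reach-base : ∀ {w} → w ∈ W → Reach G Base w U.s
      reach-base {w} w∈ with w ≟ u | w ≟ v
      ... | yes refl | _ = reach-step U.step (inj₂ (inj₁ refl)) here
      ... | no _ | yes refl = reach-step U'.step (inj₂ (inj₂ refl)) (reach-mono inj₁ (conn sv∉ su∉))
      ... | no w≢u | no w≢v = reach-mono inj₁ (conn (λ { (here q) → w≢u q ; (there (here q)) → w≢v q ; (there (there i)) → ∈Off⁻ w∈ i }) su∉)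

      -- In the base `u` and `v` are leaves, so no cycle uses them and `balanced-off` applies.
      base-balanced : ∀ c → (∀ {e} → e ∈ˡ edges c → Base e) → cls (edgeSet c) ≡ 𝓑
      base-balanced c cb = balanced-off c (λ { i (here refl) → at-u i ; i (there (here refl)) → at-v i })
        where
        one-edge : ∀ {w f y} → Step w f y → y ≢ w → (∀ {e} → Base e → Inc e w → e ≡ f) → w ∉ˡ vertices c
        one-edge {w} {f} st y≢ only w∈ with cyc-vertex-inc c w∈
        ... | e , e∈ , i with only (cb e∈) i
        ...   | refl = cycle-noLone (cyc-isCycle c) (lone st y≢ (∈⟦⟧⁺ e∈) (λ d∈ j → only (cb (∈⟦⟧⁻ d∈)) j))
        at-u : u ∉ˡ vertices c
        at-u = one-edge U.step (λ q → su∉ (here q)) base-u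
        at-v : v ∉ˡ vertices c
        at-v = one-edge U'.step (λ q → sv∉ (there (here q))) base-v

      su∈W : U.s ∈ W
      su∈W = ∈Off⁺ (λ { (here q) → su∉ (there (there (here q))) })

      tree : Grown Base W ⊥ ⁅ U.s ⁆
      tree = grow-tree base-in su∈W reach-base

      touches-F₀ : ∀ {I} → I ⊆ F₀ → Touches I W
      touches-F₀ I⊆ e∈ = base-in (∈filter⁻ base? (I⊆ e∈))

    module Closed (F : Subset m) (F₀⊆ : F₀ ⊆ F) (balF : Balanced F) (z-loops : ∀ {e} → Nonloop z e → e ∉ F) where

      private
        X : Subset m
        X = filterSet (nonloop? z)

        p = proj₁ (neighbour z u v z∉uv)
        z~p : Adj z p
        z~p = proj₁ (proj₂ (neighbour z u v z∉uv))
        p∉ : p ∉ˡ uv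
        p∉ = proj₂ (proj₂ (neighbour z u v z∉uv))
        e₀ = proj₁ (proj₂ z~p)
        st₀ : Step z e₀ p
        st₀ = proj₂ (proj₂ z~p)

        S₀ : Subset m
        S₀ = ⁅ e₀ ⁆ ∪ F

        -- The edge `e₀` is a leaf edge at `z`, since `F` has at most loops there; no cycle can pass
        -- through it.
        bal₀ : Balanced S₀
        bal₀ c c⊆ with e₀ ∈ˡ? edges c
        ... | no e₀∉ = balF c (λ i → [ (λ j → ⊥-elim (e₀∉ (subst (_∈ˡ edges c) (x∈⁅y⁆⇒x≡y e₀ j) i))) , (λ j → j) ]′ (x∈p∪q⁻ ⁅ e₀ ⁆ F (c⊆ i)))
        ... | yes e₀∈ = ⊥-elim (cycle-noLone (cyc-isCycle c) (lone st₀ (λ q → proj₁ z~p (sym q)) (∈⟦⟧⁺ e₀∈) uniq))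
          where
          uniq : ∀ {e} → e ∈ edgeSet c → Inc e z → e ≡ e₀
          uniq {e} e∈ i with x∈p∪q⁻ ⁅ e₀ ⁆ F (c⊆ (∈⟦⟧⁻ e∈))
          ... | inj₁ j = x∈⁅y⁆⇒x≡y e₀ j
          ... | inj₂ j with cyc-nonloop c e₀∈ st₀ (proj₁ z~p) (∈⟦⟧⁻ e∈)
          ...   | a , b , st , a≢b = ⊥-elim (z-loops (i , proj₂ (step⇒nonloop st a≢b)) j)

        Near : E → Set
        Near e = e ∈ F ⊎ (Nonloop z e × Avoids uv e)

        near? : ∀ e → Dec (Near e)
        near? e = (e ∈? F) ⊎-dec (nonloop? z e ×-dec avoids? uv e)

        S₁ : Subset m
        S₁ = filterSet near?

        uvz⁺ : ∀ {w} → w ∉ˡ uv → w ≢ z → w ∉ˡ uvz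
        uvz⁺ w∉ w≢z (here q) = w∉ (here q)
        uvz⁺ w∉ w≢z (there (here q)) = w∉ (there (here q))
        uvz⁺ w∉ w≢z (there (there (here q))) = w≢z q

        uvz⁻ : ∀ {w} → w ∉ˡ uvz → w ∉ˡ uv
        uvz⁻ w∉ (here q) = w∉ (here q)
        uvz⁻ w∉ (there (here q)) = w∉ (there (here q))

        -- The ear runs through `G − {u, v, z}` to `p` and returns by `e₀`. The resulting cycle
        -- avoids `u` and `v`, hence is balanced.
        ear₁ : ∀ {e} → e ≢ e₀ → Nonloop z e → Avoids uv e → BalancedEar S₀ e
        ear₁ {e} e≢e₀ nl av with nonloop⇒step nl
        ... | a , st , a≢z with reach⇒path (conn (uvz⁺ (avoids-inc av (step-incʳ st)) a≢z) (uvz⁺ p∉ (λ q → proj₁ z~p (sym q))))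
        ...   | pathIn {ts} {es} q q⊆ = balancedEar (step-sym st) ear
                  (λ i → [ (λ j → q⊆p∪q ⁅ e₀ ⁆ F (F₀⊆ (∈filter⁺ base? (inj₁ (q⊆ j))))) , (λ { (here refl) → p⊆p∪q F (x∈⁅x⁆ e₀) }) ]′ (∈-++⁻ es i))
                  (balanced-off (cyc ear st fresh) off)
          where
          ts-off : ∀ {w} → w ∈ˡ a ∷ ts → w ∉ˡ uvz
          ts-off = path-avoids q (uvz⁺ (avoids-inc av (step-incʳ st)) a≢z) q⊆
          ear : Path a (ts ++ [ z ]) (es ++ [ e₀ ]) z
          ear = path-snoc q (step-sym st₀) (λ i → ts-off i (there (there (here refl))))
          fresh : e ∉ˡ es ++ [ e₀ ]
          fresh i with ∈-++⁻ es i
          ... | inj₁ j = avoids-inc (q⊆ j) (step-incˡ st) (there (there (here refl)))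
          ... | inj₂ (here q) = e≢e₀ q
          off : ∀ {w} → w ∈ˡ a ∷ ts ++ [ z ] → w ∉ˡ uv
          off i with ∈-++⁻ (a ∷ ts) i
          ... | inj₁ j = uvz⁻ (ts-off j)
          ... | inj₂ (here refl) = z∉uv

        bal₁ : Balanced S₁
        bal₁ = balanced-extend bal₀ (λ e∈ → ear (∈filter⁻ near? e∈))
          where
          ear : ∀ {e} → Near e → e ∈ S₀ ⊎ BalancedEar S₀ e
          ear (inj₁ e∈) = inj₁ (q⊆p∪q ⁅ e₀ ⁆ F e∈)
          ear {e} (inj₂ (nl , av)) with e ≟ e₀
          ... | yes refl = inj₁ (p⊆p∪q F (x∈⁅x⁆ e₀))
          ... | no e≢ = inj₂ (ear₁ e≢ nl av)

        -- The ear supplied by the foot may enter `z` by an arbitrary edge from outside `u` and `v`.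
        -- Therefore all of those edges were inserted first, in `S₁`.
        ear₂ : ∀ {t t' e} (ft : Foot t z t') → Foot.f ft ∈ F → (∀ {w} → w ∈ˡ uv → w ≡ t ⊎ w ≡ t') → Step t e z → BalancedEar S₁ e
        ear₂ {t} {t'} {e} ft f∈ cover st with Foot.ear ft st
        ... | ts , es , q , t∉ , t'∉ , b = balancedEar st (cons (Foot.step ft) t∉ q) ear-in b
          where
          off : ∀ {w} → w ∈ˡ Foot.s ft ∷ ts → w ∉ˡ uv
          off i j = [ (λ { refl → t∉ i }) , (λ { refl → t'∉ i }) ]′ (cover j)
          ear-in : ∀ {d} → d ∈ˡ Foot.f ft ∷ es → d ∈ S₁
          ear-in (here refl) = ∈filter⁺ near? (inj₁ f∈)
          ear-in (there i) with path-edge-step q i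
          ... | a , b , s , a≢b with a ≟ z | b ≟ z
          ...   | yes refl | _ = ∈filter⁺ near? (inj₂ (step⇒nonloop s a≢b , step-avoids s (off (path-inc q i (step-incˡ s))) (off (path-inc q i (step-incʳ s)))))
          ...   | no _ | yes refl = ∈filter⁺ near? (inj₂ (step⇒nonloop (step-sym s) (λ r → a≢b (sym r)) , step-avoids s (off (path-inc q i (step-incˡ s))) (off (path-inc q i (step-incʳ s)))))
          ...   | no a≢z | no b≢z = ∈filter⁺ near? (inj₁ (F₀⊆ (∈filter⁺ base? (inj₁ (step-avoids s
                    (uvz⁺ (off (path-inc q i (step-incˡ s))) a≢z) (uvz⁺ (off (path-inc q i (step-incʳ s))) b≢z))))))

        bal₂ : Balanced (X ∪ F)
        bal₂ = balanced-extend bal₁ ear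
          where
          ear : ∀ {e} → e ∈ X ∪ F → e ∈ S₁ ⊎ BalancedEar S₁ e
          ear {e} e∈ with x∈p∪q⁻ X F e∈
          ... | inj₂ j = inj₁ (∈filter⁺ near? (inj₁ j))
          ... | inj₁ j with ∈filter⁻ (nonloop? z) j
          ...   | nl with nonloop⇒step nl
          ...     | a , st , a≢z with a ≟ u | a ≟ v
          ...       | yes refl | _ = inj₂ (ear₂ fu (F₀⊆ (∈filter⁺ base? (inj₂ (inj₁ refl)))) (λ { (here q) → inj₁ q ; (there (here q)) → inj₂ q }) (step-sym st))
          ...       | no _ | yes refl = inj₂ (ear₂ fv (F₀⊆ (∈filter⁺ base? (inj₂ (inj₂ refl)))) (λ { (here q) → inj₂ q ; (there (here q)) → inj₁ q }) (step-sym st))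
          ...       | no a≢u | no a≢v = inj₁ (∈filter⁺ near? (inj₂ (nl , step-avoids st z∉uv (λ { (here q) → a≢u q ; (there (here q)) → a≢v q }))))

      star-balanced : Balanced (filterSet (nonloop? z) ∪ F)
      star-balanced = bal₂

    private
      k : ℕ
      k = ∣ Grown.T tree ∣

      k≡ : suc k ≡ ∣ W ∣
      k≡ = tree-card tree

      n≡ : 2 + k ≡ n
      n≡ = trans (cong suc k≡) ∣W∣

      T⊆F₀ : Grown.T tree ⊆ F₀
      T⊆F₀ i = [ (λ j → ⊥-elim (∉⊥ j)) , ∈filter⁺ base? ]′ (Grown.T⊆ tree i)

      z-free : ∀ {d} → d ∈ Grown.T tree → ¬ Inc d z
      z-free d∈ i = ∈Off⁻ (Grown.touches tree d∈ i) (here refl)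

      -- A cycle through z all of whose edges at z are loops is a single loop.
      only-loops-at-z : ∀ c → z ∈ˡ vertices c → (∀ {e} → e ∈ˡ edges c → ¬ Nonloop z e) → cls (edgeSet c) ≡ 𝓑
      only-loops-at-z c z∈ loops with cyc-vertex-inc c z∈
      ... | e , e∈ , i = balanced-off c (λ w∈ → subst (_∉ˡ uv) (sym (loop-inc l i (cyc-with-loop c e∈ l w∈))) z∉uv)
        where
        l : src G e ≡ tgt G e
        l = decidable-stable (src G e ≟ tgt G e) (λ q → loops e∈ (i , q))

      module _ (F : Subset m) (F₀⊆ : F₀ ⊆ F) (ub : UpperBound F k) where

        z-loops : ∀ {e} → Nonloop z e → e ∉ F
        z-loops = pendant-bound ub (Grown.indep tree) (λ i → F₀⊆ (T⊆F₀ i)) ℕₚ.≤-refl z-free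

        -- An unbalanced cycle off `z` could be grown along the base to `∣ W ∣` independent edges,
        -- one more than `k`; a cycle through `z` is a loop there, which avoids `u` and `v`.
        balF : Balanced F
        balF c c⊆ = decidable-stable (𝓑? _) λ c≢𝓑 → contra c≢𝓑 (z ∈ˡ? vertices c)
          where
          contra : cls (edgeSet c) ≢ 𝓑 → Dec (z ∈ˡ vertices c) → Absurd
          contra c≢𝓑 (yes z∈) = c≢𝓑 (only-loops-at-z c z∈ (λ e∈ nl → z-loops nl (c⊆ e∈)))
          contra c≢𝓑 (no z∉) = ℕₚ.<⇒≱ (ℕₚ.≤-reflexive k≡)
            (subst (_≤ k) (cyc-card c g) (ub (Grown.T g) (λ i → [ (λ j → c⊆ (∈⟦⟧⁻ j)) , (λ b → F₀⊆ (∈filter⁺ base? b)) ]′ (Grown.T⊆ g i)) (Grown.indep g)))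
            where
            in-W : ∀ {w} → w ∈ˡ vertices c → w ∈ W
            in-W w∈ = ∈Off⁺ (λ { (here refl) → z∉ w∈ })
            g : Grown Base W (edgeSet c) ⟦ vertices c ⟧
            g = grow-cyc c base-in c≢𝓑 in-W (λ w∈ → reach-trans (reach-base w∈) (reach-sym (reach-base (in-W (here refl)))))

        X : Subset m
        X = filterSet (nonloop? z)

        -- Here `suc k` is `n − 1`. With the star at `z` the flat is still balanced, so its
        -- independent sets are forests. On the other side only balanced loops remain at `z`, so an
        -- independent set leaves `z` isolated and `z` reaches a root.
        sep : ∃ λ X → EdgeDisjoint G X F × UpperBound (X ∪ F) (suc k) × UpperBound (∁ X) (suc k)
        sep = X , (λ e e∈X → z-loops (∈filter⁻ (nonloop? z) e∈X)) ,
          (λ I I⊆ iI → down (indep-balanced-card< iI (λ _ _ → ∈⊤) (∈⊤ {x = z}) (λ c c⊆ → Closed.star-balanced F F₀⊆ balF z-loops c (λ i → I⊆ (c⊆ i))))) ,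
          (λ I I⊆ iI → down (deleted I I⊆ iI (indep-roots iI (λ _ _ → ∈⊤))))
          where
          down : ∀ {i} → suc i ≤ ∣ ⊤ {n} ∣ → i ≤ suc k
          down {i} le = ℕₚ.≤-pred (subst (suc i ≤_) (trans (∣⊤∣≡n n) (sym n≡)) le)
          deleted : ∀ I → I ⊆ ∁ X → Independent I → Roots I ⊤ → suc ∣ I ∣ ≤ ∣ ⊤ {n} ∣
          deleted I I⊆ iI ρ = finish (Roots.root ρ (∈⊤ {x = z}))
            where
            loops : ∀ {e} → e ∈ I → ¬ Nonloop z e
            loops e∈ nl = x∈∁p⇒x∉p (I⊆ e∈) (∈filter⁺ (nonloop? z) nl)
            stuck : ∀ {w} → Reach G (_∈ I) z w → w ≡ z
            stuck r = reach-invariant {U = _≡ z} (λ { {y = y} s e∈ refl → decidable-stable (y ≟ z) (λ y≢ → loops e∈ (step⇒nonloop s (λ q → y≢ (sym q)))) }) r refl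
            finish : (∃ λ r → r ∈ Roots.R ρ × Reach G (_∈ I) z r) ⊎ CycleNear I z → suc ∣ I ∣ ≤ ∣ ⊤ {n} ∣
            finish (inj₁ (_ , r∈ , _)) = roots-nonempty ρ r∈
            finish (inj₂ (near c c⊆ v∈ r)) = ⊥-elim (cyc-unbalanced iI c c⊆
              (only-loops-at-z c (subst (_∈ˡ vertices c) (stuck r) v∈) (λ e∈ → loops (c⊆ e∈))))

    cut-contradiction : Absurd
    cut-contradiction = unbalanced λ c _ → decidable-stable (𝓑? _) λ c≢𝓑 →
      break {F₀} {k} (λ I I⊆ iI → ℕₚ.≤-pred (subst (suc ∣ I ∣ ≤_) (sym k≡)
          (indep-balanced-card< iI (touches-F₀ I⊆) su∈W (λ d d⊆ → base-balanced d (λ i → ∈filter⁻ base? (I⊆ (d⊆ i)))))))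
        (Grown.T tree , T⊆F₀ , Grown.indep tree , ℕₚ.≤-refl)
        (subst (LowerBound ⊤) (sym n≡) (lower-⊤ c c≢𝓑)) sep

  tight-pair : ∀ {u v z} → u ≢ v → ¬ Adj u v → u ≢ z → v ≢ z → ConnectedOff (u ∷ v ∷ z ∷ []) → Loose u z v → Loose v z u → Absurd
  tight-pair u≢v u≁v u≢z v≢z conn lu lv = cut-contradiction u≢v u≁v u≢z v≢z conn
    (foot u≢z u≢v u≁v lu) (foot v≢z (λ q → u≢v (sym q)) (λ a → u≁v (adj-sym a)) lv)

-- The structure of the simple graph

module Shape (G : Graph) (cls : EdgeSet G → Cls G) (qb : Matroid.QuasiBiased G cls)
  (unb : Matroid.FlatContractions G cls) (g3 : Matroid.ThreeConnected G cls)
  (7≤n : 7 ≤ Graph.n G) where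

  open Graph G
  open Walks G
  open Contraction G cls qb unb g3

  private variable
    a b c d e f p q r s t w x y z u v : V
    xs ys : List V

  ≢-sym : a ≢ b → b ≢ a
  ≢-sym p q = p (sym q)

  ∉-nil : a ∉ˡ []
  ∉-nil ()

  infixr 5 _∷∉_
  _∷∉_ : a ≢ b → a ∉ˡ xs → a ∉ˡ b ∷ xs
  (p ∷∉ q) (here r) = p r
  (p ∷∉ q) (there r) = q r

  adj-≢ : Adj a b → a ≢ b
  adj-≢ = proj₁

  fresh : (xs : List V) → length xs < 7 → ∃ λ x → x ∉ˡ xs
  fresh xs le = ∃-fresh xs (ℕₚ.≤-trans le 7≤n)

  adj-reach : Adj a b → a ∉ˡ xs → b ∉ˡ xs → Reach G (Avoids xs) b c → Reach G (Avoids xs) a c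
  adj-reach (_ , _ , st) a∉ b∉ r = reach-step st (step-avoids st a∉ b∉) r

  hub : (h : V) → (∀ {w} → w ∉ˡ xs → Reach G (Avoids xs) w h) → ConnectedOff xs
  hub h f a∉ b∉ = reach-trans (f a∉) (reach-sym (f b∉))

  record Misses (xs : List V) : Set where
    constructor misses
    field
      {h k} : V
      h≢k   : h ≢ k
      h≁k   : ¬ Adj h k
      h∉    : h ∉ˡ xs
      k∉    : k ∉ˡ xs

  triangle : ∀ {t'} → Adj t s → Adj s z → t ≢ z → t' ≢ s → t' ≢ z → Misses (t ∷ s ∷ z ∷ []) → Loose t z t'
  triangle t~s s~z t≢z t'≢s t'≢z (misses w≢x w≁x w∉ x∉) = inj₂ (nonCover t~s
    (cons (proj₂ (proj₂ s~z)) (adj-≢ s~z ∷∉ ∉-nil) [])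
    (adj-≢ t~s ∷∉ t≢z ∷∉ ∉-nil) (t'≢s ∷∉ t'≢z ∷∉ ∉-nil) (adj-≢ s~z) w≢x w≁x w∉ x∉)

  square : ∀ {t'} → Adj t s → Adj s r → Adj r z → t ≢ r → t ≢ z → s ≢ z → t' ≢ s → t' ≢ r → t' ≢ z →
    Misses (t ∷ s ∷ r ∷ z ∷ []) → Loose t z t'
  square t~s s~r r~z t≢r t≢z s≢z t'≢s t'≢r t'≢z (misses w≢x w≁x w∉ x∉) = inj₂ (nonCover t~s
    (cons (proj₂ (proj₂ s~r)) (adj-≢ s~r ∷∉ s≢z ∷∉ ∉-nil) (cons (proj₂ (proj₂ r~z)) (adj-≢ r~z ∷∉ ∉-nil) []))
    (adj-≢ t~s ∷∉ t≢r ∷∉ t≢z ∷∉ ∉-nil) (t'≢s ∷∉ t'≢r ∷∉ t'≢z ∷∉ ∉-nil) s≢z w≢x w≁x w∉ x∉)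

  -- The complement of a triangle is a clique

  record Tri (c d e : V) : Set where
    constructor tri
    field
      c~d : Adj c d
      c~e : Adj c e
      d~e : Adj d e
      clique : ∀ {w x} → w ∉ˡ c ∷ d ∷ e ∷ [] → x ∉ˡ c ∷ d ∷ e ∷ [] → w ≢ x → Adj w x

  ∉₁ : ∀ {x y : V} {ys} → x ∉ˡ y ∷ ys → x ≢ y
  ∉₁ f q = f (here q)

  ∉₂ : ∀ {x y y' : V} {ys} → x ∉ˡ y' ∷ y ∷ ys → x ≢ y
  ∉₂ f q = f (there (here q))

  ∉₃ : ∀ {x y y' y'' : V} {ys} → x ∉ˡ y'' ∷ y' ∷ y ∷ ys → x ≢ y
  ∉₃ f q = f (there (there (here q)))

  ∉₄ : ∀ {x y : V} {a b c ys} → x ∉ˡ a ∷ b ∷ c ∷ y ∷ ys → x ≢ y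
  ∉₄ f = ∉₃ (λ i → f (there i))

  ∉₅ : ∀ {x y : V} {a b c d ys} → x ∉ˡ a ∷ b ∷ c ∷ d ∷ y ∷ ys → x ≢ y
  ∉₅ f = ∉₄ (λ i → f (there i))

  ∉₆ : ∀ {x y : V} {a b c d e ys} → x ∉ˡ a ∷ b ∷ c ∷ d ∷ e ∷ y ∷ ys → x ≢ y
  ∉₆ f = ∉₅ (λ i → f (there i))

  swap₁₂ : x ∉ˡ a ∷ b ∷ xs → x ∉ˡ b ∷ a ∷ xs
  swap₁₂ f (here q) = f (there (here q))
  swap₁₂ f (there (here q)) = f (here q)
  swap₁₂ f (there (there i)) = f (there (there i))

  swap₂₃ : x ∉ˡ a ∷ b ∷ c ∷ xs → x ∉ˡ a ∷ c ∷ b ∷ xs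
  swap₂₃ f (here q) = f (here q)
  swap₂₃ f (there i) = swap₁₂ (λ j → f (there j)) i

  tri-swap₁₂ : Tri c d e → Tri d c e
  tri-swap₁₂ (tri cd ce de k) = tri (adj-sym cd) de ce (λ i j → k (swap₁₂ i) (swap₁₂ j))

  tri-swap₂₃ : Tri c d e → Tri c e d
  tri-swap₂₃ (tri cd ce de k) = tri ce cd (adj-sym de) (λ i j → k (swap₂₃ i) (swap₂₃ j))

  record TwoMissing (c d e q r' : V) : Set where
    constructor twoMissing
    field
      T    : Tri c d e
      q∈   : q ∉ˡ c ∷ d ∷ e ∷ []
      r'∈  : r' ∉ˡ c ∷ d ∷ e ∷ []
      q≢r' : q ≢ r'
      c≁q  : ¬ Adj c q
      d≁r' : ¬ Adj d r'

  module _ {c d e q r'} (M : TwoMissing c d e q r') where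
    open TwoMissing M
    open Tri T

    -- A vertex `y` through which everything communicates once `c`, `q` and `r` are deleted: the
    -- clique is adjacent to it, and `d` and `e` reach it directly or through each other.
    Hub : V → V → Set
    Hub r y = y ∉ˡ c ∷ d ∷ e ∷ [] × y ≢ q × y ≢ r × (Adj d y ⊎ Adj e y)

    hub? : ∀ r y → Dec (Hub r y)
    hub? r y = ¬? (y ∈ˡ? _) ×-dec (¬? (y ≟ q) ×-dec (¬? (y ≟ r) ×-dec (adj? d y ⊎-dec adj? e y)))

    module _ {r s₀} (r∈ : r ∉ˡ c ∷ d ∷ e ∷ q ∷ r' ∷ []) (s₀∈ : s₀ ∉ˡ c ∷ d ∷ e ∷ q ∷ r' ∷ r ∷ []) (h : ∃ (Hub r)) where

      private
        Q⊇ : ∀ {x ys} → x ∉ˡ c ∷ d ∷ e ∷ ys → x ∉ˡ c ∷ d ∷ e ∷ []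
        Q⊇ f = ∉₁ f ∷∉ ∉₂ f ∷∉ ∉₃ f ∷∉ ∉-nil

        rQ = Q⊇ r∈
        sQ = Q⊇ s₀∈
        r≢q : r ≢ q
        r≢q = ∉₄ r∈
        r≢r' : r ≢ r'
        r≢r' = ∉₅ r∈
        s≢q : s₀ ≢ q
        s≢q = ∉₄ s₀∈
        s≢r' : s₀ ≢ r'
        s≢r' = ∉₅ s₀∈
        s≢r : s₀ ≢ r
        s≢r = ∉₆ s₀∈

        conn : ConnectedOff (c ∷ q ∷ r ∷ [])
        conn = go h
          where
          go : ∃ (Hub r) → ConnectedOff (c ∷ q ∷ r ∷ [])
          go (y , y∈ , y≢q , y≢r , arm) = hub y reach
            where
            y∉ : y ∉ˡ c ∷ q ∷ r ∷ []
            y∉ = ∉₁ y∈ ∷∉ y≢q ∷∉ y≢r ∷∉ ∉-nil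
            d∉ : d ∉ˡ c ∷ q ∷ r ∷ []
            d∉ = ≢-sym (adj-≢ c~d) ∷∉ ≢-sym (∉₂ q∈) ∷∉ ≢-sym (∉₂ rQ) ∷∉ ∉-nil
            e∉ : e ∉ˡ c ∷ q ∷ r ∷ []
            e∉ = ≢-sym (adj-≢ c~e) ∷∉ ≢-sym (∉₃ q∈) ∷∉ ≢-sym (∉₃ rQ) ∷∉ ∉-nil
            from-d : Reach G (Avoids (c ∷ q ∷ r ∷ [])) d y
            from-d = [ (λ a → adj-reach a d∉ y∉ here) , (λ a → adj-reach d~e d∉ e∉ (adj-reach a e∉ y∉ here)) ]′ arm
            from-e : Reach G (Avoids (c ∷ q ∷ r ∷ [])) e y
            from-e = [ (λ a → adj-reach (adj-sym d~e) e∉ d∉ (adj-reach a d∉ y∉ here)) , (λ a → adj-reach a e∉ y∉ here) ]′ arm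
            reach : ∀ {w} → w ∉ˡ c ∷ q ∷ r ∷ [] → Reach G (Avoids (c ∷ q ∷ r ∷ [])) w y
            reach {w} w∉ with w ≟ d | w ≟ e | w ≟ y
            ... | yes refl | _ | _ = from-d
            ... | no _ | yes refl | _ = from-e
            ... | no _ | no _ | yes refl = here
            ... | no w≢d | no w≢e | no w≢y = adj-reach (clique (∉₁ w∉ ∷∉ w≢d ∷∉ w≢e ∷∉ ∉-nil) y∈ w≢y) w∉ y∉ here

        -- The triangle `q`, `s₀`, `r` of the clique misses the non-adjacent `d`, `r'`, so the pair
        -- `c`, `q` is loose at `q` and cannot be loose at `c`. The following lemmas exhibit short
        -- cycles through `c` and `r` that would miss `d`, `r'` as well.
        not-loose : ¬ Loose c r q
        not-loose l = tight-pair (≢-sym (∉₁ q∈)) c≁q (≢-sym (∉₁ rQ)) (≢-sym r≢q) conn l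
          (triangle (clique q∈ sQ (≢-sym s≢q)) (clique sQ rQ s≢r) (≢-sym r≢q) (≢-sym (∉₁ sQ)) (≢-sym (∉₁ rQ))
            (misses (≢-sym (∉₂ r'∈)) d≁r' (≢-sym (∉₂ q∈) ∷∉ ≢-sym (∉₂ sQ) ∷∉ ≢-sym (∉₂ rQ) ∷∉ ∉-nil)
              (≢-sym q≢r' ∷∉ ≢-sym s≢r' ∷∉ ≢-sym r≢r' ∷∉ ∉-nil)))

      c~r : Adj c r
      c~r = decidable-stable (adj? c r) (λ c≁r → not-loose (inj₁ c≁r))

      c-only : ∀ {s} → s ∉ˡ c ∷ d ∷ e ∷ [] → s ≢ r → s ≢ r' → ¬ Adj c s
      c-only s∈ s≢r s≢r' c~s = not-loose (triangle c~s (clique s∈ rQ s≢r) (≢-sym (∉₁ rQ)) (λ { refl → c≁q c~s }) (≢-sym r≢q)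
        (misses (≢-sym (∉₂ r'∈)) d≁r' (≢-sym (adj-≢ c~d) ∷∉ ≢-sym (∉₂ s∈) ∷∉ ≢-sym (∉₂ rQ) ∷∉ ∉-nil)
          (∉₁ r'∈ ∷∉ ≢-sym s≢r' ∷∉ ≢-sym r≢r' ∷∉ ∉-nil)))

      e-not-r : ¬ Adj e r
      e-not-r e~r = not-loose (triangle c~e e~r (≢-sym (∉₁ rQ)) (∉₃ q∈) (≢-sym r≢q)
        (misses (≢-sym (∉₂ r'∈)) d≁r' (≢-sym (adj-≢ c~d) ∷∉ adj-≢ d~e ∷∉ ≢-sym (∉₂ rQ) ∷∉ ∉-nil)
          (∉₁ r'∈ ∷∉ ∉₃ r'∈ ∷∉ ≢-sym r≢r' ∷∉ ∉-nil)))

      e-only : ∀ {s} → s ∉ˡ c ∷ d ∷ e ∷ [] → s ≢ r → s ≢ r' → s ≢ q → ¬ Adj e s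
      e-only s∈ s≢r s≢r' s≢q e~s = not-loose (square c~e e~s (clique s∈ rQ s≢r) (≢-sym (∉₁ s∈)) (≢-sym (∉₁ rQ)) (≢-sym (∉₃ rQ))
        (∉₃ q∈) (≢-sym s≢q) (≢-sym r≢q)
        (misses (≢-sym (∉₂ r'∈)) d≁r' (≢-sym (adj-≢ c~d) ∷∉ adj-≢ d~e ∷∉ ≢-sym (∉₂ s∈) ∷∉ ≢-sym (∉₂ rQ) ∷∉ ∉-nil)
          (∉₁ r'∈ ∷∉ ∉₃ r'∈ ∷∉ ≢-sym s≢r' ∷∉ ≢-sym r≢r' ∷∉ ∉-nil)))

  swap-missing : TwoMissing c d e q r → TwoMissing d c e r q
  swap-missing (twoMissing T q∈ r∈ q≢r c≁q d≁r) = twoMissing (tri-swap₁₂ T) (swap₁₂ r∈) (swap₁₂ q∈) (≢-sym q≢r) d≁r c≁q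

  -- Two further clique vertices `r₁`, `r₂` are chosen, seven vertices in all. Either both leave a
  -- hub, or the absence of one forces so many non-adjacencies that exchanging the roles of `c` and
  -- `d` gives a contradiction.
  no-two-missing : ¬ TwoMissing c d e q r
  no-two-missing {c} {d} {e} {q} {r'} M with fresh (c ∷ d ∷ e ∷ q ∷ r' ∷ []) (s≤s (s≤s (s≤s (s≤s (s≤s (s≤s z≤n))))))
  ... | r₁ , r₁∈ with fresh (c ∷ d ∷ e ∷ q ∷ r' ∷ r₁ ∷ []) (s≤s (s≤s (s≤s (s≤s (s≤s (s≤s (s≤s z≤n)))))))
  ...   | r₂ , r₂∈ = cases (any? (hub? M r₁)) (any? (hub? M r₂))
    where
    open TwoMissing M
    open Tri T
    init : ∀ {x y} → x ∉ˡ c ∷ d ∷ e ∷ q ∷ r' ∷ y ∷ [] → x ∉ˡ c ∷ d ∷ e ∷ q ∷ r' ∷ []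
    init f (here z) = f (here z)
    init f (there (here z)) = f (there (here z))
    init f (there (there (here z))) = f (there (there (here z)))
    init f (there (there (there (here z)))) = f (there (there (there (here z))))
    init f (there (there (there (there (here z))))) = f (there (there (there (there (here z)))))
    snoc : ∀ {x y} → x ∉ˡ c ∷ d ∷ e ∷ q ∷ r' ∷ [] → x ≢ y → x ∉ˡ c ∷ d ∷ e ∷ q ∷ r' ∷ y ∷ []
    snoc f g = ∉₁ f ∷∉ ∉₂ f ∷∉ ∉₃ f ∷∉ ∉₄ f ∷∉ ∉₅ f ∷∉ g ∷∉ ∉-nil
    Q⊇ : ∀ {x} → x ∉ˡ c ∷ d ∷ e ∷ q ∷ r' ∷ [] → x ∉ˡ c ∷ d ∷ e ∷ []
    Q⊇ f = ∉₁ f ∷∉ ∉₂ f ∷∉ ∉₃ f ∷∉ ∉-nil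
    r₂≢r₁ : r₂ ≢ r₁
    r₂≢r₁ = ∉₆ r₂∈
    -- As `G − {c, q}` is connected, an edge leaves `d`, `e` towards the clique, and only `s` can be
    -- its other end; so `s` is a hub for `r`. This leaves `q` as the only possible neighbour of `e`
    -- besides `c` and `d`, which makes `q` a hub in the exchanged configuration.
    no-hub : ∀ {r s} → r ∉ˡ c ∷ d ∷ e ∷ q ∷ r' ∷ [] → s ∉ˡ c ∷ d ∷ e ∷ q ∷ r' ∷ [] → s ≢ r → ¬ ∃ (Hub M s) → Absurd
    no-hub {r} {s} r∈ s∈ s≢r none with reach-cross {U = _∈ˡ d ∷ e ∷ []} (λ w → w ∈ˡ? _)
        (connected (c ∷ q ∷ []) ℕₚ.≤-refl {d} {r} (≢-sym (adj-≢ c~d) ∷∉ ≢-sym (∉₂ q∈) ∷∉ ∉-nil)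
          (∉₁ r∈ ∷∉ ∉₄ r∈ ∷∉ ∉-nil)) (here refl) (∉₂ r∈ ∷∉ ∉₃ r∈ ∷∉ ∉-nil)
    ... | x , f , y , st , av , x∈ , y∉ = finish (neighbour e c d (≢-sym (adj-≢ c~e) ∷∉ ≢-sym (adj-≢ d~e) ∷∉ ∉-nil))
      where
      yQ : y ∉ˡ c ∷ d ∷ e ∷ []
      yQ = (λ z → avoids-inc av (step-incʳ st) (here z)) ∷∉ y∉
      y≢q : y ≢ q
      y≢q z = avoids-inc av (step-incʳ st) (there (here z))
      arm : ∀ {w} → w ≡ y → Adj d w ⊎ Adj e w
      arm refl = go x∈ st
        where
        go : x ∈ˡ d ∷ e ∷ [] → Step x f y → Adj d y ⊎ Adj e y
        go (here refl) st = inj₁ ((λ z → y∉ (here (sym z))) , f , st)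
        go (there (here refl)) st = inj₂ ((λ z → y∉ (there (here (sym z)))) , f , st)
      y≡s : y ≡ s
      y≡s = decidable-stable (y ≟ s) (λ y≢s → none (y , yQ , y≢q , y≢s , arm refl))
      h : ∃ (Hub M r)
      h = s , Q⊇ s∈ , (∉₄ s∈) , s≢r , arm (sym y≡s)
      d-none : ¬ Adj d r
      d-none d~r = none (r , Q⊇ r∈ , (∉₄ r∈) , ≢-sym s≢r , inj₁ d~r)
      s∈' = snoc s∈ s≢r
      e~q : (∃ λ y → Adj e y × y ∉ˡ c ∷ d ∷ []) → Adj e q
      e~q (y , e~y , y∉) with y ≟ q
      ... | yes refl = e~y
      ... | no y≢q with y ≟ r | y ≟ r'
      ...   | yes refl | _ = ⊥-elim (e-not-r M r∈ s∈' h e~y)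
      ...   | no _ | yes refl = ⊥-elim (none (r' , r'∈ , ≢-sym q≢r' , (≢-sym (∉₅ s∈)) , inj₂ e~y))
      ...   | no y≢r | no y≢r' = ⊥-elim (e-only M r∈ s∈' h (∉₁ y∉ ∷∉ ∉₂ y∉ ∷∉ ≢-sym (adj-≢ e~y) ∷∉ ∉-nil) y≢r y≢r' y≢q e~y)
      reorder : ∀ {x} → x ∉ˡ c ∷ d ∷ e ∷ q ∷ r' ∷ [] → x ∉ˡ d ∷ c ∷ e ∷ r' ∷ q ∷ []
      reorder f = ∉₂ f ∷∉ ∉₁ f ∷∉ ∉₃ f ∷∉ ∉₅ f ∷∉ ∉₄ f ∷∉ ∉-nil
      finish : (∃ λ y → Adj e y × y ∉ˡ c ∷ d ∷ []) → Absurd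
      finish nb = d-none (c~r (swap-missing M) (reorder r∈)
        (∉₂ s∈ ∷∉ ∉₁ s∈ ∷∉ ∉₃ s∈ ∷∉ ∉₅ s∈ ∷∉ ∉₄ s∈ ∷∉ s≢r ∷∉ ∉-nil)
        (q , swap₁₂ q∈ , q≢r' , (≢-sym (∉₄ r∈)) , inj₂ (e~q nb)))
    cases : Dec (∃ (Hub M r₁)) → Dec (∃ (Hub M r₂)) → Absurd
    -- The hub for `r₁` makes `c` adjacent to `r₁`, the one for `r₂` forbids it.
    cases (yes h₁) (yes h₂) = c-only M (init r₂∈) (snoc r₁∈ (≢-sym r₂≢r₁)) h₂ (Q⊇ r₁∈) (≢-sym r₂≢r₁) (∉₅ r₁∈)
      (c~r M r₁∈ r₂∈ h₁)
    cases (no n₁) _ = no-hub (init r₂∈) r₁∈ (≢-sym r₂≢r₁) n₁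
    cases (yes _) (no n₂) = no-hub r₁∈ (init r₂∈) r₂≢r₁ n₂

  module _ (T : Tri c d e) where
    open Tri T

    second-adj : q ∉ˡ c ∷ d ∷ e ∷ [] → r ∉ˡ c ∷ d ∷ e ∷ [] → q ≢ r → ¬ Adj c q → Adj d r
    second-adj {q} {r} q∈ r∈ q≢r c≁q = decidable-stable (adj? d r) (λ d≁r → no-two-missing (twoMissing T q∈ r∈ q≢r c≁q d≁r))

  third-adj : Tri c d e → q ∉ˡ c ∷ d ∷ e ∷ [] → r ∉ˡ c ∷ d ∷ e ∷ [] → q ≢ r → ¬ Adj c q → Adj e r
  third-adj T q∈ r∈ = second-adj (tri-swap₂₃ T) (swap₂₃ q∈) (swap₂₃ r∈)

  -- With `q₂` deleted along with `c`, `q₁`, looseness at `c` is a non-adjacency, and the clique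
  -- triangle `q₁`, `q₄`, `q₂` misses `c`, `q₃`. Connectivity comes from `second-adj` and
  -- `third-adj`, by which `d` and `e` are adjacent to `q₃`.
  no-star-out : ∀ {q₁ q₂ q₃} → Tri c d e → q₁ ∉ˡ c ∷ d ∷ e ∷ [] → q₂ ∉ˡ c ∷ d ∷ e ∷ [] → q₃ ∉ˡ c ∷ d ∷ e ∷ [] →
    q₁ ≢ q₂ → q₁ ≢ q₃ → q₂ ≢ q₃ → ¬ Adj c q₁ → ¬ Adj c q₂ → ¬ Adj c q₃ → Absurd
  no-star-out {c} {d} {e} {q₁} {q₂} {q₃} T q₁∈ q₂∈ q₃∈ q₁≢q₂ q₁≢q₃ q₂≢q₃ c≁q₁ c≁q₂ c≁q₃
    with fresh (c ∷ d ∷ e ∷ q₁ ∷ q₂ ∷ q₃ ∷ []) (s≤s (s≤s (s≤s (s≤s (s≤s (s≤s (s≤s z≤n)))))))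
  ... | q₄ , q₄∈ = tight-pair (≢-sym (∉₁ q₁∈)) c≁q₁ (≢-sym (∉₁ q₂∈)) q₁≢q₂ (hub q₃ reach) (inj₁ c≁q₂)
      (triangle (clique q₁∈ q₄Q (≢-sym q₄≢q₁)) (clique q₄Q q₂∈ q₄≢q₂) q₁≢q₂ (≢-sym (∉₁ q₄Q)) (≢-sym (∉₁ q₂∈))
        (misses (≢-sym (∉₁ q₃∈)) c≁q₃ (≢-sym (∉₁ q₁∈) ∷∉ ≢-sym (∉₁ q₄Q) ∷∉ ≢-sym (∉₁ q₂∈) ∷∉ ∉-nil)
          (≢-sym q₁≢q₃ ∷∉ ≢-sym q₄≢q₃ ∷∉ ≢-sym q₂≢q₃ ∷∉ ∉-nil)))
    where
    open Tri T
    q₄Q : q₄ ∉ˡ c ∷ d ∷ e ∷ []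
    q₄Q = ∉₁ q₄∈ ∷∉ ∉₂ q₄∈ ∷∉ ∉₃ q₄∈ ∷∉ ∉-nil
    q₄≢q₁ : q₄ ≢ q₁
    q₄≢q₁ = ∉₄ q₄∈
    q₄≢q₂ : q₄ ≢ q₂
    q₄≢q₂ = ∉₅ q₄∈
    q₄≢q₃ : q₄ ≢ q₃
    q₄≢q₃ = ∉₆ q₄∈
    q₃∉ : q₃ ∉ˡ c ∷ q₁ ∷ q₂ ∷ []
    q₃∉ = ∉₁ q₃∈ ∷∉ ≢-sym q₁≢q₃ ∷∉ ≢-sym q₂≢q₃ ∷∉ ∉-nil
    reach : ∀ {w} → w ∉ˡ c ∷ q₁ ∷ q₂ ∷ [] → Reach G (Avoids (c ∷ q₁ ∷ q₂ ∷ [])) w q₃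
    reach {w} w∉ with w ≟ d | w ≟ e | w ≟ q₃
    ... | yes refl | _ | _ = adj-reach (second-adj T q₁∈ q₃∈ q₁≢q₃ c≁q₁) w∉ q₃∉ here
    ... | no _ | yes refl | _ = adj-reach (third-adj T q₁∈ q₃∈ q₁≢q₃ c≁q₁) w∉ q₃∉ here
    ... | no _ | no _ | yes refl = here
    ... | no w≢d | no w≢e | no w≢q₃ = adj-reach (clique (∉₁ w∉ ∷∉ w≢d ∷∉ w≢e ∷∉ ∉-nil) q₃∈ w≢q₃) w∉ q₃∉ here

  -- The pair is `c`, `q` and the third deleted vertex is `d`. Looseness at `q` is a non-adjacency,
  -- and the triangle `c`, `s`, `d` misses `q`, `e`.
  no-star-in : Tri c d e → q ∉ˡ c ∷ d ∷ e ∷ [] → ¬ Adj c q → ¬ Adj d q → ¬ Adj e q → Absurd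
  no-star-in {c} {d} {e} {q} T q∈ c≁q d≁q e≁q with fresh (c ∷ d ∷ e ∷ q ∷ []) (s≤s (s≤s (s≤s (s≤s (s≤s z≤n)))))
  ... | s , s∈ = tight-pair (≢-sym (∉₁ q∈)) c≁q (adj-≢ c~d) (∉₂ q∈) (hub s reach)
      (triangle (adj-c) (adj-sym (second-adj T q∈ sQ q≢s c≁q)) (adj-≢ c~d) q≢s (∉₂ q∈)
        (misses (≢-sym (∉₃ q∈)) e≁q (≢-sym (adj-≢ c~e) ∷∉ ≢-sym (∉₃ sQ) ∷∉ ≢-sym (adj-≢ d~e) ∷∉ ∉-nil)
          (∉₁ q∈ ∷∉ q≢s ∷∉ ∉₂ q∈ ∷∉ ∉-nil)))
      (inj₁ (λ a → d≁q (adj-sym a)))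
    where
    open Tri T
    sQ : s ∉ˡ c ∷ d ∷ e ∷ []
    sQ = ∉₁ s∈ ∷∉ ∉₂ s∈ ∷∉ ∉₃ s∈ ∷∉ ∉-nil
    q≢s : q ≢ s
    q≢s = ≢-sym (∉₄ s∈)
    adj-c : Adj c s
    adj-c = second-adj (tri-swap₁₂ T) (swap₁₂ q∈) (swap₁₂ sQ) q≢s d≁q
    s∉ : s ∉ˡ c ∷ q ∷ d ∷ []
    s∉ = ∉₁ sQ ∷∉ ≢-sym q≢s ∷∉ ∉₂ sQ ∷∉ ∉-nil
    reach : ∀ {w} → w ∉ˡ c ∷ q ∷ d ∷ [] → Reach G (Avoids (c ∷ q ∷ d ∷ [])) w s
    reach {w} w∉ with w ≟ e | w ≟ s
    ... | yes refl | _ = adj-reach (third-adj T q∈ sQ q≢s c≁q) w∉ s∉ here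
    ... | no _ | yes refl = here
    ... | no w≢e | no w≢s = adj-reach (clique (∉₁ w∉ ∷∉ ∉₃ w∉ ∷∉ w≢e ∷∉ ∉-nil) sQ w≢s) w∉ s∉ here

  -- Induced 4-cycles whose complement is a clique

  module Clique (Q : V → Set) (Q? : ∀ w → Dec (Q w)) (clique : ∀ {w x} → Q w → Q x → w ≢ x → Adj w x) where

    record Sq (c₀ c₁ c₂ c₃ : V) : Set where
      constructor sq
      field
        c₀₁ : Adj c₀ c₁
        c₁₂ : Adj c₁ c₂
        c₂₃ : Adj c₂ c₃
        c₃₀ : Adj c₃ c₀
        c₀≢c₂ : c₀ ≢ c₂
        c₁≢c₃ : c₁ ≢ c₃
        c₀≁c₂ : ¬ Adj c₀ c₂
        c₁≁c₃ : ¬ Adj c₁ c₃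
        out₀ : ¬ Q c₀
        out₁ : ¬ Q c₁
        out₂ : ¬ Q c₂
        out₃ : ¬ Q c₃
        cover : ∀ w → Q w ⊎ w ∈ˡ c₀ ∷ c₁ ∷ c₂ ∷ c₃ ∷ []

    private variable
      c₀ c₁ c₂ c₃ : V

    rot : Sq c₀ c₁ c₂ c₃ → Sq c₁ c₂ c₃ c₀
    rot (sq a b c d p q p' q' o₀ o₁ o₂ o₃ k) = sq b c d a q (≢-sym p) q' (λ z → p' (adj-sym z)) o₁ o₂ o₃ o₀ (λ w → [ inj₁ , (λ i → inj₂ (move i)) ]′ (k w))
      where
      move : ∀ {w} → w ∈ˡ c₀ ∷ c₁ ∷ c₂ ∷ c₃ ∷ [] → w ∈ˡ c₁ ∷ c₂ ∷ c₃ ∷ c₀ ∷ []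
      move (here z) = there (there (there (here z)))
      move (there (here z)) = here z
      move (there (there (here z))) = there (here z)
      move (there (there (there (here z)))) = there (there (here z))

    flip-sq : Sq c₀ c₁ c₂ c₃ → Sq c₀ c₃ c₂ c₁
    flip-sq (sq a b c d p q p' q' o₀ o₁ o₂ o₃ k) = sq (adj-sym d) (adj-sym c) (adj-sym b) (adj-sym a) p (≢-sym q) p' (λ z → q' (adj-sym z)) o₀ o₃ o₂ o₁ (λ w → [ inj₁ , (λ i → inj₂ (move i)) ]′ (k w))
      where
      move : ∀ {w} → w ∈ˡ c₀ ∷ c₁ ∷ c₂ ∷ c₃ ∷ [] → w ∈ˡ c₀ ∷ c₃ ∷ c₂ ∷ c₁ ∷ []
      move (here z) = here z
      move (there (here z)) = there (there (there (here z)))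
      move (there (there (here z))) = there (there (here z))
      move (there (there (there (here z)))) = there (here z)

    Q≢ : Q q → ¬ Q c → q ≢ c
    Q≢ qq ¬qc refl = ¬qc qq

    ≢Q : ¬ Q c → Q q → c ≢ q
    ≢Q ¬qc qq refl = ¬qc qq

    record Unique-nbr (c q : V) : Set where
      constructor unique-nbr
      field
        q∈   : Q q
        c~q  : Adj c q
        only : ∀ {q'} → Q q' → Adj c q' → q' ≡ q

    nbr₁ : Sq c₀ c₁ c₂ c₃ → ∃ λ q → Q q × Adj c₁ q
    nbr₁ {c₀} {c₁} {c₂} {c₃} S with neighbour c₁ c₀ c₂ (≢-sym (adj-≢ (Sq.c₀₁ S)) ∷∉ adj-≢ (Sq.c₁₂ S) ∷∉ ∉-nil)
    ... | y , c₁~y , y∉ with Sq.cover S y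
    ...   | inj₁ qy = y , qy , c₁~y
    ...   | inj₂ (here refl) = ⊥-elim (y∉ (here refl))
    ...   | inj₂ (there (here refl)) = ⊥-elim (adj-≢ c₁~y refl)
    ...   | inj₂ (there (there (here refl))) = ⊥-elim (y∉ (there (here refl)))
    ...   | inj₂ (there (there (there (here refl)))) = ⊥-elim (Sq.c₁≁c₃ S c₁~y)

    another : Sq c₀ c₁ c₂ c₃ → ∀ a b → ∃ λ q → Q q × q ≢ a × q ≢ b
    another {c₀} {c₁} {c₂} {c₃} S a b with fresh (a ∷ b ∷ c₀ ∷ c₁ ∷ c₂ ∷ c₃ ∷ []) (s≤s (s≤s (s≤s (s≤s (s≤s (s≤s (s≤s z≤n)))))))
    ... | q , q∉ = q , [ (λ z → z) , (λ i → ⊥-elim (q∉ (there (there i)))) ]′ (Sq.cover S q) , ∉₁ q∉ , ∉₂ q∉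

    -- With a second neighbour `q'` of `c₀` in the clique, the triangle `c₀`, `q'`, `q` misses the
    -- opposite vertices `c₁`, `c₃`.
    loose₀ : Sq c₀ c₁ c₂ c₃ → Q q → ¬ Unique-nbr c₀ q → Loose c₀ q c₂
    loose₀ {c₀} {c₁} {c₂} {c₃} {q} S qq ¬u with adj? c₀ q
    ... | no c≁q = inj₁ c≁q
    ... | yes c~q with any? (λ q' → Q? q' ×-dec (adj? c₀ q' ×-dec ¬? (q' ≟ q)))
    ...   | no none = ⊥-elim (¬u (unique-nbr qq c~q (λ {q'} qq' c~q' → decidable-stable (q' ≟ q) (λ ne → none (q' , qq' , c~q' , ne)))))
    ...   | yes (q' , qq' , c~q' , ne) = triangle c~q' (clique qq' qq ne) (adj-≢ c~q) (≢Q out₂ qq') (≢Q out₂ qq)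
            (misses c₁≢c₃ c₁≁c₃ (≢-sym (adj-≢ c₀₁) ∷∉ ≢Q out₁ qq' ∷∉ ≢Q out₁ qq ∷∉ ∉-nil)
              (adj-≢ c₃₀ ∷∉ ≢Q out₃ qq' ∷∉ ≢Q out₃ qq ∷∉ ∉-nil))
      where open Sq S

    -- Once `c₁` and `c₃` keep neighbours in the clique besides `q`, deleting `c₀`, `c₂`, `q` leaves
    -- a connected graph; so `q` must be the unique clique neighbour of `c₀` or of `c₂`. The rest of
    -- the argument varies `q` until too many unique neighbours exist.
    opposite-pair : Sq c₀ c₁ c₂ c₃ → Q q → Q p → Adj c₁ p → p ≢ q → Q r → Adj c₃ r → r ≢ q → ¬ Unique-nbr c₀ q → ¬ Unique-nbr c₂ q → Absurd
    opposite-pair {c₀} {c₁} {c₂} {c₃} {q} {p} {r} S qq qp c₁~p p≢q qr c₃~r r≢q ¬u₀ ¬u₂ =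
      tight-pair c₀≢c₂ c₀≁c₂ (≢Q out₀ qq) (≢Q out₂ qq) (hub p reach) (loose₀ S qq ¬u₀) (loose₀ (rot (rot S)) qq ¬u₂)
      where
      open Sq S
      xs₀ : List V
      xs₀ = c₀ ∷ c₂ ∷ q ∷ []
      in-Q : ∀ {w} → Q w → w ≢ q → w ∉ˡ xs₀
      in-Q qw w≢q = Q≢ qw out₀ ∷∉ Q≢ qw out₂ ∷∉ w≢q ∷∉ ∉-nil
      from-Q : ∀ {w} → Q w → w ≢ q → Reach G (Avoids xs₀) w p
      from-Q {w} qw w≢q with w ≟ p
      ... | yes refl = here
      ... | no w≢p = adj-reach (clique qw qp w≢p) (in-Q qw w≢q) (in-Q qp p≢q) here
      reach : ∀ {w} → w ∉ˡ xs₀ → Reach G (Avoids xs₀) w p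
      reach {w} w∉ with cover w
      ... | inj₁ qw = from-Q qw (∉₃ w∉)
      ... | inj₂ (here z) = ⊥-elim (w∉ (here z))
      ... | inj₂ (there (here refl)) = adj-reach c₁~p w∉ (in-Q qp p≢q) here
      ... | inj₂ (there (there (here z))) = ⊥-elim (w∉ (there (here z)))
      ... | inj₂ (there (there (there (here refl)))) = adj-reach c₃~r w∉ (in-Q qr r≢q) (from-Q qr r≢q)

    unique-≁ : Unique-nbr c p → Q q → q ≢ p → ¬ Adj c q
    unique-≁ u qq q≢p c~q = q≢p (Unique-nbr.only u qq c~q)

    -- Three consecutive vertices of the square with unique neighbours in Q; j and o are c₁ and c₂ in either order.
    triple : ∀ {j o q₀ qj qo} → Sq c₀ c₁ c₂ c₃ → (∀ w → w ∈ˡ c₁ ∷ c₂ ∷ [] → w ≡ j ⊎ w ≡ o) → j ≢ c₀ → j ≢ c₃ → o ≢ c₀ → o ≢ c₃ → ¬ Q j → ¬ Q o →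
      Adj j o → Unique-nbr c₀ q₀ → Unique-nbr j qj → Unique-nbr o qo → q₀ ≢ qj → q₀ ≢ qo → qj ≢ qo → Q q → Adj c₃ q → q ≢ qj → Absurd
    triple {c₀} {c₁} {c₂} {c₃} {q} {j} {o} {q₀} {qj} {qo} S cov j≢c₀ j≢c₃ o≢c₀ o≢c₃ ¬Qj ¬Qo j~o u₀ uj uo q₀≢qj q₀≢qo qj≢qo qq c₃~q q≢qj =
      -- The pair is `c₀`, `qj`, non-adjacent because `q₀` is the only clique neighbour of `c₀`, and
      -- `c₃` is deleted with it. The cycles through `c₀` miss `o`, `qj`; those through `qj` miss
      -- `j` and one of `q₀`, `qo`.
      tight-pair (≢Q out₀ Qj) (unique-≁ u₀ Qj (≢-sym q₀≢qj)) (≢-sym (adj-≢ c₃₀)) (Q≢ Qj out₃) (hub qo reach) loose-c₀ loose-qj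
      where
      open Sq S
      Q0 = Unique-nbr.q∈ u₀
      Qj = Unique-nbr.q∈ uj
      Qo = Unique-nbr.q∈ uo
      xs₀ : List V
      xs₀ = c₀ ∷ qj ∷ c₃ ∷ []
      qo∉ : qo ∉ˡ xs₀
      qo∉ = Q≢ Qo out₀ ∷∉ ≢-sym qj≢qo ∷∉ Q≢ Qo out₃ ∷∉ ∉-nil
      o∉ : o ∉ˡ xs₀
      o∉ = o≢c₀ ∷∉ ≢Q ¬Qo Qj ∷∉ o≢c₃ ∷∉ ∉-nil
      from-o : Reach G (Avoids xs₀) o qo
      from-o = adj-reach (Unique-nbr.c~q uo) o∉ qo∉ here
      middle : ∀ {w} → w ∉ˡ xs₀ → w ∈ˡ c₁ ∷ c₂ ∷ [] → Reach G (Avoids xs₀) w qo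
      middle {w} w∉ i with cov w i
      ... | inj₁ refl = adj-reach j~o w∉ o∉ from-o
      ... | inj₂ refl = from-o
      reach : ∀ {w} → w ∉ˡ xs₀ → Reach G (Avoids xs₀) w qo
      reach {w} w∉ with cover w
      ... | inj₂ (here z) = ⊥-elim (w∉ (here z))
      ... | inj₂ (there (here z)) = middle w∉ (here z)
      ... | inj₂ (there (there (here z))) = middle w∉ (there (here z))
      ... | inj₂ (there (there (there (here z)))) = ⊥-elim (w∉ (there (there (here z))))
      ... | inj₁ qw with w ≟ qo
      ...   | yes refl = here
      ...   | no w≢ = adj-reach (clique qw Qo w≢) w∉ qo∉ here
      missing : ∀ {ys} → o ∉ˡ ys → qj ∉ˡ ys → Misses ys
      missing = misses (≢Q ¬Qo Qj) (unique-≁ uo Qj qj≢qo)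
      loose-c₀ : Loose c₀ c₃ qj
      loose-c₀ with q ≟ q₀
      ... | yes refl = triangle (Unique-nbr.c~q u₀) (adj-sym c₃~q) (≢-sym (adj-≢ c₃₀)) (≢-sym q₀≢qj) (Q≢ Qj out₃)
            (missing (o≢c₀ ∷∉ ≢Q ¬Qo Q0 ∷∉ o≢c₃ ∷∉ ∉-nil) (Q≢ Qj out₀ ∷∉ ≢-sym q₀≢qj ∷∉ Q≢ Qj out₃ ∷∉ ∉-nil))
      ... | no q≢q₀ = square (Unique-nbr.c~q u₀) (clique Q0 qq (≢-sym q≢q₀)) (adj-sym c₃~q) (≢Q out₀ qq) (≢-sym (adj-≢ c₃₀)) (Q≢ Q0 out₃)
            (≢-sym q₀≢qj) (≢-sym q≢qj) (Q≢ Qj out₃)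
            (missing (o≢c₀ ∷∉ ≢Q ¬Qo Q0 ∷∉ ≢Q ¬Qo qq ∷∉ o≢c₃ ∷∉ ∉-nil) (Q≢ Qj out₀ ∷∉ ≢-sym q₀≢qj ∷∉ ≢-sym q≢qj ∷∉ Q≢ Qj out₃ ∷∉ ∉-nil))
      loose-qj : Loose qj c₃ c₀
      loose-qj = triangle (clique Qj qq (≢-sym q≢qj)) (adj-sym c₃~q) (Q≢ Qj out₃) (≢Q out₀ qq) (≢-sym (adj-≢ c₃₀)) missing'
        where
        j∉ : j ∉ˡ qj ∷ q ∷ c₃ ∷ []
        j∉ = ≢Q ¬Qj Qj ∷∉ ≢Q ¬Qj qq ∷∉ j≢c₃ ∷∉ ∉-nil
        missing' : Misses (qj ∷ q ∷ c₃ ∷ [])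
        missing' with q ≟ qo
        ... | yes refl = misses (≢Q ¬Qj Q0) (unique-≁ uj Q0 q₀≢qj) j∉ (q₀≢qj ∷∉ q₀≢qo ∷∉ Q≢ Q0 out₃ ∷∉ ∉-nil)
        ... | no q≢qo = misses (≢Q ¬Qj Qo) (unique-≁ uj Qo (≢-sym qj≢qo)) j∉ (≢-sym qj≢qo ∷∉ ≢-sym q≢qo ∷∉ Q≢ Qo out₃ ∷∉ ∉-nil)

    three-unique : ∀ {q₀ q₁ q₂} → Sq c₀ c₁ c₂ c₃ → Unique-nbr c₀ q₀ → Unique-nbr c₁ q₁ → Unique-nbr c₂ q₂ → q₀ ≢ q₁ → q₀ ≢ q₂ → q₁ ≢ q₂ → Absurd
    three-unique {q₁ = q₁} S u₀ u₁ u₂ q₀≢q₁ q₀≢q₂ q₁≢q₂ with nbr₁ (rot (rot S))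
    -- The vertex `j` must have its unique neighbour different from `q`. Since `q₁ ≢ q₂`, at least
    -- one of `c₁` and `c₂` qualifies.
    ... | q , qq , c₃~q with q ≟ q₁
    ...   | no q≢q₁ = triple S (λ { _ (here z) → inj₁ z ; _ (there (here z)) → inj₂ z }) (≢-sym (adj-≢ c₀₁)) c₁≢c₃ (≢-sym c₀≢c₂) (adj-≢ c₂₃) out₁ out₂
                        c₁₂ u₀ u₁ u₂ q₀≢q₁ q₀≢q₂ q₁≢q₂ qq c₃~q q≢q₁
      where open Sq S
    ...   | yes refl = triple S (λ { _ (here z) → inj₂ z ; _ (there (here z)) → inj₁ z }) (≢-sym c₀≢c₂) (adj-≢ c₂₃) (≢-sym (adj-≢ c₀₁)) c₁≢c₃ out₂ out₁
                        (adj-sym c₁₂) u₀ u₂ u₁ q₀≢q₂ q₀≢q₁ (≢-sym q₁≢q₂) qq c₃~q q₁≢q₂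
      where open Sq S

    -- For a third clique vertex `r`, either `c₃` has a neighbour besides `r`, and then
    -- `opposite-pair` makes `r` the unique neighbour of `c₂`, or `r` is the unique neighbour of
    -- `c₃`. Both give three consecutive unique neighbours.
    two-unique : Sq c₀ c₁ c₂ c₃ → Unique-nbr c₀ p → Unique-nbr c₁ q → p ≢ q → Absurd
    two-unique {c₀} {c₁} {c₂} {c₃} {p} {q} S u₀ u₁ p≢q with another S p q
    ... | r , qr , r≢p , r≢q with any? (λ s → Q? s ×-dec (adj? c₃ s ×-dec ¬? (s ≟ r)))
    ...   | yes (s , qs , c₃~s , s≢r) = opposite-pair S qr (Unique-nbr.q∈ u₁) (Unique-nbr.c~q u₁) (≢-sym r≢q) qs c₃~s s≢r
              (λ u → unique-≁ u₀ qr r≢p (Unique-nbr.c~q u)) (λ u₂ → three-unique S u₀ u₁ u₂ p≢q (≢-sym r≢p) (≢-sym r≢q))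
    ...   | no none with nbr₁ (rot (rot S))
    ...     | s , qs , c₃~s with s ≟ r
    ...       | no s≢r = none (s , qs , c₃~s , s≢r)
    ...       | yes refl = three-unique (rot (rot (rot S))) (unique-nbr qs c₃~s (λ {q'} qq' a → decidable-stable (q' ≟ s) (λ ne → none (q' , qq' , a , ne)))) u₀ u₁ r≢p r≢q p≢q

    one-unique : Sq c₀ c₁ c₂ c₃ → Unique-nbr c₀ p → Absurd
    one-unique {c₀} {c₁} {c₂} {c₃} {p} S u₀ with nbr₁ (rot S)
    ... | r , qr , c₂~r with another S r p
    ...   | q , qq , q≢r , q≢p = opposite-pair (rot S) qq qr c₂~r (≢-sym q≢r) (Unique-nbr.q∈ u₀) (Unique-nbr.c~q u₀) (≢-sym q≢p)
              (λ u₁ → two-unique S u₀ u₁ (≢-sym q≢p)) (λ u₃ → two-unique (flip-sq S) u₀ u₃ (≢-sym q≢p))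

    no-square : ¬ Sq c₀ c₁ c₂ c₃
    no-square S with nbr₁ S | nbr₁ (rot (rot S))
    ... | p , qp , c₁~p | r , qr , c₃~r with another S p r
    ...   | q , qq , q≢p , q≢r = opposite-pair S qq qp c₁~p (≢-sym q≢p) qr c₃~r (≢-sym q≢r) (one-unique S) (one-unique (rot (rot S)))

    -- Longer induced cycles: remove the two neighbours p, s of a vertex m of the cycle, and q outside it.
    centre : ∀ {p m s q q' x q''} → Adj p m → Adj s m → p ≢ s → ¬ Adj p s → ¬ Q p → ¬ Q s → ¬ Q m → Q q → Q q' → Q q'' → q ≢ q' → q ≢ q'' →
      Adj m q' → Adj x q'' → ¬ Q x → x ≢ p → x ≢ s →
      (∀ {w} → w ∉ˡ p ∷ s ∷ q ∷ [] → ¬ Q w → w ≢ m → Reach G (Avoids (p ∷ s ∷ q ∷ [])) w x) →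
      Misses (p ∷ m ∷ q' ∷ q ∷ []) → Misses (s ∷ m ∷ q' ∷ q ∷ []) → Absurd
    centre {p} {m} {s} {q} {q'} {x} {q''} p~m s~m p≢s p≁s ¬Qp ¬Qs ¬Qm qq qq' qq'' q≢q' q≢q'' m~q' x~q'' ¬Qx x≢p x≢s arc mp ms =
      tight-pair p≢s p≁s (≢Q ¬Qp qq) (≢Q ¬Qs qq) (hub q' reach)
        (square p~m m~q' (clique qq' qq (≢-sym q≢q')) (≢Q ¬Qp qq') (≢Q ¬Qp qq) (≢Q ¬Qm qq) (adj-≢ s~m) (≢Q ¬Qs qq') (≢Q ¬Qs qq) mp)
        (square s~m m~q' (clique qq' qq (≢-sym q≢q')) (≢Q ¬Qs qq') (≢Q ¬Qs qq) (≢Q ¬Qm qq) (adj-≢ p~m) (≢Q ¬Qp qq') (≢Q ¬Qp qq) ms)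
      where
      xs₀ : List V
      xs₀ = p ∷ s ∷ q ∷ []
      in-Q : ∀ {w} → Q w → w ≢ q → w ∉ˡ xs₀
      in-Q qw w≢q = Q≢ qw ¬Qp ∷∉ Q≢ qw ¬Qs ∷∉ w≢q ∷∉ ∉-nil
      from-Q : ∀ {w} → Q w → w ≢ q → Reach G (Avoids xs₀) w q'
      from-Q {w} qw w≢q with w ≟ q'
      ... | yes refl = here
      ... | no w≢q' = adj-reach (clique qw qq' w≢q') (in-Q qw w≢q) (in-Q qq' (≢-sym q≢q')) here
      x∉ : x ∉ˡ xs₀
      x∉ = x≢p ∷∉ x≢s ∷∉ ≢Q ¬Qx qq ∷∉ ∉-nil
      reach : ∀ {w} → w ∉ˡ xs₀ → Reach G (Avoids xs₀) w q'
      reach {w} w∉ with Q? w | w ≟ m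
      ... | yes qw | _ = from-Q qw (∉₃ w∉)
      ... | no _ | yes refl = adj-reach m~q' w∉ (in-Q qq' (≢-sym q≢q')) here
      ... | no ¬qw | no w≢m = reach-trans (arc w∉ ¬qw w≢m) (adj-reach x~q'' x∉ (in-Q qq'' (≢-sym q≢q'')) (from-Q qq'' (≢-sym q≢q'')))

    -- Five consecutive vertices of an induced cycle; `R` is the remaining arc from `d` back to `u`.
    -- It is empty for a 5-cycle, and then `d` and `u` are adjacent.
    record Long (u a b c d : V) (R : List V) : Set where
      field
        u~a : Adj u a
        a~b : Adj a b
        b~c : Adj b c
        c~d : Adj c d
        u≁b : ¬ Adj u b
        u≁c : ¬ Adj u c
        a≁c : ¬ Adj a c
        a≁d : ¬ Adj a d
        b≁d : ¬ Adj b d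
        u≢b : u ≢ b
        u≢c : u ≢ c
        u≢d : u ≢ d
        a≢c : a ≢ c
        a≢d : a ≢ d
        b≢d : b ≢ d
        outs : ∀ {w} → w ∈ˡ u ∷ a ∷ b ∷ c ∷ d ∷ R → ¬ Q w
        cover : ∀ w → Q w ⊎ w ∈ˡ u ∷ a ∷ b ∷ c ∷ d ∷ R
        apart : ∀ {w} → w ∈ˡ R → w ∉ˡ u ∷ a ∷ b ∷ c ∷ d ∷ []
        R→d : ∀ xs → d ∉ˡ xs → (∀ {w} → w ∈ˡ R → w ∉ˡ xs) → ∀ {w} → w ∈ˡ R → Reach G (Avoids xs) w d
        R→u : ∀ xs → u ∉ˡ xs → (∀ {w} → w ∈ˡ R → w ∉ˡ xs) → ∀ {w} → w ∈ˡ R → Reach G (Avoids xs) w u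
        d→u : ∀ xs → d ∉ˡ xs → u ∉ˡ xs → (∀ {w} → w ∈ˡ R → w ∉ˡ xs) → Reach G (Avoids xs) d u
        nbr : ∀ {w} → w ∈ˡ u ∷ a ∷ b ∷ c ∷ d ∷ [] → ∃ λ q → Q q × Adj w q
        {o} : V
        Qo  : Q o
        u≁o : ¬ Adj u o

    -- With fewer than three vertices outside the cycle, five consecutive cycle vertices
    -- cannot be 2-coloured by neighbours in Q so that non-adjacent ones get different colours.
    no-long : ∀ {u a b c d R} → ¬ Long u a b c d R
    no-long {u} {a} {b} {c} {d} {R} L = κd≢κb κd≡κb
      where
      open Long L
      Qu = outs (here refl)
      Qa = outs (there (here refl))
      Qb = outs (there (there (here refl)))
      Qc = outs (there (there (there (here refl))))
      Qd = outs (there (there (there (there (here refl)))))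
      QR : ∀ {w} → w ∈ˡ R → ¬ Q w
      QR i = outs (there (there (there (there (there i)))))
      nu = nbr (here refl)
      na = nbr (there (here refl))
      nb = nbr (there (there (here refl)))
      nc = nbr (there (there (there (here refl))))
      nd = nbr (there (there (there (there (here refl)))))
      Qκu : Q (proj₁ nu)
      Qκu = proj₁ (proj₂ nu)
      ~κu : Adj u (proj₁ nu)
      ~κu = proj₂ (proj₂ nu)
      Qκa : Q (proj₁ na)
      Qκa = proj₁ (proj₂ na)
      ~κa : Adj a (proj₁ na)
      ~κa = proj₂ (proj₂ na)
      Qκb : Q (proj₁ nb)
      Qκb = proj₁ (proj₂ nb)
      ~κb : Adj b (proj₁ nb)
      ~κb = proj₂ (proj₂ nb)
      Qκc : Q (proj₁ nc)
      Qκc = proj₁ (proj₂ nc)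
      ~κc : Adj c (proj₁ nc)
      ~κc = proj₂ (proj₂ nc)
      Qκd : Q (proj₁ nd)
      Qκd = proj₁ (proj₂ nd)
      ~κd : Adj d (proj₁ nd)
      ~κd = proj₂ (proj₂ nd)
      κu κa κb κc κd : V
      κu = proj₁ nu
      κa = proj₁ na
      κb = proj₁ nb
      κc = proj₁ nc
      κd = proj₁ nd

      R-avoids : ∀ {p s q} → p ∈ˡ u ∷ a ∷ b ∷ c ∷ d ∷ [] → s ∈ˡ u ∷ a ∷ b ∷ c ∷ d ∷ [] → Q q → ∀ {w} → w ∈ˡ R → w ∉ˡ p ∷ s ∷ q ∷ []
      R-avoids p∈ s∈ qq i (here refl) = apart i p∈
      R-avoids p∈ s∈ qq i (there (here refl)) = apart i s∈
      R-avoids p∈ s∈ qq i (there (there (here refl))) = QR i qq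

      centre-a : ∀ {x q q''} → x ≡ c ⊎ x ≡ d → Q q → q ≢ κa → Q q'' → q ≢ q'' → Adj x q'' → Absurd
      centre-a {x} {q} x≡ qq q≢κa qq'' q≢q'' x~ = centre u~a (adj-sym a~b) u≢b u≁b Qu Qb Qa qq Qκa qq'' q≢κa q≢q''
        ~κa x~ (at (λ x → ¬ Q x) Qc Qd) (at (_≢ u) (≢-sym u≢c) (≢-sym u≢d)) (at (_≢ b) (≢-sym (adj-≢ b~c)) (≢-sym b≢d)) arc
        (misses b≢d b≁d (≢-sym u≢b ∷∉ ≢-sym (adj-≢ a~b) ∷∉ ≢Q Qb Qκa ∷∉ ≢Q Qb qq ∷∉ ∉-nil)
          (≢-sym u≢d ∷∉ ≢-sym a≢d ∷∉ ≢Q Qd Qκa ∷∉ ≢Q Qd qq ∷∉ ∉-nil))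
        (misses u≢c u≁c (u≢b ∷∉ adj-≢ u~a ∷∉ ≢Q Qu Qκa ∷∉ ≢Q Qu qq ∷∉ ∉-nil)
          (≢-sym (adj-≢ b~c) ∷∉ ≢-sym a≢c ∷∉ ≢Q Qc Qκa ∷∉ ≢Q Qc qq ∷∉ ∉-nil))
        where
        at : (P : V → Set) → P c → P d → P x
        at P pc pd = [ (λ z → subst P (sym z) pc) , (λ z → subst P (sym z) pd) ]′ x≡
        xs₀ : List V
        xs₀ = u ∷ b ∷ q ∷ []
        c∉ : c ∉ˡ xs₀
        c∉ = ≢-sym u≢c ∷∉ ≢-sym (adj-≢ b~c) ∷∉ ≢Q Qc qq ∷∉ ∉-nil
        d∉ : d ∉ˡ xs₀
        d∉ = ≢-sym u≢d ∷∉ ≢-sym b≢d ∷∉ ≢Q Qd qq ∷∉ ∉-nil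
        d→x : Reach G (Avoids xs₀) d x
        d→x = at (Reach G (Avoids xs₀) d) (adj-reach (adj-sym c~d) d∉ c∉ here) here
        arc : ∀ {w} → w ∉ˡ xs₀ → ¬ Q w → w ≢ a → Reach G (Avoids xs₀) w x
        arc {w} w∉ ¬qw w≢a with cover w
        ... | inj₁ qw = ⊥-elim (¬qw qw)
        ... | inj₂ (here z) = ⊥-elim (w∉ (here z))
        ... | inj₂ (there (here z)) = ⊥-elim (w≢a z)
        ... | inj₂ (there (there (here z))) = ⊥-elim (w∉ (there (here z)))
        ... | inj₂ (there (there (there (here refl)))) = adj-reach c~d c∉ d∉ d→x
        ... | inj₂ (there (there (there (there (here refl))))) = d→x
        ... | inj₂ (there (there (there (there (there i))))) =
                reach-trans (R→d xs₀ d∉ (R-avoids (here refl) (there (there (here refl))) qq) i) d→x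

      centre-b : ∀ {x q q''} → x ≡ u ⊎ x ≡ d → Q q → q ≢ κb → Q q'' → q ≢ q'' → Adj x q'' → Absurd
      centre-b {x} {q} x≡ qq q≢κb qq'' q≢q'' x~ = centre a~b (adj-sym b~c) a≢c a≁c Qa Qc Qb qq Qκb qq'' q≢κb q≢q''
        ~κb x~ (at (λ x → ¬ Q x) Qu Qd) (at (_≢ a) (adj-≢ u~a) (≢-sym a≢d)) (at (_≢ c) u≢c (≢-sym (adj-≢ c~d))) arc
        (misses u≢c u≁c (adj-≢ u~a ∷∉ u≢b ∷∉ ≢Q Qu Qκb ∷∉ ≢Q Qu qq ∷∉ ∉-nil)
          (≢-sym a≢c ∷∉ ≢-sym (adj-≢ b~c) ∷∉ ≢Q Qc Qκb ∷∉ ≢Q Qc qq ∷∉ ∉-nil))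
        (misses a≢d a≁d (a≢c ∷∉ adj-≢ a~b ∷∉ ≢Q Qa Qκb ∷∉ ≢Q Qa qq ∷∉ ∉-nil)
          (≢-sym (adj-≢ c~d) ∷∉ ≢-sym b≢d ∷∉ ≢Q Qd Qκb ∷∉ ≢Q Qd qq ∷∉ ∉-nil))
        where
        at : (P : V → Set) → P u → P d → P x
        at P pu pd = [ (λ z → subst P (sym z) pu) , (λ z → subst P (sym z) pd) ]′ x≡
        xs₀ : List V
        xs₀ = a ∷ c ∷ q ∷ []
        u∉ : u ∉ˡ xs₀
        u∉ = adj-≢ u~a ∷∉ u≢c ∷∉ ≢Q Qu qq ∷∉ ∉-nil
        d∉ : d ∉ˡ xs₀
        d∉ = ≢-sym a≢d ∷∉ ≢-sym (adj-≢ c~d) ∷∉ ≢Q Qd qq ∷∉ ∉-nil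
        R∉ : ∀ {w} → w ∈ˡ R → w ∉ˡ xs₀
        R∉ = R-avoids (there (here refl)) (there (there (there (here refl)))) qq
        d→x : Reach G (Avoids xs₀) d x
        d→x = at (Reach G (Avoids xs₀) d) (d→u xs₀ d∉ u∉ R∉) here
        arc : ∀ {w} → w ∉ˡ xs₀ → ¬ Q w → w ≢ b → Reach G (Avoids xs₀) w x
        arc {w} w∉ ¬qw w≢b with cover w
        ... | inj₁ qw = ⊥-elim (¬qw qw)
        ... | inj₂ (here refl) = reach-trans (reach-sym (d→u xs₀ d∉ u∉ R∉)) d→x
        ... | inj₂ (there (here z)) = ⊥-elim (w∉ (here z))
        ... | inj₂ (there (there (here z))) = ⊥-elim (w≢b z)
        ... | inj₂ (there (there (there (here z)))) = ⊥-elim (w∉ (there (here z)))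
        ... | inj₂ (there (there (there (there (here refl))))) = d→x
        ... | inj₂ (there (there (there (there (there i))))) = reach-trans (R→d xs₀ d∉ R∉ i) d→x

      centre-c : ∀ {q q''} → Q q → q ≢ κc → Q q'' → q ≢ q'' → Adj u q'' → Absurd
      centre-c {q} qq q≢κc qq'' q≢q'' u~ = centre b~c (adj-sym c~d) b≢d b≁d Qb Qd Qc qq Qκc qq'' q≢κc q≢q''
        ~κc u~ Qu u≢b u≢d arc
        (misses a≢d a≁d (adj-≢ a~b ∷∉ a≢c ∷∉ ≢Q Qa Qκc ∷∉ ≢Q Qa qq ∷∉ ∉-nil)
          (≢-sym b≢d ∷∉ ≢-sym (adj-≢ c~d) ∷∉ ≢Q Qd Qκc ∷∉ ≢Q Qd qq ∷∉ ∉-nil))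
        (misses u≢b u≁b (u≢d ∷∉ u≢c ∷∉ ≢Q Qu Qκc ∷∉ ≢Q Qu qq ∷∉ ∉-nil)
          (b≢d ∷∉ adj-≢ b~c ∷∉ ≢Q Qb Qκc ∷∉ ≢Q Qb qq ∷∉ ∉-nil))
        where
        xs₀ : List V
        xs₀ = b ∷ d ∷ q ∷ []
        u∉ : u ∉ˡ xs₀
        u∉ = u≢b ∷∉ u≢d ∷∉ ≢Q Qu qq ∷∉ ∉-nil
        arc : ∀ {w} → w ∉ˡ xs₀ → ¬ Q w → w ≢ c → Reach G (Avoids xs₀) w u
        arc {w} w∉ ¬qw w≢c with cover w
        ... | inj₁ qw = ⊥-elim (¬qw qw)
        ... | inj₂ (here refl) = here
        ... | inj₂ (there (here refl)) = adj-reach (adj-sym u~a) w∉ u∉ here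
        ... | inj₂ (there (there (here z))) = ⊥-elim (w∉ (here z))
        ... | inj₂ (there (there (there (here z)))) = ⊥-elim (w≢c z)
        ... | inj₂ (there (there (there (there (here z))))) = ⊥-elim (w∉ (there (here z)))
        ... | inj₂ (there (there (there (there (there i))))) =
                R→u xs₀ u∉ (R-avoids (there (there (here refl))) (there (there (there (there (here refl))))) qq) i

      Conflict : V → V → Set
      Conflict q₁ q₂ = ∀ {q} → Q q → q ≢ q₁ → q ≢ q₂ → Absurd

      conflict-≢ : ∀ {q₁ q₂} → Conflict q₁ q₂ → q₁ ≢ q₂
      conflict-≢ {q₁} k refl with o ≟ q₁
      ... | no o≢ = k Qo o≢ o≢
      ... | yes refl = k Qκu κu≢o κu≢o
        where
        κu≢o : κu ≢ o
        κu≢o z = u≁o (subst (Adj u) z ~κu)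

      conflict-∈ : ∀ {q q₁ q₂} → Conflict q₁ q₂ → Q q → q ≢ q₁ → q ≡ q₂
      conflict-∈ {q} {q₁} {q₂} k qq q≢ = decidable-stable (q ≟ q₂) (k qq q≢)

      -- The conflicts `ac`, `cu`, `ub`, `bd`, `da` form a cycle of odd length five, which is what
      -- excludes two colours.
      k-ac : Conflict κa κc
      k-ac qq n₁ n₂ = centre-a (inj₁ refl) qq n₁ Qκc n₂ ~κc
      k-ad : Conflict κa κd
      k-ad qq n₁ n₂ = centre-a (inj₂ refl) qq n₁ Qκd n₂ ~κd
      k-bu : Conflict κb κu
      k-bu qq n₁ n₂ = centre-b (inj₁ refl) qq n₁ Qκu n₂ ~κu
      k-bd : Conflict κb κd
      k-bd qq n₁ n₂ = centre-b (inj₂ refl) qq n₁ Qκd n₂ ~κd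
      k-cu : Conflict κc κu
      k-cu qq n₁ n₂ = centre-c qq n₁ Qκu n₂ ~κu

      κu≡κa : κu ≡ κa
      κu≡κa = decidable-stable (κu ≟ κa) (λ ne → conflict-≢ k-cu (sym (conflict-∈ k-ac Qκu ne)))
      κb≡κc : κb ≡ κc
      κb≡κc = conflict-∈ k-ac Qκb (λ z → conflict-≢ k-bu (trans z (sym κu≡κa)))
      κd≡κb : κd ≡ κb
      κd≡κb = trans (conflict-∈ k-ac Qκd (λ z → conflict-≢ k-ad (sym z))) (sym κb≡κc)
      κd≢κb : κd ≢ κb
      κd≢κb z = conflict-≢ k-bd (sym z)

  -- Induced paths from u to z in the simple graph without v and without the edge uz

  module Chordless {u v z : V} (u≢v : u ≢ v) (u≁v : ¬ Adj u v) (u≢z : u ≢ z) (v≢z : v ≢ z) where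

    -- The edge `uz` is removed only in the direction leaving `u`, because the paths of interest
    -- start at `u` and never return to it.
    Link : V → V → Set
    Link x y = Adj x y × x ≢ v × y ≢ v × ¬ (x ≡ u × y ≡ z)

    link? : ∀ x y → Dec (Link x y)
    link? x y = adj? x y ×-dec (¬? (x ≟ v) ×-dec (¬? (y ≟ v) ×-dec ¬? ((x ≟ u) ×-dec (y ≟ z))))

    data IPath : V → List V → Set where
      one  : IPath z []
      link : ∀ {x y ys} → Link x y → x ∉ˡ y ∷ ys → (∀ {w} → w ∈ˡ ys → ¬ Link x w) → IPath y ys → IPath x (y ∷ ys)

    Near : V → V → Set
    Near x w = x ≡ w ⊎ Link x w

    near? : ∀ x w → Dec (Near x w)
    near? x w = (x ≟ w) ⊎-dec link? x w

    -- Joining `x` to the last vertex near it, and forgetting everything before that vertex, leaves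
    -- no chord at `x`.
    attach : ∀ x {y ys} → IPath y ys → Any (Near x) (y ∷ ys) → ∃ (IPath x)
    attach x one (here (inj₁ refl)) = [] , one
    attach x one (here (inj₂ l)) = _ , link l (adj-≢ (proj₁ l) ∷∉ ∉-nil) (λ ()) one
    attach x {y} {y' ∷ ys} P@(link _ _ _ p) hit with Any.any? (near? x) (y' ∷ ys) | hit
    ... | yes later | _ = attach x p later
    ... | no none | there i = ⊥-elim (none i)
    ... | no none | here (inj₁ refl) = _ , P
    ... | no none | here (inj₂ l) = _ , link l (adj-≢ (proj₁ l) ∷∉ (λ i → none (Any.map inj₁ i)))
            (λ i l' → none (Any.map (λ { refl → inj₂ l' }) i)) P

    prepend : ∀ {x e y} → Step x e y → Avoids (u ∷ v ∷ []) e → ∃ (IPath y) → ∃ (IPath x)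
    prepend {x} {e} {y} st av (ys , P) with x ≟ y
    ... | yes refl = ys , P
    ... | no x≢y = attach x P (here (inj₂ ((x≢y , e , st) , ∉₂ (avoids-inc av (step-incˡ st)) ,
                     ∉₂ (avoids-inc av (step-incʳ st)) , (λ q → avoids-inc av (step-incˡ st) (here (proj₁ q))))))

    from-reach : ∀ {x} → Reach G (Avoids (u ∷ v ∷ [])) x z → ∃ (IPath x)
    from-reach here = [] , one
    from-reach (fwd e av r) = prepend (step-ends e) av (from-reach r)
    from-reach (bwd e av r) = prepend (step-sym (step-ends e)) av (from-reach r)

    induced : ∃ (IPath u)
    induced with neighbour u v z (u≢v ∷∉ u≢z ∷∉ ∉-nil)
    ... | s , u~s , s∉ = attach u (proj₂ (from-reach (connected (u ∷ v ∷ []) ℕₚ.≤-refl (≢-sym (adj-≢ u~s) ∷∉ ∉₁ s∉ ∷∉ ∉-nil) (≢-sym u≢z ∷∉ ≢-sym v≢z ∷∉ ∉-nil))))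
            (here (inj₂ (u~s , u≢v , ∉₁ s∉ , λ q → ∉₂ s∉ (proj₂ q))))

    ipath-path : ∀ {x ys} → IPath x ys → ∃ λ es → Path x ys es z
    ipath-path one = [] , []
    ipath-path (link (a , _) x∉ _ p) with ipath-path p
    ... | es , q = _ , cons (proj₂ (proj₂ a)) x∉ q

    ipath-v : ∀ {x ys} → IPath x ys → x ≢ v → v ∉ˡ x ∷ ys
    ipath-v one x≢v = ≢-sym x≢v ∷∉ ∉-nil
    ipath-v (link (_ , _ , y≢v , _) _ _ p) x≢v = ≢-sym x≢v ∷∉ ipath-v p y≢v

    ipath-last : ∀ {x ys} → IPath x ys → z ∈ˡ x ∷ ys
    ipath-last one = here refl
    ipath-last (link _ _ _ p) = there (ipath-last p)

    ipath-reach : ∀ {x ys} → IPath x ys → ∀ xs → (∀ {w} → w ∈ˡ x ∷ ys → w ∉ˡ xs) → ∀ {w} → w ∈ˡ x ∷ ys → Reach G (Avoids xs) w x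
    ipath-reach P xs av (here refl) = here
    ipath-reach (link (a , _) _ _ p) xs av (there i) =
      reach-trans (ipath-reach p xs (λ j → av (there j)) i) (adj-reach (adj-sym a) (av (there (here refl))) (av (here refl)) here)

    chord : ∀ {x y ys} → IPath x (y ∷ ys) → x ≢ v → ∀ {w} → w ∈ˡ ys → ¬ (x ≡ u × w ≡ z) → ¬ Adj x w
    chord P@(link _ _ no-link _) x≢v i not-uz a = no-link i (a , x≢v , (λ { refl → ipath-v P x≢v (there (there i)) }) , not-uz)

    tail-≢v : ∀ {x y ys} → IPath x (y ∷ ys) → y ≢ v
    tail-≢v (link (_ , _ , y≢v , _) _ _ _) = y≢v

    -- The induced path together with an edge `uz` is a cycle avoiding `v`. Two non-adjacent
    -- vertices off it would make `u` loose.
    co-clique : ∀ {x y ys} → IPath u (x ∷ y ∷ ys) → ¬ Loose u z v → ∀ {w w'} → w ∉ˡ u ∷ x ∷ y ∷ ys → w' ∉ˡ u ∷ x ∷ y ∷ ys → w ≢ w' → Adj w w'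
    co-clique {x} {y} {ys} P@(link (u~x , _ , x≢v , _) u∉ _ p) tight {w} {w'} w∉ w'∉ w≢w' = decidable-stable (adj? w w') λ w≁w' →
      tight (inj₂ (nonCover u~x (proj₂ (ipath-path p)) u∉ (ipath-v p x≢v) (x≢z p) w≢w' w≁w' w∉ w'∉))
      where
      x≢z : ∀ {x} → IPath x (y ∷ ys) → x ≢ z
      x≢z (link _ x∉ _ q) refl = x∉ (ipath-last q)

    reach-z : ∀ {x ys} → IPath x ys → ∀ xs → (∀ {w} → w ∈ˡ x ∷ ys → w ∉ˡ xs) → ∀ {w} → w ∈ˡ x ∷ ys → Reach G (Avoids xs) w z
    reach-z P xs av i = reach-trans (ipath-reach P xs av i) (reach-sym (ipath-reach P xs av (ipath-last P)))

    outside? : (cs : List V) (w : V) → w ∉ˡ cs ⊎ w ∈ˡ cs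
    outside? cs w with w ∈ˡ? cs
    ... | yes i = inj₂ i
    ... | no i = inj₁ i

    module LongCase (u~z : Adj u z) (tight : ¬ Loose u z v) {a b c d R}
      (P₀ : IPath u (a ∷ b ∷ c ∷ d ∷ R)) (P₁ : IPath a (b ∷ c ∷ d ∷ R)) (P₂ : IPath b (c ∷ d ∷ R)) (P₃ : IPath c (d ∷ R)) (P₄ : IPath d R)
      (u∉ : u ∉ˡ a ∷ b ∷ c ∷ d ∷ R) (a∉ : a ∉ˡ b ∷ c ∷ d ∷ R) (b∉ : b ∉ˡ c ∷ d ∷ R) (c∉ : c ∉ˡ d ∷ R) where

      cs : List V
      cs = u ∷ a ∷ b ∷ c ∷ d ∷ R

      Q : V → Set
      Q w = w ∉ˡ cs

      z∈ : z ∈ˡ d ∷ R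
      z∈ = ipath-last P₄

      past : ∀ {x w : V} {ys} → x ∉ˡ ys → w ∈ˡ ys → w ≢ x
      past x∉ i refl = x∉ i

      b≢z : b ≢ z
      b≢z refl = b∉ (there z∈)

      c≢z : c ≢ z
      c≢z refl = c∉ z∈

      a≢u : a ≢ u
      a≢u q = ∉₁ u∉ (sym q)

      b≢u : b ≢ u
      b≢u q = ∉₂ u∉ (sym q)

      c≢u : c ≢ u
      c≢u q = ∉₃ u∉ (sym q)

      d≢u : d ≢ u
      d≢u q = u∉ (there (there (there (here (sym q)))))

      u-chord : ∀ {w} → w ∈ˡ b ∷ c ∷ d ∷ R → w ≢ z → ¬ Adj u w
      u-chord i w≢z = chord P₀ u≢v i (λ q → w≢z (proj₂ q))

      a-chord : ∀ {w} → w ∈ˡ c ∷ d ∷ R → ¬ Adj a w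
      a-chord i = chord P₁ (tail-≢v P₀) i (λ q → a≢u (proj₁ q))

      b-chord : ∀ {w} → w ∈ˡ d ∷ R → ¬ Adj b w
      b-chord i = chord P₂ (tail-≢v P₁) i (λ q → b≢u (proj₁ q))

      c-chord : ∀ {w} → w ∈ˡ R → ¬ Adj c w
      c-chord i = chord P₃ (tail-≢v P₂) i (λ q → c≢u (proj₁ q))

      nbr-u : ∃ λ q → Q q × Adj u q
      nbr-u with neighbour u a z (∉₁ u∉ ∷∉ u≢z ∷∉ ∉-nil)
      ... | y , u~y , y∉ = y , (λ { (here q) → adj-≢ u~y (sym q) ; (there (here q)) → y∉ (here q) ; (there (there i)) → u-chord i (∉₂ y∉) u~y }) , u~y

      nbr-a : ∃ λ q → Q q × Adj a q
      nbr-a with neighbour a u b (a≢u ∷∉ ∉₁ a∉ ∷∉ ∉-nil)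
      ... | y , a~y , y∉ = y , (λ { (here q) → y∉ (here q) ; (there (here q)) → adj-≢ a~y (sym q) ; (there (there (here q))) → y∉ (there (here q))
                                  ; (there (there (there i))) → a-chord i a~y }) , a~y

      nbr-b : ∃ λ q → Q q × Adj b q
      nbr-b with neighbour b a c (≢-sym (∉₁ a∉) ∷∉ ∉₁ b∉ ∷∉ ∉-nil)
      ... | y , b~y , y∉ = y , (λ { (here refl) → u-chord (here refl) b≢z (adj-sym b~y) ; (there (here q)) → y∉ (here q) ; (there (there (here q))) → adj-≢ b~y (sym q)
                                  ; (there (there (there (here q)))) → y∉ (there (here q)) ; (there (there (there (there i)))) → b-chord i b~y }) , b~y

      nbr-c : ∃ λ q → Q q × Adj c q
      nbr-c with neighbour c b d (≢-sym (∉₁ b∉) ∷∉ ∉₁ c∉ ∷∉ ∉-nil)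
      ... | y , c~y , y∉ = y , (λ { (here refl) → u-chord (there (here refl)) c≢z (adj-sym c~y) ; (there (here refl)) → a-chord (here refl) (adj-sym c~y)
                                  ; (there (there (here q))) → y∉ (here q) ; (there (there (there (here q)))) → adj-≢ c~y (sym q)
                                  ; (there (there (there (there (here q))))) → y∉ (there (here q)) ; (there (there (there (there (there i))))) → c-chord i c~y }) , c~y

      d-front : ∀ {y} → Adj d y → y ≢ c → (u ≡ y → Absurd) → y ∉ˡ R → Q y
      d-front d~y y≢c u≢y y∉R (here q) = u≢y (sym q)
      d-front d~y y≢c u≢y y∉R (there (here refl)) = a-chord (there (here refl)) (adj-sym d~y)
      d-front d~y y≢c u≢y y∉R (there (there (here refl))) = b-chord (here refl) (adj-sym d~y)
      d-front d~y y≢c u≢y y∉R (there (there (there (here q)))) = y≢c q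
      d-front d~y y≢c u≢y y∉R (there (there (there (there (here q))))) = adj-≢ d~y (sym q)
      d-front d~y y≢c u≢y y∉R (there (there (there (there (there i))))) = y∉R i

      -- The cycle neighbour of d other than c is the head of R, or u when d = z.
      nbr-d : ∀ {S} → IPath d S → R ≡ S → ∃ λ q → Q q × Adj d q
      nbr-d one refl with neighbour d c u (≢-sym (∉₁ c∉) ∷∉ d≢u ∷∉ ∉-nil)
      ... | y , d~y , y∉ = y , d-front d~y (∉₁ y∉) (λ q → ∉₂ y∉ (sym q)) (λ ()) , d~y
      nbr-d P'@(link {y = y'} _ d∉ _ P'') refl with neighbour d c y' (≢-sym (∉₁ c∉) ∷∉ ∉₁ d∉ ∷∉ ∉-nil)
      ... | y , d~y , y∉ = y , d-front d~y (∉₁ y∉) (λ { refl → u-chord (there (there (here refl))) (λ { refl → d∉ (ipath-last P'') }) (adj-sym d~y) })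
              (λ { (here q) → ∉₂ y∉ q ; (there i) → chord P' (tail-≢v P₃) i (λ q → d≢u (proj₁ q)) d~y }) , d~y

      R→u : ∀ {x ys} → IPath x ys → ∀ xs → u ∉ˡ xs → (∀ {w} → w ∈ˡ ys → w ∉ˡ xs) → ∀ {w} → w ∈ˡ ys → Reach G (Avoids xs) w u
      R→u (link _ _ _ p) xs u∉' av i = reach-trans (reach-z p xs av i) (adj-reach (adj-sym u~z) (av (ipath-last p)) u∉' here)

      ∷-avoids : ∀ {xs} → d ∉ˡ xs → (∀ {w} → w ∈ˡ R → w ∉ˡ xs) → ∀ {w} → w ∈ˡ d ∷ R → w ∉ˡ xs
      ∷-avoids d∉ av (here refl) = d∉
      ∷-avoids d∉ av (there i) = av i

      head-∉ : ∀ {x ys w} → IPath x ys → w ∈ˡ ys → w ≢ x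
      head-∉ (link _ x∉ _ _) = past x∉

      open Clique Q (λ w → ¬? (w ∈ˡ? cs)) (co-clique P₀ tight)

      absurd : (Adj u a × Adj a b × Adj b c × Adj c d) → Absurd
      absurd (u~a , a~b , b~c , c~d) = no-long record
        { u~a = u~a ; a~b = a~b ; b~c = b~c ; c~d = c~d
        ; u≁b = u-chord (here refl) b≢z ; u≁c = u-chord (there (here refl)) c≢z
        ; a≁c = a-chord (here refl) ; a≁d = a-chord (there (here refl)) ; b≁d = b-chord (here refl)
        ; u≢b = ≢-sym b≢u ; u≢c = ≢-sym c≢u ; u≢d = ≢-sym d≢u ; a≢c = ∉₂ a∉ ; a≢d = ∉₃ a∉ ; b≢d = ∉₂ b∉
        ; outs = λ i q → q i
        ; cover = outside? cs
        ; apart = λ i → past u∉ (there (there (there (there i)))) ∷∉ past a∉ (there (there (there i))) ∷∉ past b∉ (there (there i))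
                          ∷∉ past c∉ (there i) ∷∉ head-∉ P₄ i ∷∉ ∉-nil
        ; R→d = λ xs d∉ av i → ipath-reach P₄ xs (∷-avoids d∉ av) (there i)
        ; R→u = R→u P₄
        ; d→u = λ xs d∉ u∉' av → reach-trans (reach-z P₄ xs (∷-avoids d∉ av) (here refl)) (adj-reach (adj-sym u~z) (∷-avoids d∉ av z∈) u∉' here)
        ; nbr = λ { (here refl) → nbr-u ; (there (here refl)) → nbr-a ; (there (there (here refl))) → nbr-b ; (there (there (there (here refl)))) → nbr-c
                  ; (there (there (there (there (here refl))))) → nbr-d P₄ refl }
        ; o = v
        ; Qo = ipath-v P₀ u≢v
        ; u≁o = u≁v
        }

    -- The cases follow the length of the induced path. One edge is impossible because `uz` was
    -- removed; two edges give the triangle, three an induced square, and four or more a long cycle.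
    tight⇒tri : Adj u z → ¬ Loose u z v → ∃ λ s → Tri u s z
    tight⇒tri u~z tight = go (proj₂ induced)
      where
      go : ∀ {ys} → IPath u ys → ∃ λ s → Tri u s z
      go one = ⊥-elim (u≢z refl)
      go (link (_ , _ , _ , not-uz) _ _ one) = ⊥-elim (not-uz (refl , refl))
      go P@(link {y = s} l _ _ (link l' _ _ one)) = s , tri (proj₁ l) u~z (proj₁ l') (co-clique P tight)
      go P@(link {y = a} l u∉ _ P₁@(link {y = b} l' a∉ _ (link l'' _ _ one))) = ⊥-elim (no-square (sq (proj₁ l) (proj₁ l') (proj₁ l'') (adj-sym u~z) (∉₂ u∉) (∉₂ a∉)
          (chord P u≢v (here refl) (λ q → adj-≢ (proj₁ l'') (proj₂ q))) (chord P₁ (tail-≢v P) (here refl) (λ q → ∉₁ u∉ (sym (proj₁ q))))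
          (λ q → q (here refl)) (λ q → q (there (here refl))) (λ q → q (there (there (here refl)))) (λ q → q (there (there (there (here refl)))))
          (outside? (u ∷ a ∷ b ∷ z ∷ []))))
        where open Clique (_∉ˡ u ∷ a ∷ b ∷ z ∷ []) (λ w → ¬? (w ∈ˡ? _)) (co-clique P tight)
      go P@(link l u∉ _ P₁@(link l' a∉ _ P₂@(link l'' b∉ _ P₃@(link l₃ c∉ _ P₄)))) =
        ⊥-elim (LongCase.absurd u~z tight P P₁ P₂ P₃ P₄ u∉ a∉ b∉ c∉ (proj₁ l , proj₁ l' , proj₁ l'' , proj₁ l₃))

  -- Growing a connected vertex set until a single vertex is left

  module _ {u v : V} (u≢v : u ≢ v) where

    private
      Inside : List V → E → Set
      Inside L e = src G e ∈ˡ L × tgt G e ∈ˡ L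

      step-inside : ∀ {x e y L} → Step x e y → x ∈ˡ L → y ∈ˡ L → Inside L e
      step-inside (inj₁ (refl , refl)) x∈ y∈ = x∈ , y∈
      step-inside (inj₂ (refl , refl)) x∈ y∈ = y∈ , x∈

      Result : Set
      Result = ∃ λ z → z ∉ˡ u ∷ v ∷ [] × ConnectedOff (u ∷ v ∷ z ∷ [])

      module _ {r} (r∉ : r ∉ˡ u ∷ v ∷ []) where

        record Blob (L : List V) : Set where
          field
            unique : Unique L
            r∈     : r ∈ˡ L
            off    : ∀ {w} → w ∈ˡ L → w ∉ˡ u ∷ v ∷ []
            reach  : ∀ {w} → w ∈ˡ L → Reach G (Inside L) w r

        last-vertex : ∀ {L z} → Blob L → z ∉ˡ u ∷ v ∷ L → 3 + length L ≡ n → ConnectedOff (u ∷ v ∷ z ∷ [])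
        last-vertex {L} {z} B z∉ eq = hub r (λ w∉ → reach-mono (λ { (i , j) → off' i , off' j }) (reach (in-L w∉)))
          where
          open Blob B
          off' : ∀ {w} → w ∈ˡ L → w ∉ˡ u ∷ v ∷ z ∷ []
          off' i = ∉₁ (off i) ∷∉ ∉₂ (off i) ∷∉ (λ { refl → z∉ (there (there i)) }) ∷∉ ∉-nil
          in-L : ∀ {w} → w ∉ˡ u ∷ v ∷ z ∷ [] → w ∈ˡ L
          in-L {w} w∉ = decidable-stable (w ∈ˡ? L) λ w∉L → ℕₚ.<⇒≱ (ℕₚ.≤-refl {suc n})
              (subst (_≤ n) (trans (∣⟦⟧∣ (all w∉L)) (cong suc eq)) (∣p∣≤n ⟦ w ∷ z ∷ u ∷ v ∷ L ⟧))
            where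
            all : w ∉ˡ L → Unique (w ∷ z ∷ u ∷ v ∷ L)
            all w∉L = _∷_ (∉⇒All≢ (∉₃ w∉ ∷∉ ∉₁ w∉ ∷∉ ∉₂ w∉ ∷∉ w∉L)) (_∷_ (∉⇒All≢ z∉)
              (_∷_ (∉⇒All≢ (u≢v ∷∉ (λ i → off i (here refl)))) (_∷_ (∉⇒All≢ (λ i → off i (there (here refl)))) unique)))

        enlarge : ∀ {L w} → Blob L → w ∉ˡ u ∷ v ∷ L → ∃ λ y → Blob (y ∷ L)
        enlarge {L} {w} B w∉ with reach-cross {U = _∈ˡ L} (λ x → x ∈ˡ? L)
            (connected (u ∷ v ∷ []) ℕₚ.≤-refl r∉ (∉₁ w∉ ∷∉ ∉₂ w∉ ∷∉ ∉-nil)) (Blob.r∈ B) (λ i → w∉ (there (there i)))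
        ... | x , e , y , st , av , x∈ , y∉ = y , record
          { unique = _∷_ (∉⇒All≢ y∉) unique
          ; r∈ = there r∈
          ; off = λ { (here refl) → avoids-inc av (step-incʳ st) ; (there i) → off i }
          ; reach = λ { (here refl) → reach-step (step-sym st) (step-inside st (there x∈) (here refl)) (mono (reach x∈)) ; (there i) → mono (reach i) }
          }
          where
          open Blob B
          mono : ∀ {a b} → Reach G (Inside L) a b → Reach G (Inside (y ∷ L)) a b
          mono = reach-mono (λ { (i , j) → there i , there j })

        -- The set keeps growing inside `G − {u, v}` until one vertex is left over. Deleting that
        -- vertex is harmless, since the set was connected at every stage.
        grow-blob : ∀ k {L} → Blob L → 3 + length L + k ≡ n → Result
        grow-blob k {L} B eq with ∃-fresh (u ∷ v ∷ L) (subst (3 + length L ≤_) eq (ℕₚ.m≤m+n _ k))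
        grow-blob zero B eq | z , z∉ = z , (∉₁ z∉ ∷∉ ∉₂ z∉ ∷∉ ∉-nil) , last-vertex B z∉ (trans (sym (ℕₚ.+-identityʳ _)) eq)
        grow-blob (suc k) {L} B eq | w , w∉ with enlarge B w∉
        ... | y , B' = grow-blob k B' (trans (sym (ℕₚ.+-suc (3 + length L) k)) eq)

    non-cut : ∃ λ z → z ∉ˡ u ∷ v ∷ [] × ConnectedOff (u ∷ v ∷ z ∷ [])
    non-cut with fresh (u ∷ v ∷ []) (s≤s (s≤s (s≤s z≤n)))
    -- The offset four accounts for `u`, `v`, the initial vertex `r` and the vertex left over at the
    -- end.
    ... | r , r∉ = grow-blob r∉ (n ∸ 4)
            (record { unique = unique₁ ; r∈ = here refl ; off = λ { (here refl) → r∉ } ; reach = λ { (here refl) → here } })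
            (ℕₚ.m+[n∸m]≡n (ℕₚ.≤-trans (s≤s (s≤s (s≤s (s≤s z≤n)))) 7≤n))

  -- Looseness is not decided, so the tight vertex of the pair is found only up to double negation;
  -- all uses have a contradiction as goal.
  exists-tri : u ≢ v → ¬ Adj u v → ¬ ¬ (∃ λ c → ∃ λ d → ∃ λ e → Tri c d e)
  exists-tri {u} {v} u≢v u≁v none with non-cut u≢v
  ... | z , z∉ , conn = at-u λ lu → at-v λ lv → tight-pair u≢v u≁v u≢z v≢z conn lu lv
    where
    u≢z : u ≢ z
    u≢z = ≢-sym (∉₁ z∉)
    v≢z : v ≢ z
    v≢z = ≢-sym (∉₂ z∉)
    at-u : ¬ ¬ Loose u z v
    at-u tight = none (u , _ , z , proj₂ (Chordless.tight⇒tri u≢v u≁v u≢z v≢z (decidable-stable (adj? u z) (λ a → tight (inj₁ a))) tight))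
    at-v : ¬ ¬ Loose v z u
    at-v tight = none (v , _ , z , proj₂ (Chordless.tight⇒tri (≢-sym u≢v) (λ a → u≁v (adj-sym a)) v≢z u≢z (decidable-stable (adj? v z) (λ a → tight (inj₁ a))) tight))

  -- Configurations of non-adjacent pairs

  NonAdj : V → V → Set
  NonAdj x y = x ≢ y × ¬ Adj x y

  nonAdj? : ∀ x y → Dec (NonAdj x y)
  nonAdj? x y = ¬? (x ≟ y) ×-dec ¬? (adj? x y)

  nonAdj-sym : NonAdj a b → NonAdj b a
  nonAdj-sym (ne , na) = ≢-sym ne , λ z → na (adj-sym z)

  module _ (T : Tri c d e) where

    private
      Ts : List V
      Ts = c ∷ d ∷ e ∷ []

    rename : x ∈ˡ Ts → ∃ λ d' → ∃ λ e' → Tri x d' e' × (∀ {w} → w ∉ˡ Ts → w ∉ˡ x ∷ d' ∷ e' ∷ [])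
    rename (here refl) = _ , _ , T , λ i → i
    rename (there (here refl)) = _ , _ , tri-swap₁₂ T , swap₁₂
    rename (there (there (here refl))) = _ , _ , tri-swap₁₂ (tri-swap₂₃ T) , λ i → swap₁₂ (swap₂₃ i)

    rename₂ : a ∈ˡ Ts → b ∈ˡ Ts → a ≢ b → ∃ λ f → Tri a b f × (∀ {w} → w ∉ˡ Ts → w ∉ˡ a ∷ b ∷ f ∷ [])
    rename₂ (here refl) (here refl) ne = ⊥-elim (ne refl)
    rename₂ (here refl) (there (here refl)) ne = _ , T , λ i → i
    rename₂ (here refl) (there (there (here refl))) ne = _ , tri-swap₂₃ T , swap₂₃
    rename₂ (there (here refl)) (here refl) ne = _ , tri-swap₁₂ T , swap₁₂
    rename₂ (there (here refl)) (there (here refl)) ne = ⊥-elim (ne refl)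
    rename₂ (there (here refl)) (there (there (here refl))) ne = _ , tri-swap₂₃ (tri-swap₁₂ T) , λ i → swap₂₃ (swap₁₂ i)
    rename₂ (there (there (here refl))) (here refl) ne = _ , tri-swap₁₂ (tri-swap₂₃ T) , λ i → swap₁₂ (swap₂₃ i)
    rename₂ (there (there (here refl))) (there (here refl)) ne = _ , tri-swap₂₃ (tri-swap₁₂ (tri-swap₂₃ T)) , λ i → swap₂₃ (swap₁₂ (swap₂₃ i))
    rename₂ (there (there (here refl))) (there (there (here refl))) ne = ⊥-elim (ne refl)

    inside-adj : a ∈ˡ Ts → b ∈ˡ Ts → a ≢ b → Adj a b
    inside-adj a∈ b∈ ne = Tri.c~d (proj₁ (proj₂ (rename₂ a∈ b∈ ne)))

    sides : NonAdj a b → (a ∈ˡ Ts × b ∉ˡ Ts) ⊎ (b ∈ˡ Ts × a ∉ˡ Ts)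
    sides {a} {b} (ne , na) with a ∈ˡ? Ts | b ∈ˡ? Ts
    ... | yes a∈ | no b∉ = inj₁ (a∈ , b∉)
    ... | no a∉ | yes b∈ = inj₂ (b∈ , a∉)
    ... | yes a∈ | yes b∈ = ⊥-elim (na (inside-adj a∈ b∈ ne))
    ... | no a∉ | no b∉ = ⊥-elim (na (Tri.clique T a∉ b∉ ne))

    disjoint-out : a ∈ˡ Ts → b ∉ˡ Ts → w ∈ˡ Ts → x ∉ˡ Ts → a ≢ w → b ≢ x → ¬ Adj a b → ¬ Adj w x → Absurd
    disjoint-out a∈ b∉ w∈ x∉ a≢w b≢x a≁b w≁x with rename₂ a∈ w∈ a≢w
    ... | f , T' , out = no-two-missing (twoMissing T' (out b∉) (out x∉) b≢x a≁b w≁x)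

    tri-disjoint : NonAdj a b → NonAdj w x → a ≢ w → a ≢ x → b ≢ w → b ≢ x → Absurd
    tri-disjoint ab wx a≢w a≢x b≢w b≢x with sides ab | sides wx
    ... | inj₁ (a∈ , b∉) | inj₁ (w∈ , x∉) = disjoint-out a∈ b∉ w∈ x∉ a≢w b≢x (proj₂ ab) (proj₂ wx)
    ... | inj₁ (a∈ , b∉) | inj₂ (x∈ , w∉) = disjoint-out a∈ b∉ x∈ w∉ a≢x b≢w (proj₂ ab) (proj₂ (nonAdj-sym wx))
    ... | inj₂ (b∈ , a∉) | inj₁ (w∈ , x∉) = disjoint-out b∈ a∉ w∈ x∉ b≢w a≢x (proj₂ (nonAdj-sym ab)) (proj₂ wx)
    ... | inj₂ (b∈ , a∉) | inj₂ (x∈ , w∉) = disjoint-out b∈ a∉ x∈ w∉ b≢x a≢w (proj₂ (nonAdj-sym ab)) (proj₂ (nonAdj-sym wx))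

    -- Every non-adjacent pair has one vertex in the triangle and one in the clique, so these pairs
    -- form a bipartite graph, which has no triangle.
    tri-triangle : NonAdj a b → NonAdj b w → NonAdj a w → Absurd
    tri-triangle ab bw aw with sides ab | sides aw
    ... | inj₁ (_ , b∉) | inj₁ (_ , w∉) = proj₂ bw (Tri.clique T b∉ w∉ (proj₁ bw))
    ... | inj₂ (b∈ , _) | inj₂ (w∈ , _) = proj₂ bw (inside-adj b∈ w∈ (proj₁ bw))
    ... | inj₁ (a∈ , _) | inj₂ (_ , a∉) = a∉ a∈
    ... | inj₂ (_ , a∉) | inj₁ (a∈ , _) = a∉ a∈

    tri-star : NonAdj x a → NonAdj x b → NonAdj x w → a ≢ b → a ≢ w → b ≢ w → Absurd
    tri-star {x} {a} {b} {w} xa xb xw a≢b a≢w b≢w with sides xa | sides xb | sides xw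
    ... | inj₁ (x∈ , a∉) | inj₁ (_ , b∉) | inj₁ (_ , w∉) with rename x∈
    ...   | _ , _ , T' , out = no-star-out T' (out a∉) (out b∉) (out w∉) a≢b a≢w b≢w (proj₂ xa) (proj₂ xb) (proj₂ xw)
    tri-star {w = w} xa xb xw a≢b a≢w b≢w | inj₂ (a∈ , x∉) | inj₂ (b∈ , _) | inj₂ (w∈ , _) with rename₂ a∈ b∈ a≢b
    ...   | f , T' , out with w ≟ f
    ...     | yes refl = no-star-in T' (out x∉) (proj₂ (nonAdj-sym xa)) (proj₂ (nonAdj-sym xb)) (proj₂ (nonAdj-sym xw))
    ...     | no w≢f = proj₂ (nonAdj-sym xw) (Tri.clique T' (≢-sym a≢w ∷∉ ≢-sym b≢w ∷∉ w≢f ∷∉ ∉-nil) (out x∉) (proj₁ (nonAdj-sym xw)))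
    tri-star xa xb xw a≢b a≢w b≢w | inj₁ (x∈ , _) | inj₂ (_ , x∉) | _ = x∉ x∈
    tri-star xa xb xw a≢b a≢w b≢w | inj₂ (_ , x∉) | inj₁ (x∈ , _) | _ = x∉ x∈
    tri-star xa xb xw a≢b a≢w b≢w | inj₁ (x∈ , _) | _ | inj₂ (_ , x∉) = x∉ x∈
    tri-star xa xb xw a≢b a≢w b≢w | inj₂ (_ , x∉) | _ | inj₁ (x∈ , _) = x∉ x∈

  no-disjoint : NonAdj a b → NonAdj w x → a ≢ w → a ≢ x → b ≢ w → b ≢ x → Absurd
  no-disjoint ab wx p q r s = exists-tri (proj₁ ab) (proj₂ ab) λ { (_ , _ , _ , T) → tri-disjoint T ab wx p q r s }

  no-triangle : NonAdj a b → NonAdj b w → NonAdj a w → Absurd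
  no-triangle ab bw aw = exists-tri (proj₁ ab) (proj₂ ab) λ { (_ , _ , _ , T) → tri-triangle T ab bw aw }

  no-star : NonAdj x a → NonAdj x b → NonAdj x w → a ≢ b → a ≢ w → b ≢ w → Absurd
  no-star xa xb xw p q r = exists-tri (proj₁ xa) (proj₂ xa) λ { (_ , _ , _ , T) → tri-star T xa xb xw p q r }

  -- Any two missing edges share a vertex, and neither a triangle nor a star of three missing edges
  -- occurs. So at most two edges are missing, and two of them form a path.
  short-path : SiIsKnMinusShortPath G
  short-path with any? (λ u → any? (λ v → nonAdj? u v))
  ... | no none = proj₁ (fresh [] (s≤s z≤n)) ∷ [] , s≤s z≤n , s≤s z≤n , unique₁ ,
        λ u v u≢v → mk⇔ (λ _ ()) (λ _ → decidable-stable (adj? u v) (λ na → none (u , v , u≢v , na)))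
  ... | yes (u , v , uv) with any? (λ x → any? (λ y → nonAdj? x y ×-dec ¬? (((u ≟ x) ×-dec (v ≟ y)) ⊎-dec ((u ≟ y) ×-dec (v ≟ x)))))
  ...   | no none = u ∷ v ∷ [] , s≤s z≤n , s≤s (s≤s z≤n) , unique₂ (proj₁ uv) ,
        λ x y x≢y → mk⇔
          (λ { xy (inj₁ (inj₁ (refl , refl))) → proj₂ uv xy ; xy (inj₁ (inj₂ (refl , refl))) → proj₂ uv (adj-sym xy) })
          (λ off → decidable-stable (adj? x y) (λ na → none (x , y , (x≢y , na) , λ on → off (inj₁ on))))
  ...   | yes (x , y , xy , other) = centred (u ≟ x) (u ≟ y) (v ≟ x) (v ≟ y)
    where
    two : ∀ {a b c} → NonAdj a b → NonAdj b c → a ≢ c → SiIsKnMinusShortPath G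
    two {a} {b} {c} ab bc a≢c = a ∷ b ∷ c ∷ [] , s≤s z≤n , s≤s (s≤s (s≤s z≤n)) ,
        _∷_ (∉⇒All≢ (proj₁ ab ∷∉ a≢c ∷∉ ∉-nil)) (unique₂ (proj₁ bc)) ,
        λ p q p≢q → mk⇔
          (λ { pq (inj₁ (inj₁ (refl , refl))) → proj₂ ab pq ; pq (inj₁ (inj₂ (refl , refl))) → proj₂ ab (adj-sym pq)
             ; pq (inj₂ (inj₁ (inj₁ (refl , refl)))) → proj₂ bc pq ; pq (inj₂ (inj₁ (inj₂ (refl , refl)))) → proj₂ bc (adj-sym pq) })
          (λ off → decidable-stable (adj? p q) (λ na → third (p≢q , na) off))
      where
      from-b : ∀ {q} → NonAdj b q → a ≢ q → c ≢ q → Absurd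
      from-b bq a≢q c≢q = no-star (nonAdj-sym ab) bc bq a≢c a≢q c≢q
      third : ∀ {p q} → NonAdj p q → ¬ OnPath (a ∷ b ∷ c ∷ []) p q → Absurd
      third {p} {q} pq off with b ≟ p | b ≟ q
      ... | yes refl | _ = from-b pq (λ { refl → off (inj₁ (inj₂ (refl , refl))) }) (λ { refl → off (inj₂ (inj₁ (inj₁ (refl , refl)))) })
      ... | no _ | yes refl = from-b (nonAdj-sym pq) (λ { refl → off (inj₁ (inj₁ (refl , refl))) }) (λ { refl → off (inj₂ (inj₁ (inj₂ (refl , refl)))) })
      ... | no b≢p | no b≢q with a ≟ p | a ≟ q | c ≟ p | c ≟ q
      ...   | no a≢p | no a≢q | _ | _ = no-disjoint ab pq a≢p a≢q b≢p b≢q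
      ...   | _ | _ | no c≢p | no c≢q = no-disjoint bc pq b≢p b≢q c≢p c≢q
      ...   | yes refl | _ | _ | yes refl = no-triangle ab bc pq
      ...   | _ | yes refl | yes refl | _ = no-triangle ab bc (nonAdj-sym pq)
      ...   | yes refl | _ | yes refl | _ = a≢c refl
      ...   | _ | yes refl | _ | yes refl = a≢c refl
    centred : Dec (u ≡ x) → Dec (u ≡ y) → Dec (v ≡ x) → Dec (v ≡ y) → SiIsKnMinusShortPath G
    centred (yes refl) _ _ _ = two (nonAdj-sym uv) xy (λ q → other (inj₁ (refl , q)))
    centred (no _) (yes refl) _ _ = two (nonAdj-sym uv) (nonAdj-sym xy) (λ q → other (inj₂ (refl , q)))
    centred (no _) (no u≢y) (yes refl) _ = two uv xy u≢y
    centred (no u≢x) (no _) (no _) (yes refl) = two uv (nonAdj-sym xy) u≢x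
    centred (no u≢x) (no u≢y) (no v≢x) (no v≢y) = ⊥-elim (no-disjoint uv xy u≢x u≢y v≢x v≢y)

theorem5p1 : (G : Graph) (cls : EdgeSet G → Cls G) → IsQuasiBiased G cls
    → M3Connected G cls → Unbreakable G cls → Graph3Connected G
    → 7 ≤ Graph.n G → SiIsKnMinusShortPath G
theorem5p1 G cls (theta , meets) _ (_ , flats) (4≤n , conn) 7≤n = Shape.short-path G cls
  (record { theta-closed = theta ; 𝓛-meets-𝓕 = meets }) (record { contraction-connected = flats })
  (record { 4≤n = 4≤n ; connected-off = conn }) 7≤n
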